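{- If $n\geq 4$ is even, then \[\mathsf{g}(K_n^3)=\frac{(n-2)(n+3)(n-4)}{24}.\] If $n\geq 6$ is even, then \[\widetilde{\mathsf{g}}(K_n^3)=\frac{(n-2)(n+3)(n-4)}{12}.\]
   Context: For a graph $G$, $\mathsf{g}(G)$ denotes the orientable genus of $G$: the minimum $h$ such that $G$ embeds in the orientable surface of genus $h$. $\widetilde{\mathsf{g}}(G)$ denotes the non-orientable genus: the minimum $c$ such that $G$ embeds in the non-orientable surface with $c$ crosscaps, with the convention $\widetilde{\mathsf{g}}(G)=0$ if $G$ is planar. For a hypergraph $H$, its Levi graph $L_H$ is the bipartite graph with vertex set $V(H)\sqcup E(H)$ in which $v\in V(H)$ and $e\in E(H)$ are adjacent if and only if $v\in e$. The genus (resp. non-orientable genus) of a hypergraph $H$ is defined as that of its Levi graph: $\mathsf{g}(H)=\mathsf{g}(L_H)$, $\widetilde{\mathsf{g}}(H)=\widetilde{\mathsf{g}}(L_H)$. $K_n^3$ denotes the complete $3$-uniform hypergraph with vertex set $[n]=\{1,\dots,n\}$ whose edges are all $3$-element subsets of $[n]$. -}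

module Defs where

open import Data.Bool using (Bool; T; not)
open import Data.Empty using (⊥)
open import Data.Fin using (Fin)
open import Data.Fin.Patterns using (0F; 1F; 2F)
open import Data.Fin.Subset using (Subset; _∈_; ∣_∣)
open import Data.Integer as ℤ using (ℤ; +_)
open import Data.Nat using (ℕ; _*_; _≤_; _≡ᵇ_)
open import Data.Product using (Σ; ∃; _×_; _,_)
open import Data.Sum using (_⊎_; inj₁; inj₂)
open import Data.Unit using (⊤)
open import Function.Bundles using (_↔_; Inverse)
open import Function.Definitions using (Injective)
open import Relation.Binary.Construct.Closure.Equivalence using (EqClosure) renaming (setoid to closureSetoid)
open import Relation.Binary.Core using (Rel)
open import Relation.Binary.Definitions using (Symmetric)
open import Relation.Binary.PropositionalEquality using (_≡_; _≢_; setoid)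
open import Relation.Nullary using (¬_)

------------------------------------------------------------------------
-- Graphs and hypergraphs

record Graph : Set₁ where
  field
    Vertex  : Set
    Adj     : Rel Vertex _
    adj-sym : Symmetric Adj
    no-loop : ∀ v → ¬ Adj v v

-- A hypergraph on the vertex set Fin n is a set of subsets of Fin n, given by
-- its Boolean characteristic function, so that T (H e) is a proposition and
-- every edge occurs once.
Hypergraph : ℕ → Set
Hypergraph n = Subset n → Bool

Edge : ∀ {n} → Hypergraph n → Set
Edge {n} H = Σ (Subset n) λ e → T (H e)

completeUniform : (r n : ℕ) → Hypergraph n
completeUniform r n e = ∣ e ∣ ≡ᵇ r

module _ {n : ℕ} (H : Hypergraph n) where

  LeviAdj : Rel (Fin n ⊎ Edge H) _
  LeviAdj (inj₁ v)       (inj₂ (e , _)) = v ∈ e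
  LeviAdj (inj₂ (e , _)) (inj₁ v)       = v ∈ e
  LeviAdj (inj₁ _)       (inj₁ _)       = ⊥
  LeviAdj (inj₂ _)       (inj₂ _)       = ⊥

  private
    levi-sym : Symmetric LeviAdj
    levi-sym {inj₁ _} {inj₂ _} v∈e = v∈e
    levi-sym {inj₂ _} {inj₁ _} v∈e = v∈e
    levi-sym {inj₁ _} {inj₁ _} ()
    levi-sym {inj₂ _} {inj₂ _} ()

    levi-no-loop : ∀ x → ¬ LeviAdj x x
    levi-no-loop (inj₁ _) ()
    levi-no-loop (inj₂ _) ()

  Levi : Graph
  Levi = record
    { Vertex  = Fin n ⊎ Edge H
    ; Adj     = LeviAdj
    ; adj-sym = levi-sym
    ; no-loop = levi-no-loop
    }

------------------------------------------------------------------------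
-- Closed surfaces with a cell decomposition

-- One step along some τ i with i satisfying P.
Step : {Flag : Set} → (Fin 3 → Flag → Flag) → (Fin 3 → Set) → Rel Flag _
Step τ P x y = ∃ λ i → P i × τ i x ≡ y

-- A connected closed surface together with a finite cell decomposition (with
-- at least one 1-cell; loops and parallel edges are allowed), presented by its
-- flags.  The flags are the triangles of the barycentric subdivision: each has
-- a corner 0 at a vertex, a corner 1 inside an edge and a corner 2 inside a
-- face, and τ i glues it to the other triangle on the side opposite corner i.
-- Hence the k-cells are the orbits of the two τ i with i ≢ k.  The surface has
-- no boundary since no τ i has a fixed point, and an edge is surrounded by
-- exactly four flags since τ 0F and τ 2F commute and never agree.
record CellSurface : Set₁ where
  field
    Flag       : Set
    finite     : ∃ λ m → Flag ↔ Fin m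
    base       : Flag
    τ          : Fin 3 → Flag → Flag
    involutive : ∀ i x → τ i (τ i x) ≡ x
    no-fixed   : ∀ i x → τ i x ≢ x
    commute    : ∀ x → τ 0F (τ 2F x) ≡ τ 2F (τ 0F x)
    disagree   : ∀ x → τ 0F x ≢ τ 2F x
    connected  : ∀ x y → EqClosure (Step τ (λ _ → ⊤)) x y
    -- #cells k counts the k-cells: the quotient of Flag by the orbit relation
    -- is in bijection with Fin (#cells k).
    #cells     : Fin 3 → ℕ
    cells      : ∀ k → Inverse (closureSetoid (Step τ (_≢ k))) (setoid (Fin (#cells k)))

  cell : ∀ k → Flag → Fin (#cells k)
  cell k = Inverse.to (cells k)

  χ : ℤ
  χ = + #cells 0F ℤ.- + #cells 1F ℤ.+ + #cells 2F

  -- The flags are 2-coloured by local orientation, adjacent flags having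
  -- opposite colours.
  Orientable : Set
  Orientable = Σ (Flag → Bool) λ colour → ∀ i x → colour (τ i x) ≡ not (colour x)

-- By the classification of closed surfaces: the sphere with h handles, and
-- the sphere with c ≥ 1 crosscaps.

IsOrientableSurface : ℕ → CellSurface → Set
IsOrientableSurface h M = Orientable × χ ≡ + 2 ℤ.- + (2 * h)
  where open CellSurface M

IsNonOrientableSurface : ℕ → CellSurface → Set
IsNonOrientableSurface c M = 1 ≤ c × ¬ Orientable × χ ≡ + 2 ℤ.- + c
  where open CellSurface M

------------------------------------------------------------------------
-- Embeddings and genus

-- G is a subgraph of the 1-skeleton of M.  As G is simple, distinct edges of G
-- have distinct pairs of ends and so automatically lie on distinct 1-cells.
record _↪_ (G : Graph) (M : CellSurface) : Set where
  open Graph G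
  open CellSurface M
  field
    vertex    : Vertex → Fin (#cells 0F)
    injective : Injective _≡_ _≡_ vertex
    edge      : ∀ {u v} → Adj u v →
                ∃ λ x → cell 0F x ≡ vertex u × cell 0F (τ 0F x) ≡ vertex v

-- An embedding of G in a surface need not be cellular: the complement of G may
-- have components other than open discs.  These are cut into cells by further
-- vertices and edges, so G embeds in a given surface iff it is a subgraph of
-- the 1-skeleton of some cell decomposition of that surface.

EmbedsInOrientable : Graph → ℕ → Set₁
EmbedsInOrientable G h = Σ CellSurface λ M → IsOrientableSurface h M × G ↪ M

EmbedsInNonOrientable : Graph → ℕ → Set₁
EmbedsInNonOrientable G c = Σ CellSurface λ M → IsNonOrientableSurface c M × G ↪ M

Planar : Graph → Set₁
Planar G = EmbedsInOrientable G 0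

IsLeast : (ℕ → Set₁) → ℕ → Set₁
IsLeast P m = P m × (∀ k → P k → m ≤ k)

-- "The genus of G is g" and "the non-orientable genus of G is c", as relations.

HasGenus : Graph → ℕ → Set₁
HasGenus G = IsLeast (EmbedsInOrientable G)

HasNonOrientableGenus : Graph → ℕ → Set₁
HasNonOrientableGenus G c =
  (Planar G × c ≡ 0) ⊎ (¬ Planar G × IsLeast (EmbedsInNonOrientable G) c)

HypergraphHasGenus : ∀ {n} → Hypergraph n → ℕ → Set₁
HypergraphHasGenus H = HasGenus (Levi H)

HypergraphHasNonOrientableGenus : ∀ {n} → Hypergraph n → ℕ → Set₁
HypergraphHasNonOrientableGenus H = HasNonOrientableGenus (Levi H)

-- Lower bound.  Let a simple bipartite graph with p vertices and q edges lie in the 1-skeleton of a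
-- closed surface.  Over the field with two elements the coboundaries of vertices are orthogonal to
-- the coboundaries of faces, and comparing ranks gives χ ≤ p − q + r, where r is the number of
-- regions of the complement of the graph.  Each region has at least four of the 2q sides of edges,
-- so 2χ ≤ 2p − q.
--
-- Upper bound.  Equality holds if all faces are quadrilaterals v, vwx, w, vwy.  They amount to a
-- perfect matching of the points other than v and w for each pair {v, w}, possible as n is even; the
-- faces around v form a single disc iff these matchings make up an Euler circuit of the complete
-- graph on the points other than v.  Such matchings are found by adding two points a, b at a time.
-- The circuit at a is an Euler circuit C of the complete graph on the old points and b, and that at b
-- is C reversed with a in place of b.  At an old point v this leaves, beside the old circuit, a short
-- circuit through avw, vwb, vbw′, w′va for each transition w, w′ of C at v, and it is merged with the
-- old circuit at w by replacing matched pairs {a, b}, {p, q} by {a, p}, {b, q} in the matching of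
-- {v, w}.  Exactly one of w and w′ has to be treated in this way, so the edges of C should alternate
-- between two classes.  For an orientable surface p is the one of p, q whose sign fits; one wrong
-- choice makes the surface non-orientable.

module Submission where

open import Defs
open import Algebra.Bundles using (CommutativeRing)
import Algebra.Properties.Semiring.Sum as SemiringSum
open import Data.Bool using (Bool; true; false; not; _∧_; _xor_; T; if_then_else_)
import Data.Bool.Properties as Bool
open import Data.Empty using (⊥; ⊥-elim-irr)
open import Data.Fin
  using (Fin; zero; suc; toℕ; fromℕ<; punchIn; punchOut; splitAt; join; _↑ˡ_; _↑ʳ_; combine; remQuot; opposite)
open import Data.Fin.Patterns using (0F; 1F; 2F; 3F; 4F; 5F)
open import Data.Fin.Permutation using (↔⇒≡)
import Data.Fin.Properties as Fin
open import Data.Fin.Subset using (Subset; _∈_; _∉_; _⊆_; ∣_∣; ⁅_⁆; _∪_; inside; outside)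
import Data.Fin.Subset.Properties as Subset
open import Data.Integer as ℤ using (+_)
import Data.Integer.Properties as ℤ
import Data.Integer.Tactic.RingSolver as ℤ-Solver
open import Data.Nat using (ℕ; zero; suc; _+_; _*_; _∸_; _≤_; _<_; z≤n; s≤s; _≡ᵇ_)
open import Data.Nat.Divisibility using (_∣_; divides)
import Data.Nat.Properties as ℕ
open import Data.Nat.Tactic.RingSolver using (solve-∀)
open import Data.Product using (Σ; ∃; ∃₂; _×_; _,_; proj₁; proj₂; uncurry)
open import Data.Product.Function.NonDependent.Propositional using (_×-↔_)
open import Data.Sum using (_⊎_; inj₁; inj₂; [_,_]′)
open import Data.Sum.Properties using (inj₁-injective; inj₂-injective)
open import Data.Unit using (⊤; tt)
open import Data.Vec using ([]; _∷_)
open import Data.Vec.Base using (here; there)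
open import Function using (_∘_; id; case_of_)
open import Function.Bundles using (_↔_; Inverse; mk↔ₛ′)
import Function.Properties.Inverse as Inv
open import Relation.Binary.Construct.Closure.Equivalence using (EqClosure)
  renaming (setoid to closureSetoid)
import Relation.Binary.Construct.Closure.Equivalence as EqC
open import Relation.Binary.Construct.Closure.ReflexiveTransitive using (ε; _◅_; _◅◅_)
open import Relation.Binary.Construct.Closure.Symmetric using (SymClosure; fwd; bwd)
open import Relation.Binary.Core using (Rel)
open import Relation.Binary.Definitions using (tri<; tri≈; tri>)
open import Relation.Binary.PropositionalEquality
  using (_≡_; _≢_; refl; sym; trans; cong; cong₂; subst; subst₂; setoid; isEquivalence; module ≡-Reasoning)
open import Relation.Nullary using (¬_; Dec; yes; no; does; contradiction; ¬?; _→-dec_; _×-dec_)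
open import Relation.Nullary.Decidable using (True; toWitness; from-yes; dec-true; dec-false)

open SemiringSum (CommutativeRing.semiring Bool.xor-∧-commutativeRing)
  using (sum; sum-cong-≗; sum-remove; ∑-distrib-+; ∑-comm; ∑-permute; *-distribˡ-sum; *-distribʳ-sum; sum-replicate-zero)

-- Linear algebra over the field with two elements

-- The genus comes from p = n + t and q = 3t for the Levi graph, t being the number of triples: the
-- lower bound reads 2χ ≤ 2n - t, and 2n - t = 4 - 4g for the asserted g. Ranks replace a count of
-- faces because a region need not be a disc; the matrices get extra columns for vertices of the
-- graph and for regions because the coboundaries alone are dependent, those of all vertices adding
-- up to zero.
--
-- In the construction the circuit C does not depend on the old matchings, and every choice of p
-- yields a design. C lives on n + 1 points, an odd number, as an Euler circuit of a complete graph
-- requires. Away from 0 it pairs consecutive residues modulo n + 1, so the parity of the residue of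
-- x - v is a tournament that alternates along C; it supplies the signs of the new triples. The
-- classes of edges come from the parities of the two ends.
--
-- A short circuit, cut open where it is merged, is a walk with an odd number of moves. Hence an
-- orientation of the new surface restricts to the old points whatever p is, and a single
-- non-orientable design on six points settles all larger cases. On four points the matchings are
-- unique and give the sphere.

xor-cancel : ∀ x y → x xor y ≡ false → x ≡ y
xor-cancel false false _ = refl
xor-cancel true  true  _ = refl

sum-zero : ∀ {n} (f : Fin n → Bool) → (∀ i → f i ≡ false) → sum f ≡ false
sum-zero {n} f f≡0 = trans (sum-cong-≗ f≡0) (sum-replicate-zero n)

Independent : ∀ {a m} → (Fin a → Fin m → Bool) → Set
Independent {a} A = ∀ (u : Fin a → Bool) → (∀ k → sum (λ i → u i ∧ A i k) ≡ false) → ∀ i → u i ≡ false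

Orthogonal : ∀ {a b m} → (Fin a → Fin m → Bool) → (Fin b → Fin m → Bool) → Set
Orthogonal A B = ∀ i j → sum (λ k → A i k ∧ B j k) ≡ false

-- A zero first row would by itself be a nontrivial vanishing combination.
pivot : ∀ {a m} (A : Fin (suc a) → Fin m → Bool) → Independent A → ∃ λ k → A zero k ≡ true
pivot {a} A ind with Fin.any? (λ k → A zero k Bool.≟ true)
... | yes p = p
... | no ¬p = contradiction (ind e₀ zero-sum zero) λ ()
  where
  e₀ : Fin (suc a) → Bool
  e₀ zero    = true
  e₀ (suc _) = false
  zero-sum : ∀ k → sum (λ i → e₀ i ∧ A i k) ≡ false
  zero-sum k rewrite Bool.¬-not (λ A₀k → ¬p (k , A₀k)) = sum-zero {a} _ (λ _ → refl)

module _ {a b m} (A : Fin (suc a) → Fin (suc m) → Bool) (B : Fin b → Fin (suc m) → Bool)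
         (indA : Independent A) (indB : Independent B) (orth : Orthogonal A B)
         (j : Fin (suc m)) (A₀j : A zero j ≡ true) where

  open ≡-Reasoning

  -- Gaussian elimination with the pivot in row `zero` and column `j`, both of which are then
  -- deleted.
  eliminated : Fin a → Fin m → Bool
  eliminated i k = A (suc i) (punchIn j k) xor A (suc i) j ∧ A zero (punchIn j k)

  dropped : Fin b → Fin m → Bool
  dropped i k = B i (punchIn j k)

  sum-split : ∀ (f : Fin (suc m) → Bool) → sum f ≡ false → f j ≡ sum (λ k → f (punchIn j k))
  sum-split f sf = xor-cancel _ _ (trans (sym (sum-remove f)) sf)

  -- Orthogonality to the pivot row, whose entry at `j` is 1, expresses column `j` of `B` through
  -- the other columns. Deleting it therefore loses nothing.
  B-column : ∀ i → B i j ≡ sum (λ k → A zero (punchIn j k) ∧ dropped i k)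
  B-column i = trans (cong (_∧ B i j) (sym A₀j)) (sum-split (λ k → A zero k ∧ B i k) (orth zero i))

  eliminated-independent : Independent eliminated
  eliminated-independent u u≡0 i = indA u⁺ u⁺≡0 (suc i)
    where
    -- The total multiple of the pivot row contained in the combination of eliminated rows.
    c : Bool
    c = sum (λ i → u i ∧ A (suc i) j)
    u⁺ : Fin (suc a) → Bool
    u⁺ zero    = c
    u⁺ (suc i) = u i
    u⁺≡0 : ∀ k → sum (λ i → u⁺ i ∧ A i k) ≡ false
    u⁺≡0 k with j Fin.≟ k
    ... | yes refl rewrite A₀j = trans (cong (_xor c) (Bool.∧-identityʳ c)) (Bool.xor-same c)
    ... | no j≢k rewrite sym (Fin.punchIn-punchOut j≢k) = begin
      c ∧ z xor sum (λ i → u i ∧ A (suc i) k′)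
        ≡⟨ Bool.xor-comm (c ∧ z) _ ⟩
      sum (λ i → u i ∧ A (suc i) k′) xor c ∧ z
        ≡⟨ cong (sum (λ i → u i ∧ A (suc i) k′) xor_) (*-distribʳ-sum z (λ i → u i ∧ A (suc i) j)) ⟩
      sum (λ i → u i ∧ A (suc i) k′) xor sum (λ i → (u i ∧ A (suc i) j) ∧ z)
        ≡⟨ sym (∑-distrib-+ (λ i → u i ∧ A (suc i) k′) _) ⟩
      sum (λ i → u i ∧ A (suc i) k′ xor (u i ∧ A (suc i) j) ∧ z)
        ≡⟨ sum-cong-≗ (λ i → trans (cong (u i ∧ A (suc i) k′ xor_) (Bool.∧-assoc (u i) _ _))
                                    (sym (Bool.∧-distribˡ-xor (u i) _ _))) ⟩
      sum (λ i → u i ∧ eliminated i (punchOut j≢k))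
        ≡⟨ u≡0 _ ⟩
      false ∎
      where
      k′ = punchIn j (punchOut j≢k)
      z = A zero k′

  -- By `B-column`, a combination of rows that vanishes on all other columns vanishes on column `j`
  -- as well.
  dropped-independent : Independent dropped
  dropped-independent u u≡0 = indB u u≡0′
    where
    u≡0′ : ∀ k → sum (λ i → u i ∧ B i k) ≡ false
    u≡0′ k with j Fin.≟ k
    ... | no j≢k rewrite sym (Fin.punchIn-punchOut j≢k) = u≡0 _
    ... | yes refl = begin
      sum (λ i → u i ∧ B i j)
        ≡⟨ sum-cong-≗ (λ i → cong (u i ∧_) (B-column i)) ⟩
      sum (λ i → u i ∧ sum (λ k → z k ∧ dropped i k))
        ≡⟨ sum-cong-≗ (λ i → *-distribˡ-sum (u i) (λ k → z k ∧ dropped i k)) ⟩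
      sum (λ i → sum (λ k → u i ∧ (z k ∧ dropped i k)))
        ≡⟨ ∑-comm (λ i k → u i ∧ (z k ∧ dropped i k)) ⟩
      sum (λ k → sum (λ i → u i ∧ (z k ∧ dropped i k)))
        ≡⟨ sum-cong-≗ (λ k → trans (sum-cong-≗ (λ i → shuffle (u i) (z k) _)) (sym (*-distribˡ-sum (z k) (λ i → u i ∧ dropped i k)))) ⟩
      sum (λ k → z k ∧ sum (λ i → u i ∧ dropped i k))
        ≡⟨ sum-zero _ (λ k → trans (cong (z k ∧_) (u≡0 k)) (Bool.∧-zeroʳ (z k))) ⟩
      false ∎
      where
      z = λ k → A zero (punchIn j k)
      shuffle : ∀ x y w → x ∧ (y ∧ w) ≡ y ∧ (x ∧ w)
      shuffle x y w = trans (sym (Bool.∧-assoc x y w)) (trans (cong (_∧ w) (Bool.∧-comm x y)) (Bool.∧-assoc y x w))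

  eliminated-orthogonal : Orthogonal eliminated dropped
  eliminated-orthogonal i l = begin
    sum (λ k → (x k xor y ∧ z k) ∧ d k)
      ≡⟨ sum-cong-≗ (λ k → trans (Bool.∧-distribʳ-xor (d k) (x k) _) (cong (x k ∧ d k xor_) (Bool.∧-assoc y (z k) (d k)))) ⟩
    sum (λ k → x k ∧ d k xor y ∧ (z k ∧ d k))
      ≡⟨ ∑-distrib-+ (λ k → x k ∧ d k) _ ⟩
    sum (λ k → x k ∧ d k) xor sum (λ k → y ∧ (z k ∧ d k))
      ≡⟨ cong₂ _xor_ (sym (sum-split (λ k → A (suc i) k ∧ B l k) (orth (suc i) l))) (sym (*-distribˡ-sum y (λ k → z k ∧ d k))) ⟩
    y ∧ B l j xor y ∧ sum (λ k → z k ∧ d k)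
      ≡⟨ cong (λ w → y ∧ B l j xor y ∧ w) (sym (B-column l)) ⟩
    y ∧ B l j xor y ∧ B l j
      ≡⟨ Bool.xor-same (y ∧ B l j) ⟩
    false ∎
    where
    x = λ k → A (suc i) (punchIn j k)
    y = A (suc i) j
    z = λ k → A zero (punchIn j k)
    d = λ k → dropped l k

independent⇒≤ : ∀ {a m} (A : Fin a → Fin m → Bool) → Independent A → a ≤ m
independent⇒≤ {zero} A ind = z≤n
independent⇒≤ {suc a} {zero} A ind with () ← proj₁ (pivot A ind)
independent⇒≤ {suc a} {suc m} A ind =
  let j , A₀j = pivot A ind in
  -- The elimination step is applied with an empty `B`.
  s≤s (independent⇒≤ _ (eliminated-independent {b = 0} A (λ ()) ind (λ _ _ ()) (λ _ ()) j A₀j))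

-- Over this field a space can meet its orthogonal complement, so the two families cannot be joined
-- into one independent family. Instead each elimination step removes one row of `A` together with
-- one column, and `B` keeps all its rows.
orthogonal⇒≤ : ∀ {a b m} (A : Fin a → Fin m → Bool) (B : Fin b → Fin m → Bool) →
               Independent A → Independent B → Orthogonal A B → a + b ≤ m
orthogonal⇒≤ {zero} A B indA indB orth = independent⇒≤ B indB
orthogonal⇒≤ {suc a} {m = zero} A B indA indB orth with () ← proj₁ (pivot A indA)
orthogonal⇒≤ {suc a} {m = suc m} A B indA indB orth =
  let j , A₀j = pivot A indA in
  s≤s (orthogonal⇒≤ _ _ (eliminated-independent A B indA indB orth j A₀j)
                        (dropped-independent A B indA indB orth j A₀j)
                        (eliminated-orthogonal A B indA indB orth j A₀j))

sum-single : ∀ {n} (f : Fin n → Bool) k → (∀ j → j ≢ k → f j ≡ false) → sum f ≡ f k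
sum-single {suc n} f k f≡0 =
  trans (sum-remove {i = k} f)
        (trans (cong (f k xor_) (sum-zero (f ∘ punchIn k) (λ j → f≡0 _ (Fin.punchInᵢ≢i k j)))) (Bool.xor-identityʳ (f k)))

sum-other : ∀ {n} (f : Fin n → Bool) k → sum f ≡ false → f k ≡ true → ∃ λ j → j ≢ k × f j ≡ true
sum-other f k sf fk with Fin.any? (λ j → ¬? (j Fin.≟ k) ×-dec (f j Bool.≟ true))
... | yes found = found
... | no none = contradiction (trans (sym fk) (trans (sym (sum-single f k λ j j≢k → Bool.¬-not (λ fj → none (j , j≢k , fj)))) sf)) λ ()

sum-join : ∀ m {n} (f : Fin (m + n) → Bool) →
           sum f ≡ sum (λ i → f (i ↑ˡ n)) xor sum (λ j → f (m ↑ʳ j))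
sum-join zero f = refl
sum-join (suc m) f = trans (cong (f zero xor_) (sum-join m (f ∘ suc))) (sym (Bool.xor-assoc (f zero) _ _))

sum-combine : ∀ m {n} (f : Fin (m * n) → Bool) →
              sum f ≡ sum (λ i → sum (λ j → f (combine {m} {n} i j)))
sum-combine zero f = refl
sum-combine (suc m) {n} f = trans (sum-join n f) (cong (sum (λ j → f (j ↑ˡ (m * n))) xor_) (sum-combine m (λ j → f (n ↑ʳ j))))

indicator : ∀ {n} → Fin n → Fin n → Bool
indicator i j = does (i Fin.≟ j)

indicator-≡ : ∀ {n} {i j : Fin n} → i ≡ j → indicator i j ≡ true
indicator-≡ {i = i} {j} i≡j = dec-true (i Fin.≟ j) i≡j

indicator-≢ : ∀ {n} {i j : Fin n} → i ≢ j → indicator i j ≡ false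
indicator-≢ {i = i} {j} i≢j = dec-false (i Fin.≟ j) i≢j

indicator⇒≡ : ∀ {n} {i j : Fin n} → indicator i j ≡ true → i ≡ j
indicator⇒≡ {i = i} {j} e with i Fin.≟ j
... | yes i≡j = i≡j
indicator⇒≡ () | no _

sum-indicatorˡ : ∀ {n} (u : Fin n → Bool) k → sum (λ i → u i ∧ indicator i k) ≡ u k
sum-indicatorˡ u k = trans (sum-single _ k λ j j≢k → trans (cong (u j ∧_) (indicator-≢ j≢k)) (Bool.∧-zeroʳ (u j)))
                           (trans (cong (u k ∧_) (indicator-≡ {i = k} refl)) (Bool.∧-identityʳ (u k)))

sum-indicatorʳ : ∀ {n} (u : Fin n → Bool) k → sum (λ i → u i ∧ indicator k i) ≡ u k
sum-indicatorʳ u k = trans (sum-single _ k λ j j≢k → trans (cong (u j ∧_) (indicator-≢ (j≢k ∘ sym))) (Bool.∧-zeroʳ (u j)))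
                           (trans (cong (u k ∧_) (indicator-≡ {i = k} refl)) (Bool.∧-identityʳ (u k)))

-- This is `orthogonal⇒≤` for the rows (A₁, A₂, 0) against the rows (B₁, 0, B₃) and (C₁, C₂, 0). In
-- `rank-bound` the three blocks of columns are the 1-cells, the vertices of the graph and the
-- regions.
blockOrthogonal⇒≤ : ∀ {v f q e p c}
  (A₁ : Fin v → Fin e → Bool) (A₂ : Fin v → Fin p → Bool)
  (B₁ : Fin f → Fin e → Bool) (B₃ : Fin f → Fin c → Bool)
  (C₁ : Fin q → Fin e → Bool) (C₂ : Fin q → Fin p → Bool) →
  (∀ (u : Fin v → Bool) → (∀ k → sum (λ i → u i ∧ A₁ i k) ≡ false) → (∀ k → sum (λ i → u i ∧ A₂ i k) ≡ false) → ∀ i → u i ≡ false) →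
  (∀ (u : Fin f → Bool) (w : Fin q → Bool) → (∀ k → sum (λ i → u i ∧ B₁ i k) xor sum (λ i → w i ∧ C₁ i k) ≡ false) →
           (∀ k → sum (λ i → u i ∧ B₃ i k) ≡ false) → (∀ i → u i ≡ false) × (∀ i → w i ≡ false)) →
  Orthogonal A₁ B₁ →
  (∀ i j → sum (λ k → A₁ i k ∧ C₁ j k) xor sum (λ k → A₂ i k ∧ C₂ j k) ≡ false) →
  v + (f + q) ≤ e + (p + c)
blockOrthogonal⇒≤ {v} {f} {q} {e} {p} {c} A₁ A₂ B₁ B₃ C₁ C₂ indA indBC orthB orthC =
  orthogonal⇒≤ A B ind-A ind-B orth
  where
  block : (Fin e → Bool) → (Fin p → Bool) → (Fin c → Bool) → Fin (e + (p + c)) → Bool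
  block x y z k = [ x , (λ l → [ y , z ]′ (splitAt p l)) ]′ (splitAt e k)
  block₁ : ∀ x y z k → block x y z (k ↑ˡ (p + c)) ≡ x k
  block₁ x y z k = cong [ x , (λ l → [ y , z ]′ (splitAt p l)) ]′ (Fin.splitAt-↑ˡ e k (p + c))
  block₂ : ∀ x y z k → block x y z (e ↑ʳ (k ↑ˡ c)) ≡ y k
  block₂ x y z k = trans (cong [ x , (λ l → [ y , z ]′ (splitAt p l)) ]′ (Fin.splitAt-↑ʳ e (p + c) (k ↑ˡ c))) (cong [ y , z ]′ (Fin.splitAt-↑ˡ p k c))
  block₃ : ∀ x y z k → block x y z (e ↑ʳ (p ↑ʳ k)) ≡ z k
  block₃ x y z k = trans (cong [ x , (λ l → [ y , z ]′ (splitAt p l)) ]′ (Fin.splitAt-↑ʳ e (p + c) (p ↑ʳ k))) (cong [ y , z ]′ (Fin.splitAt-↑ʳ p c k))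
  nul : ∀ {n} → Fin n → Bool
  nul _ = false
  A : Fin v → Fin (e + (p + c)) → Bool
  A i = block (A₁ i) (A₂ i) nul
  rowB : Fin f ⊎ Fin q → Fin (e + (p + c)) → Bool
  rowB (inj₁ i) = block (B₁ i) nul (B₃ i)
  rowB (inj₂ j) = block (C₁ j) (C₂ j) nul
  B : Fin (f + q) → Fin (e + (p + c)) → Bool
  B i = rowB (splitAt f i)
  open ≡-Reasoning
  dot : ∀ x y z x′ y′ z′ → sum (λ k → block x y z k ∧ block x′ y′ z′ k) ≡
        sum (λ k → x k ∧ x′ k) xor (sum (λ k → y k ∧ y′ k) xor sum (λ k → z k ∧ z′ k))
  dot x y z x′ y′ z′ = trans (sum-join e _) (cong₂ _xor_
    (sum-cong-≗ (λ k → cong₂ _∧_ (block₁ x y z k) (block₁ x′ y′ z′ k)))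
    (trans (sum-join p _) (cong₂ _xor_
      (sum-cong-≗ (λ k → cong₂ _∧_ (block₂ x y z k) (block₂ x′ y′ z′ k)))
      (sum-cong-≗ (λ k → cong₂ _∧_ (block₃ x y z k) (block₃ x′ y′ z′ k))))))
  ind-A : Independent A
  ind-A u h = indA u
    (λ k → trans (sum-cong-≗ (λ i → cong (u i ∧_) (sym (block₁ (A₁ i) (A₂ i) nul k)))) (h _))
    (λ k → trans (sum-cong-≗ (λ i → cong (u i ∧_) (sym (block₂ (A₁ i) (A₂ i) nul k)))) (h _))
  ind-B : Independent B
  ind-B u h i = trans (cong u (sym (Fin.join-splitAt f q i))) (byCases (splitAt f i))
    where
    split : ∀ k → sum (λ i → u (i ↑ˡ q) ∧ rowB (inj₁ i) k) xor sum (λ j → u (f ↑ʳ j) ∧ rowB (inj₂ j) k) ≡ false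
    split k = trans (sym (trans (sum-join f _) (cong₂ _xor_
      (sum-cong-≗ (λ i → cong (λ s → u (i ↑ˡ q) ∧ rowB s k) (Fin.splitAt-↑ˡ f i q)))
      (sum-cong-≗ (λ j → cong (λ s → u (f ↑ʳ j) ∧ rowB s k) (Fin.splitAt-↑ʳ f q j)))))) (h k)
    zeros : (∀ i → u (i ↑ˡ q) ≡ false) × (∀ j → u (f ↑ʳ j) ≡ false)
    zeros = indBC (λ i → u (i ↑ˡ q)) (λ j → u (f ↑ʳ j))
      (λ k → trans (cong₂ _xor_
        (sum-cong-≗ (λ i → cong (u (i ↑ˡ q) ∧_) (sym (block₁ (B₁ i) nul (B₃ i) k))))
        (sum-cong-≗ (λ j → cong (u (f ↑ʳ j) ∧_) (sym (block₁ (C₁ j) (C₂ j) nul k))))) (split _))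
      (λ k → trans (sym (Bool.xor-identityʳ _)) (trans (cong₂ _xor_
        (sum-cong-≗ (λ i → cong (u (i ↑ˡ q) ∧_) (sym (block₃ (B₁ i) nul (B₃ i) k))))
        (sym (sum-zero _ (λ j → trans (cong (u (f ↑ʳ j) ∧_) (block₃ (C₁ j) (C₂ j) nul k)) (Bool.∧-zeroʳ _))))) (split _)))
    byCases : ∀ s → u (join f q s) ≡ false
    byCases (inj₁ i) = proj₁ zeros i
    byCases (inj₂ j) = proj₂ zeros j
  orth : Orthogonal A B
  orth i j with splitAt f j
  ... | inj₁ j = begin
    _ ≡⟨ dot (A₁ i) (A₂ i) nul (B₁ j) nul (B₃ j) ⟩
    _ ≡⟨ cong₂ _xor_ (orthB i j) (cong₂ _xor_ (sum-zero _ (λ k → Bool.∧-zeroʳ (A₂ i k))) (sum-zero {c} _ (λ _ → refl))) ⟩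
    false ∎
  ... | inj₂ j = begin
    _ ≡⟨ dot (A₁ i) (A₂ i) nul (C₁ j) (C₂ j) nul ⟩
    _ ≡⟨ cong (sum (λ k → A₁ i k ∧ C₁ j k) xor_) (trans (cong (sum (λ k → A₂ i k ∧ C₂ j k) xor_) (sum-zero {c} _ (λ _ → refl))) (Bool.xor-identityʳ _)) ⟩
    _ ≡⟨ orthC i j ⟩
    false ∎

-- Finite quotients and orbit counting

Classes : {X : Set} → Rel X _ → ℕ → Set
Classes R c = Inverse (closureSetoid R) (setoid (Fin c))

record FiniteQuotient {N : ℕ} (R : Rel (Fin N) _) : Set where
  field
    size    : ℕ
    class   : Fin N → Fin size
    rep     : Fin size → Fin N
    section : ∀ i → class (rep i) ≡ i
    respect : ∀ {x y} → R x y → class x ≡ class y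
    exact   : ∀ {x y} → class x ≡ class y → EqClosure R x y

Listed : ∀ {N K} → (Fin K → Fin N × Fin N) → Rel (Fin N) _
Listed p x y = ∃ λ i → p i ≡ (x , y)

abstract

  -- Starting from singletons, the listed pairs are processed one at a time; each lies inside a
  -- class or merges two classes.
  quotient : ∀ {N} K (p : Fin K → Fin N × Fin N) → FiniteQuotient (Listed p)
  quotient {N} zero p = record
    { size = N ; class = id ; rep = id ; section = λ _ → refl ; respect = λ () ; exact = λ { refl → ε } }
  quotient {N} (suc K) p = result
    where
    module Q = FiniteQuotient (quotient K (p ∘ suc))
    lift : ∀ {x y} → EqClosure (Listed (p ∘ suc)) x y → EqClosure (Listed p) x y
    lift = EqC.map λ { (i , eq) → suc i , eq }
    l r : Fin N
    l = proj₁ (p zero)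
    r = proj₂ (p zero)
    new : EqClosure (Listed p) l r
    new = fwd (zero , refl) ◅ ε

    merge : (s : ℕ) (cl : Fin N → Fin s) (rep : Fin s → Fin N) (section : ∀ i → cl (rep i) ≡ i) →
            (respect : ∀ {x y} → Listed (p ∘ suc) x y → cl x ≡ cl y) →
            (exact : ∀ {x y} → cl x ≡ cl y → EqClosure (Listed (p ∘ suc)) x y) →
            cl r ≢ cl l → FiniteQuotient (Listed p)
    merge zero cl _ _ _ _ _ with () ← cl l
    merge (suc s) cl rep section respect exact β≢α = record
      { size = s ; class = f ∘ cl ; rep = rep ∘ punchIn β
      ; section = λ i → trans (cong f (section (punchIn β i))) (f-punchIn i)
      ; respect = λ { (zero , refl) → trans f-α (sym f-β) ; (suc i , eq) → cong f (respect (i , eq)) }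
      ; exact = λ {x} {y} → exact′ x y }
      where
      α β : Fin (suc s)
      α = cl l
      β = cl r
      f : Fin (suc s) → Fin s
      -- The class `β` is deleted from the numbering, and its points join the class `α`.
      f γ with β Fin.≟ γ
      ... | yes _ = punchOut β≢α
      ... | no β≢γ = punchOut β≢γ
      f-β : f β ≡ punchOut β≢α
      f-β with β Fin.≟ β
      ... | yes _ = refl
      ... | no β≢β = contradiction refl β≢β
      f-≢ : ∀ {γ} (β≢γ : β ≢ γ) → f γ ≡ punchOut β≢γ
      f-≢ {γ} β≢γ with β Fin.≟ γ
      ... | yes β≡γ = contradiction β≡γ β≢γ
      ... | no _ = Fin.punchOut-cong β refl
      f-α : f α ≡ punchOut β≢α
      f-α = f-≢ β≢α
      f-punchIn : ∀ i → f (punchIn β i) ≡ i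
      f-punchIn i = trans (f-≢ (Fin.punchInᵢ≢i β i ∘ sym)) (Fin.punchOut-punchIn β)
      exact′ : ∀ x y → f (cl x) ≡ f (cl y) → EqClosure (Listed p) x y
      exact′ x y eq = byCases (β Fin.≟ cl x) (β Fin.≟ cl y)
        where
        to-l : ∀ {z} → cl z ≡ α → EqClosure (Listed p) l z
        to-l e = lift (exact (sym e))
        to-r : ∀ {z} → β ≡ cl z → EqClosure (Listed p) r z
        to-r e = lift (exact e)
        byCases : Dec (β ≡ cl x) → Dec (β ≡ cl y) → EqClosure (Listed p) x y
        byCases (yes ex) (yes ey) = lift (exact (trans (sym ex) ey))
        byCases (yes ex) (no ny) =
          EqC.symmetric _ (to-r ex) ◅◅ EqC.symmetric _ new ◅◅
          to-l (sym (Fin.punchOut-injective β≢α ny (trans (sym f-β) (trans (trans (cong f ex) eq) (f-≢ ny)))))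
        byCases (no nx) (yes ey) =
          EqC.symmetric _ (to-l (Fin.punchOut-injective nx β≢α (trans (sym (f-≢ nx)) (trans eq (trans (cong f (sym ey)) f-β)))))
          ◅◅ new ◅◅ to-r ey
        byCases (no nx) (no ny) = lift (exact (Fin.punchOut-injective nx ny (trans (sym (f-≢ nx)) (trans eq (f-≢ ny)))))

    result : FiniteQuotient (Listed p)
    result with Q.class r Fin.≟ Q.class l
    ... | no β≢α = merge Q.size Q.class Q.rep Q.section Q.respect Q.exact β≢α
    ... | yes β≡α = record
      { size = Q.size ; class = Q.class ; rep = Q.rep ; section = Q.section
      ; respect = λ { (zero , refl) → sym β≡α ; (suc i , eq) → Q.respect (i , eq) }
      ; exact = lift ∘ Q.exact }

class-respects : ∀ {N} {R : Rel (Fin N) _} (Q : FiniteQuotient R) →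
                 ∀ {x y} → EqClosure R x y → FiniteQuotient.class Q x ≡ FiniteQuotient.class Q y
class-respects Q = EqC.gfold {S = _≡_} isEquivalence (FiniteQuotient.class Q) (FiniteQuotient.respect Q)

-- The list must contain all steps of `R` but may contain other related pairs, so an irregular set
-- of steps can be padded with trivial pairs.
finiteClasses : ∀ {X : Set} {N} → X ↔ Fin N → (R : Rel X _) → ∀ K (p : Fin K → X × X) →
                (∀ i → EqClosure R (proj₁ (p i)) (proj₂ (p i))) →
                (∀ {x y} → R x y → ∃ λ i → p i ≡ (x , y)) →
                ∃ (Classes R)
finiteClasses {X} {N} bij R K p sound complete = Q.size , record
  { to = Q.class ∘ B.to
  ; from = B.from ∘ Q.rep
  ; to-cong = λ x~y → class-respects (quotient K p′) (EqC.gmap B.to (λ r → let i , eq = complete r in i , cong (λ (a , b) → B.to a , B.to b) eq) x~y)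
  ; from-cong = λ { refl → ε }
  ; inverse = (λ {i} e → to-from e) , λ {x} e → from-to e
  }
  where
  module B = Inverse bij
  p′ : Fin K → Fin N × Fin N
  p′ i = B.to (proj₁ (p i)) , B.to (proj₂ (p i))
  module Q = FiniteQuotient (quotient K p′)
  R′⇒ : ∀ {a b} → EqClosure (Listed p′) a b → EqClosure R (B.from a) (B.from b)
  R′⇒ = EqC.join ∘ EqC.gmap B.from λ { (i , refl) → subst₂ (EqClosure R) (sym (B.strictlyInverseʳ _)) (sym (B.strictlyInverseʳ _)) (sound i) }
  to-from : ∀ {i x} → EqClosure R x (B.from (Q.rep i)) → Q.class (B.to x) ≡ i
  to-from {i} {x} e = trans (class-respects (quotient K p′) (EqC.gmap B.to (λ r → let j , eq = complete r in j , cong (λ (a , b) → B.to a , B.to b) eq) e))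
                            (trans (cong Q.class (B.strictlyInverseˡ _)) (Q.section i))
  from-to : ∀ {x i} → i ≡ Q.class (B.to x) → EqClosure R (B.from (Q.rep i)) x
  from-to {x} refl = subst (EqClosure R _) (B.strictlyInverseʳ x) (R′⇒ (Q.exact (Q.section _)))

module _ {X : Set} {R : Rel X _} {c : ℕ} (C : Classes R c) {S : Set} (w : S → X → X)
         (w-related : ∀ i x → EqClosure R x (w i x))
         (free      : ∀ x {i j} → w i x ≡ w j x → i ≡ j)
         (unit      : ∃ λ i → ∀ x → w i x ≡ x)
         (closed    : ∀ x i {y} → SymClosure R (w i x) y → ∃ λ j → w j x ≡ y) where

  private
    module C = Inverse C

    inOrbit : ∀ {x y z} i → w i x ≡ y → EqClosure R y z → ∃ λ j → w j x ≡ z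
    inOrbit i e ε = i , e
    inOrbit i refl (r ◅ rs) = let j , eq = closed _ i r in inOrbit j eq rs

  -- Each class is identified with `S` through its representative: `closed` lets the maps `w i`
  -- reach the whole class, and `free` makes the index unique.
  orbits : (Fin c × S) ↔ X
  orbits = mk↔ₛ′ to from to-from from-to
    where
    to : Fin c × S → X
    to (a , i) = w i (C.from a)
    position : ∀ x → ∃ λ j → w j (C.from (C.to x)) ≡ x
    position x = inOrbit (proj₁ unit) (proj₂ unit _) (C.strictlyInverseʳ x)
    from : X → Fin c × S
    from x = C.to x , proj₁ (position x)
    to-from : ∀ x → to (from x) ≡ x
    to-from x = proj₂ (position x)
    class-to : ∀ a i → C.to (to (a , i)) ≡ a
    class-to a i = trans (sym (C.to-cong (w-related i (C.from a)))) (C.strictlyInverseˡ a)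
    from-to : ∀ y → from (to y) ≡ y
    from-to (a , i) = cong₂ _,_ (class-to a i)
      (free (C.from a) (trans (cong (w (proj₁ (position x)) ∘ C.from) (sym (class-to a i))) (proj₂ (position x))))
      where x = to (a , i)

  orbit-count : ∀ {N s} → X ↔ Fin N → S ↔ Fin s → N ≡ c * s
  orbit-count fin finS = ↔⇒≡ (Inv.↔-trans (Inv.↔-sym fin) (Inv.↔-trans (Inv.↔-sym orbits)
    (Inv.↔-trans (Inv.↔-refl ×-↔ finS) (Inv.↔-sym Fin.*↔×))))

-- Euler's inequality for a bipartite graph in the 1-skeleton of a cell surface

module _ (M : CellSurface) where

  open CellSurface M

  private
    V E F : ℕ
    V = #cells 0F
    E = #cells 1F
    F = #cells 2F

  cell-τ : ∀ k {i} → i ≢ k → ∀ x → cell k (τ i x) ≡ cell k x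
  cell-τ k i≢k x = sym (Inverse.to-cong (cells k) (fwd (_ , i≢k , refl) ◅ ε))

  representative : ∀ k → Fin (#cells k) → Flag
  representative k = Inverse.from (cells k)

  cell-representative : ∀ k a → cell k (representative k a) ≡ a
  cell-representative k = Inverse.strictlyInverseˡ (cells k)

  cell-constant : ∀ {A : Set} k (f : Flag → A) → (∀ i → i ≢ k → ∀ x → f (τ i x) ≡ f x) →
                  ∀ {x y} → cell k x ≡ cell k y → f x ≡ f y
  cell-constant k f inv {x} {y} e =
    trans (sym (const (Inverse.strictlyInverseʳ (cells k) x)))
          (trans (cong (f ∘ representative k) e) (const (Inverse.strictlyInverseʳ (cells k) y)))
    where
    const : ∀ {x y} → EqClosure (Step τ (_≢ k)) x y → f x ≡ f y
    const = EqC.gfold {S = _≡_} isEquivalence f λ { (i , i≢k , refl) → sym (inv i i≢k _) }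

  surface-constant : ∀ {A : Set} (f : Flag → A) → (∀ i x → f (τ i x) ≡ f x) → ∀ x y → f x ≡ f y
  surface-constant f inv x y =
    EqC.gfold {S = _≡_} isEquivalence f (λ { (i , _ , refl) → sym (inv i _) }) (connected x y)

  aroundEdge : Fin 4 → Flag → Flag
  aroundEdge 0F x = x
  aroundEdge 1F x = τ 0F x
  aroundEdge 2F x = τ 2F x
  aroundEdge 3F x = τ 0F (τ 2F x)

  τ-injective : ∀ i {x y} → τ i x ≡ τ i y → x ≡ y
  τ-injective i e = trans (sym (involutive i _)) (trans (cong (τ i) e) (involutive i _))

  edge-orbits : (Fin E × Fin 4) ↔ Flag
  edge-orbits = orbits (cells 1F) aroundEdge related free (0F , λ _ → refl) closed
    where
    step : ∀ i → i ≢ 1F → ∀ x → EqClosure (Step τ (_≢ 1F)) x (τ i x)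
    step i i≢1 x = fwd (i , i≢1 , refl) ◅ ε
    related : ∀ i x → EqClosure (Step τ (_≢ 1F)) x (aroundEdge i x)
    related 0F x = ε
    related 1F x = step 0F (λ ()) x
    related 2F x = step 2F (λ ()) x
    related 3F x = step 2F (λ ()) x ◅◅ step 0F (λ ()) _
    n02 : ∀ x → x ≢ τ 0F (τ 2F x)
    n02 x e = disagree x (trans (cong (τ 0F) e) (involutive 0F _))
    n1 : ∀ x → τ 2F x ≢ τ 0F (τ 2F x)
    n1 x = no-fixed 0F (τ 2F x) ∘ sym
    n2 : ∀ x → τ 0F x ≢ τ 0F (τ 2F x)
    n2 x = no-fixed 2F x ∘ sym ∘ τ-injective 0F
    free : ∀ x {i j} → aroundEdge i x ≡ aroundEdge j x → i ≡ j
    free x {0F} {0F} e = refl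
    free x {0F} {1F} e = contradiction (sym e) (no-fixed 0F x)
    free x {0F} {2F} e = contradiction (sym e) (no-fixed 2F x)
    free x {0F} {3F} e = contradiction e (n02 x)
    free x {1F} {0F} e = contradiction e (no-fixed 0F x)
    free x {1F} {1F} e = refl
    free x {1F} {2F} e = contradiction e (disagree x)
    free x {1F} {3F} e = contradiction e (n2 x)
    free x {2F} {0F} e = contradiction e (no-fixed 2F x)
    free x {2F} {1F} e = contradiction (sym e) (disagree x)
    free x {2F} {2F} e = refl
    free x {2F} {3F} e = contradiction e (n1 x)
    free x {3F} {0F} e = contradiction (sym e) (n02 x)
    free x {3F} {1F} e = contradiction (sym e) (n2 x)
    free x {3F} {2F} e = contradiction (sym e) (n1 x)
    free x {3F} {3F} e = refl
    move : ∀ i → i ≢ 1F → ∀ j x → ∃ λ k → aroundEdge k x ≡ τ i (aroundEdge j x)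
    move 0F _ 0F x = 1F , refl
    move 0F _ 1F x = 0F , sym (involutive 0F x)
    move 0F _ 2F x = 3F , refl
    move 0F _ 3F x = 2F , sym (involutive 0F _)
    move 1F i≢1 _ _ = contradiction refl i≢1
    move 2F _ 0F x = 2F , refl
    move 2F _ 1F x = 3F , commute x
    move 2F _ 2F x = 0F , sym (involutive 2F x)
    move 2F _ 3F x = 1F , sym (trans (sym (commute _)) (cong (τ 0F) (involutive 2F x)))
    closed : ∀ x j {y} → SymClosure (Step τ (_≢ 1F)) (aroundEdge j x) y → ∃ λ k → aroundEdge k x ≡ y
    closed x j (fwd (i , i≢1 , refl)) = move i i≢1 j x
    closed x j {y} (bwd (i , i≢1 , e)) =
      let k , eq = move i i≢1 j x in k , trans eq (trans (cong (τ i) (sym e)) (involutive i y))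

  flagSum : (Flag → Bool) → Bool
  flagSum h = sum (h ∘ Inverse.from (proj₂ finite))

  flagSum-orbits : ∀ {c s} (O : (Fin c × Fin s) ↔ Flag) (h : Flag → Bool) →
                   flagSum h ≡ sum (λ a → sum (λ i → h (Inverse.to O (a , i))))
  flagSum-orbits {c} {s} O h = begin
    sum (h ∘ B.from)                                               ≡⟨ ∑-permute (h ∘ B.from) π ⟩
    sum (λ i → h (B.from (B.to (O.to (Fin*.to i)))))               ≡⟨ sum-combine c {s} (λ i → h (B.from (B.to (O.to (Fin*.to i))))) ⟩
    sum (λ a → sum (λ i → h (B.from (B.to (O.to (Fin*.to (combine {c} {s} a i)))))))
      ≡⟨ sum-cong-≗ (λ a → sum-cong-≗ (λ i → cong h (trans (B.strictlyInverseʳ _) (cong O.to (Fin.remQuot-combine a i))))) ⟩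
    sum (λ a → sum (λ i → h (O.to (a , i)))) ∎
    where
    open ≡-Reasoning
    module B = Inverse (proj₂ finite)
    module O = Inverse O
    module Fin* = Inverse (Fin.*↔× {c} {s})
    π : Fin (c * s) ↔ Fin (proj₁ finite)
    π = Inv.↔-trans Fin.*↔× (Inv.↔-trans O (proj₂ finite))

  -- Since `τ 1F` is an involution without fixed points, equal values cancel in pairs modulo two.
  flagSum-even : ∀ h → (∀ x → h (τ 1F x) ≡ h x) → flagSum h ≡ false
  flagSum-even h inv = trans (flagSum-orbits O h) (sum-zero _ λ a → pair (Inverse.to O (a , 0F)))
    where
    pair : ∀ x → h x xor (h (τ 1F x) xor false) ≡ false
    pair x = trans (cong (h x xor_) (trans (Bool.xor-identityʳ _) (inv x))) (Bool.xor-same (h x))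
    R : Rel Flag _
    R x y = τ 1F x ≡ y
    module B = Inverse (proj₂ finite)
    classes : ∃ (Classes R)
    classes = finiteClasses (proj₂ finite) R _ (λ i → B.from i , τ 1F (B.from i)) (λ i → fwd refl ◅ ε)
                (λ { {x} refl → B.to x , cong₂ _,_ (B.strictlyInverseʳ x) (cong (τ 1F) (B.strictlyInverseʳ x)) })
    w : Fin 2 → Flag → Flag
    w 0F x = x
    w 1F x = τ 1F x
    related : ∀ i x → EqClosure R x (w i x)
    related 0F x = ε
    related 1F x = fwd refl ◅ ε
    free : ∀ x {i j} → w i x ≡ w j x → i ≡ j
    free x {0F} {0F} e = refl
    free x {0F} {1F} e = contradiction (sym e) (no-fixed 1F x)
    free x {1F} {0F} e = contradiction e (no-fixed 1F x)
    free x {1F} {1F} e = refl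
    closed : ∀ x i {y} → SymClosure R (w i x) y → ∃ λ j → w j x ≡ y
    closed x 0F (fwd refl) = 1F , refl
    closed x 1F (fwd refl) = 0F , sym (involutive 1F x)
    closed x 0F (bwd refl) = 1F , involutive 1F _
    closed x 1F (bwd e) = 0F , τ-injective 1F (sym e)
    O : (Fin (proj₁ classes) × Fin 2) ↔ Flag
    O = orbits (proj₂ classes) w related free (0F , λ _ → refl) closed

  -- The coboundaries of a set of vertices and, dually, of a set of faces, as functions of a flag at the edge.
  δ⁰ : (Fin V → Bool) → Flag → Bool
  δ⁰ S x = S (cell 0F x) xor S (cell 0F (τ 0F x))

  δ² : (Fin F → Bool) → Flag → Bool
  δ² T x = T (cell 2F x) xor T (cell 2F (τ 2F x))

  δ-edge : ∀ S {x y} → cell 1F x ≡ cell 1F y → δ⁰ S x ≡ δ⁰ S y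
  δ-edge S = cell-constant 1F (δ⁰ S) λ
    { 0F _ x → trans (cong (λ z → S (cell 0F (τ 0F x)) xor S (cell 0F z)) (involutive 0F x)) (Bool.xor-comm (S (cell 0F (τ 0F x))) _)
    ; 1F i≢1 x → contradiction refl i≢1
    ; 2F _ x → cong₂ (λ a b → S a xor S b) (cell-τ 0F (λ ()) x)
                 (trans (cong (cell 0F) (commute x)) (cell-τ 0F (λ ()) _)) }

  δ*-edge : ∀ T {x y} → cell 1F x ≡ cell 1F y → δ² T x ≡ δ² T y
  δ*-edge T = cell-constant 1F (δ² T) λ
    { 0F _ x → cong₂ (λ a b → T a xor T b) (cell-τ 2F (λ ()) x)
                 (trans (cong (cell 2F) (sym (commute x))) (cell-τ 2F (λ ()) _))
    ; 1F i≢1 x → contradiction refl i≢1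
    ; 2F _ x → trans (cong (λ z → T (cell 2F (τ 2F x)) xor T (cell 2F z)) (involutive 2F x)) (Bool.xor-comm (T (cell 2F (τ 2F x))) _) }

  -- Both sides of the pairing expand to the sum of S v ∧ T f over the flags, which τ 1F cancels in pairs.
  δ⊥δ* : ∀ S T → sum (λ e → δ⁰ S (representative 1F e) ∧ δ² T (representative 1F e)) ≡ false
  δ⊥δ* S T = trans (sum-cong-≗ (λ e → around (representative 1F e)))
                   (trans (sym (flagSum-orbits edge-orbits h)) (flagSum-even h λ x → cong₂ (λ a b → S a ∧ T b) (cell-τ 0F (λ ()) x) (cell-τ 2F (λ ()) x)))
    where
    h : Flag → Bool
    h y = S (cell 0F y) ∧ T (cell 2F y)
    expand : ∀ a b c d → (a xor b) ∧ (c xor d) ≡ a ∧ c xor (b ∧ c xor (a ∧ d xor (b ∧ d xor false)))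
    expand false b c d = lemma b c d
      where
      lemma : ∀ b c d → b ∧ (c xor d) ≡ b ∧ c xor (b ∧ d xor false)
      lemma false _ _ = refl
      lemma true c d = cong (c xor_) (sym (Bool.xor-identityʳ d))
    expand true false false d = sym (trans (Bool.xor-identityʳ _) refl)
    expand true false true d = cong not (sym (Bool.xor-identityʳ d))
    expand true true false false = refl
    expand true true false true = refl
    expand true true true false = refl
    expand true true true true = refl
    around : ∀ x → δ⁰ S x ∧ δ² T x ≡ sum (λ i → h (aroundEdge i x))
    around x = trans (expand (S (cell 0F x)) (S (cell 0F (τ 0F x))) (T (cell 2F x)) (T (cell 2F (τ 2F x))))
      (cong (h x xor_) (cong₂ _xor_ (cong (λ a → S (cell 0F (τ 0F x)) ∧ T a) (sym (cell-τ 2F (λ ()) x)))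
        (cong₂ _xor_ (cong (λ a → S a ∧ T (cell 2F (τ 2F x))) (sym (cell-τ 0F (λ ()) x)))
          (cong (_xor false) (cong₂ (λ a b → S a ∧ T b)
             (sym (trans (cong (cell 0F) (commute x)) (cell-τ 0F (λ ()) (τ 0F x))))
             (sym (cell-τ 2F (λ ()) (τ 2F x))))))))

-- The graph is given by its vertices `g` and, for each edge, a flag `s i` pointing from the end
-- `P i` to the end `Q i`. Two different edges are assumed because a single edge has only two sides,
-- too few for a lone region.
module Euler (M : CellSurface) {p q : ℕ}
  (g : Fin p → Fin (CellSurface.#cells M 0F)) (s : Fin q → CellSurface.Flag M) (P Q : Fin q → Fin p)
  (source : ∀ i → CellSurface.cell M 0F (s i) ≡ g (P i))
  (target : ∀ i → CellSurface.cell M 0F (CellSurface.τ M 0F (s i)) ≡ g (Q i))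
  (bipartite : ∀ i j → g (P i) ≢ g (Q j))
  (simple : ∀ i j → g (P i) ≡ g (P j) → g (Q i) ≡ g (Q j) → i ≡ j)
  (i₀ i₁ : Fin q) (i₀≢i₁ : i₀ ≢ i₁) where

  open CellSurface M

  private
    V E F : ℕ
    V = #cells 0F
    E = #cells 1F
    F = #cells 2F
    c : ∀ k → Flag → Fin (#cells k)
    c = cell
    s₁ : Fin q → Fin E
    s₁ i = cell 1F (s i)
    rep₁ : Fin E → Flag
    rep₁ = representative M 1F
    δV : (Fin V → Bool) → Flag → Bool
    δV = δ⁰ M
    δF : (Fin F → Bool) → Flag → Bool
    δF = δ² M

  δ-s : ∀ S i → δV S (rep₁ (s₁ i)) ≡ S (g (P i)) xor S (g (Q i))
  δ-s S i = trans (δ-edge M S (cell-representative M 1F (s₁ i))) (cong₂ (λ a b → S a xor S b) (source i) (target i))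

  δ*-s : ∀ T i → δF T (rep₁ (s₁ i)) ≡ δF T (s i)
  δ*-s T i = δ*-edge M T (cell-representative M 1F (s₁ i))

  -- The coboundary of a vertex, evaluated at a 1-cell, detects whether the vertex is exactly one of
  -- its ends. Hence edges on a common 1-cell have the same ends, the bipartition matches `P` with
  -- `P` and `Q` with `Q`, and `simple` applies.
  s₁-injective : ∀ i j → s₁ i ≡ s₁ j → i ≡ j
  s₁-injective i j e = byEnds (ends (g (Q j))) (ends (g (P j)))
    where
    ends : ∀ v → (g (P i) ≡ v ⊎ g (Q i) ≡ v) ⊎ indicator v (g (P j)) xor indicator v (g (Q j)) ≡ false
    ends v with g (P i) Fin.≟ v | g (Q i) Fin.≟ v
    ... | yes e₁ | _ = inj₁ (inj₁ e₁)
    ... | no _ | yes e₂ = inj₁ (inj₂ e₂)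
    ... | no n₁ | no n₂ = inj₂ (trans (sym (δ-s (indicator v) j)) (trans (cong (δV (indicator v) ∘ rep₁) (sym e))
            (trans (δ-s (indicator v) i) (cong₂ _xor_ (indicator-≢ (n₁ ∘ sym)) (indicator-≢ (n₂ ∘ sym))))))
    absurd : ∀ {a b} → a ≡ true → b ≡ false → a xor b ≢ false
    absurd refl refl ()
    absurd′ : ∀ {a b} → a ≡ false → b ≡ true → a xor b ≢ false
    absurd′ refl refl ()
    byEnds : _ → _ → i ≡ j
    byEnds (inj₁ (inj₁ e₁)) _ = contradiction e₁ (bipartite i j)
    byEnds (inj₂ z) _ = contradiction z (absurd′ (indicator-≢ (bipartite j j ∘ sym)) (indicator-≡ {i = g (Q j)} refl))
    byEnds _ (inj₁ (inj₂ e₂)) = contradiction (sym e₂) (bipartite j i)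
    byEnds _ (inj₂ z) = contradiction z (absurd (indicator-≡ {i = g (P j)} refl) (indicator-≢ (bipartite j j)))
    byEnds (inj₁ (inj₂ eQ)) (inj₁ (inj₁ eP)) = simple i j eP eQ

  marked? : ∀ e → Dec (∃ λ i → s₁ i ≡ e)
  marked? e = Fin.any? (λ i → s₁ i Fin.≟ e)

  -- The regions into which the graph divides the surface.
  crossing : Fin E → Fin F × Fin F
  crossing e with marked? e
  ... | yes _ = c 2F (rep₁ e) , c 2F (rep₁ e)
  ... | no  _ = c 2F (rep₁ e) , c 2F (τ 2F (rep₁ e))

  module R = FiniteQuotient (quotient E crossing)

  regions : ℕ
  regions = R.size

  constant-on-regions : ∀ {A : Set} (T : Fin F → A) →
    (∀ e → (∀ i → s₁ i ≢ e) → T (c 2F (rep₁ e)) ≡ T (c 2F (τ 2F (rep₁ e)))) → ∀ f → T (R.rep (R.class f)) ≡ T f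
  constant-on-regions T h f = EqC.gfold {S = _≡_} isEquivalence T step (R.exact (R.section (R.class f)))
    where
    step : ∀ {x y} → Listed crossing x y → T x ≡ T y
    step (e , eq) with marked? e | eq
    ... | yes _ | refl = refl
    ... | no n | refl = h e λ i eq′ → n (i , eq′)

  class-crossing : ∀ e → (∀ i → s₁ i ≢ e) → R.class (c 2F (rep₁ e)) ≡ R.class (c 2F (τ 2F (rep₁ e)))
  class-crossing e n = R.respect (e , eq)
    where
    eq : crossing e ≡ (c 2F (rep₁ e) , c 2F (τ 2F (rep₁ e)))
    eq with marked? e
    ... | yes (i , eq) = contradiction eq (n i)
    ... | no _ = refl

  δ-zero : ∀ S → (∀ e → δV S (rep₁ e) ≡ false) → ∀ x y → S (c 0F x) ≡ S (c 0F y)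
  δ-zero S h = surface-constant M (S ∘ c 0F) λ
    { 0F x → sym (xor-cancel _ _ (trans (δ-edge M S (sym (cell-representative M 1F (cell 1F x)))) (h _)))
    ; 1F x → cong S (cell-τ M 0F (λ ()) x)
    ; 2F x → cong S (cell-τ M 0F (λ ()) x) }

  δ*-zero : ∀ T → (∀ e → δF T (rep₁ e) ≡ false) → ∀ x y → T (c 2F x) ≡ T (c 2F y)
  δ*-zero T h = surface-constant M (T ∘ c 2F) λ
    { 0F x → cong T (cell-τ M 2F (λ ()) x)
    ; 1F x → cong T (cell-τ M 2F (λ ()) x)
    ; 2F x → sym (xor-cancel _ _ (trans (δ*-edge M T (sym (cell-representative M 1F (cell 1F x)))) (h _))) }

  sum-δ : ∀ {n} (f : Fin n → Fin n → Bool) (u : Fin n → Bool) a b →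
          sum (λ i → u i ∧ (f i a xor f i b)) ≡ sum (λ i → u i ∧ f i a) xor sum (λ i → u i ∧ f i b)
  sum-δ f u a b = trans (sum-cong-≗ (λ i → Bool.∧-distribˡ-xor (u i) (f i a) (f i b))) (∑-distrib-+ (λ i → u i ∧ f i a) _)

  -- The rows of `A` are the coboundaries of the vertices of the surface, extended by incidence with
  -- the vertices of the graph. Orthogonal to them are the coboundaries of the faces, extended by
  -- incidence with the representatives of regions, and the edges of the graph, extended by their
  -- two ends. The extensions make both families independent.
  rank-bound : V + (F + q) ≤ E + (p + regions)
  rank-bound = blockOrthogonal⇒≤ A₁ A₂ B₁ B₃ C₁ C₂ indA indBC
                 (λ v f → δ⊥δ* M (indicator v) (indicator f)) orthC
    where
    A₁ : Fin V → Fin E → Bool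
    A₁ v e = δV (indicator v) (rep₁ e)
    A₂ : Fin V → Fin p → Bool
    A₂ v j = indicator v (g j)
    B₁ : Fin F → Fin E → Bool
    B₁ f e = δF (indicator f) (rep₁ e)
    B₃ : Fin F → Fin regions → Bool
    B₃ f r = indicator f (R.rep r)
    C₁ : Fin q → Fin E → Bool
    C₁ i e = indicator (s₁ i) e
    C₂ : Fin q → Fin p → Bool
    C₂ i j = indicator (P i) j xor indicator (Q i) j
    combination : ∀ {n} (u : Fin n → Bool) a b → sum (λ i → u i ∧ (indicator i a xor indicator i b)) ≡ u a xor u b
    combination u a b = trans (sum-δ indicator u a b) (cong₂ _xor_ (sum-indicatorˡ u a) (sum-indicatorˡ u b))
    -- A combination with zero coboundary is constant, and a vertex of the graph shows that the
    -- constant is zero.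
    indA : ∀ u → (∀ e → sum (λ v → u v ∧ A₁ v e) ≡ false) → (∀ j → sum (λ v → u v ∧ A₂ v j) ≡ false) → ∀ v → u v ≡ false
    indA u h₁ h₂ v = begin
      u v                        ≡⟨ cong u (sym (cell-representative M 0F v)) ⟩
      u (c 0F (representative M 0F v)) ≡⟨ δ-zero u (λ e → trans (sym (combination u _ _)) (h₁ e)) _ (s i₀) ⟩
      u (c 0F (s i₀))            ≡⟨ cong u (source i₀) ⟩
      u (g (P i₀))               ≡⟨ sym (sum-indicatorˡ u (g (P i₀))) ⟩
      sum (λ v → u v ∧ A₂ v (P i₀)) ≡⟨ h₂ (P i₀) ⟩
      false ∎
      where open ≡-Reasoning
    -- Off the graph the faces in `u` have no coboundary, so `u` is constant on each region and
    -- vanishes at its representative. What remains is a combination of distinct unit vectors.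
    indBC : ∀ u w → (∀ e → sum (λ f → u f ∧ B₁ f e) xor sum (λ i → w i ∧ C₁ i e) ≡ false) →
            (∀ r → sum (λ f → u f ∧ B₃ f r) ≡ false) → (∀ f → u f ≡ false) × (∀ i → w i ≡ false)
    indBC u w h₁ h₂ = u≡0 , w≡0
      where
      h₁′ : ∀ e → δF u (rep₁ e) xor sum (λ i → w i ∧ C₁ i e) ≡ false
      h₁′ e = trans (cong (_xor sum (λ i → w i ∧ C₁ i e)) (sym (combination u _ _))) (h₁ e)
      u≡0 : ∀ f → u f ≡ false
      u≡0 f = trans (sym (constant-on-regions u unmarked f)) (trans (sym (sum-indicatorˡ u _)) (h₂ (R.class f)))
        where
        unmarked : ∀ e → (∀ i → s₁ i ≢ e) → u (c 2F (rep₁ e)) ≡ u (c 2F (τ 2F (rep₁ e)))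
        unmarked e n = xor-cancel _ _ (trans (sym (Bool.xor-identityʳ _)) (trans (cong (δF u (rep₁ e) xor_)
          (sym (sum-zero _ λ i → trans (cong (w i ∧_) (indicator-≢ (n i))) (Bool.∧-zeroʳ (w i))))) (h₁′ e)))
      w≡0 : ∀ i → w i ≡ false
      w≡0 i = begin
        w i ≡⟨ sym (Bool.∧-identityʳ (w i)) ⟩
        w i ∧ true ≡⟨ cong (w i ∧_) (sym (indicator-≡ {i = s₁ i} refl)) ⟩
        w i ∧ C₁ i (s₁ i) ≡⟨ sym (sum-single _ i λ j j≢i → trans (cong (w j ∧_) (indicator-≢ (j≢i ∘ s₁-injective j i))) (Bool.∧-zeroʳ (w j))) ⟩
        sum (λ j → w j ∧ C₁ j (s₁ i)) ≡⟨ cong (_xor sum (λ j → w j ∧ C₁ j (s₁ i))) (sym (cong₂ _xor_ (u≡0 (c 2F (rep₁ (s₁ i)))) (u≡0 (c 2F (τ 2F (rep₁ (s₁ i))))))) ⟩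
        δF u (rep₁ (s₁ i)) xor sum (λ j → w j ∧ C₁ j (s₁ i)) ≡⟨ h₁′ (s₁ i) ⟩
        false ∎
        where open ≡-Reasoning
    -- Both blocks record whether `v` is an end of edge `i`, and they cancel.
    orthC : ∀ v i → sum (λ e → A₁ v e ∧ C₁ i e) xor sum (λ j → A₂ v j ∧ C₂ i j) ≡ false
    orthC v i = trans (cong₂ _xor_
      (trans (sum-indicatorʳ (A₁ v) (s₁ i)) (δ-s (indicator v) i))
      (trans (sum-cong-≗ (λ j → Bool.∧-distribˡ-xor (A₂ v j) (indicator (P i) j) _))
        (trans (∑-distrib-+ (λ j → A₂ v j ∧ indicator (P i) j) _)
          (cong₂ _xor_ (sum-indicatorʳ (A₂ v) (P i)) (sum-indicatorʳ (A₂ v) (Q i))))))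
      (Bool.xor-same (indicator v (g (P i)) xor indicator v (g (Q i))))

  -- A region has at least four sides: the edges with exactly one side in it form a nonempty even
  -- subgraph of a simple bipartite graph, unless it is the only region.
  module _ (r : Fin regions) where

    within : Fin F → Bool
    within f = indicator r (R.class f)

    D : Fin q → Bool
    D i = δF within (s i)

    unmarked-zero : ∀ e → (∀ i → s₁ i ≢ e) → δF within (rep₁ e) ≡ false
    unmarked-zero e n = trans (cong (λ z → indicator r z xor within (c 2F (τ 2F (rep₁ e)))) (class-crossing e n)) (Bool.xor-same (within (c 2F (τ 2F (rep₁ e)))))

    -- The coboundaries of `v` and of the region are orthogonal, so an even number of 1-cells at `v`
    -- have exactly one side in the region. A 1-cell outside the graph has both sides or neither, so
    -- the second such 1-cell lies on the graph.
    another : ∀ v i → D i ≡ true → indicator v (g (P i)) xor indicator v (g (Q i)) ≡ true →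
              ∃ λ j → j ≢ i × D j ≡ true × indicator v (g (P j)) xor indicator v (g (Q j)) ≡ true
    another v i Di vi = found (sum-other φ (s₁ i) (δ⊥δ* M (indicator v) within)
                                (cong₂ _∧_ (trans (δ-s (indicator v) i) vi) (trans (δ*-s within i) Di)))
      where
      φ : Fin E → Bool
      φ e = δV (indicator v) (rep₁ e) ∧ δF within (rep₁ e)
      ∧-true : ∀ {a b} → a ∧ b ≡ true → a ≡ true × b ≡ true
      ∧-true {true} {true} _ = refl , refl
      found : (∃ λ e → e ≢ s₁ i × φ e ≡ true) → _
      found (e , e≢ , φe) with marked? e | ∧-true {δV (indicator v) (rep₁ e)} φe
      ... | no n | _ , t = contradiction (trans (sym t) (unmarked-zero e (λ j eq → n (j , eq)))) λ ()
      ... | yes (j , refl) | t₁ , t₂ = j , (λ j≡i → e≢ (cong s₁ j≡i)) , trans (sym (δ*-s within j)) t₂ , trans (sym (δ-s (indicator v) j)) t₁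

    sharesQ : ∀ i → D i ≡ true → ∃ λ j → j ≢ i × D j ≡ true × g (Q i) ≡ g (Q j)
    sharesQ i Di =
      let j , j≢i , Dj , t = another (g (Q i)) i Di (cong₂ _xor_ (indicator-≢ (bipartite i i ∘ sym)) (indicator-≡ {i = g (Q i)} refl))
      in j , j≢i , Dj , indicator⇒≡ (trans (sym (cong (_xor indicator (g (Q i)) (g (Q j))) (indicator-≢ (bipartite j i ∘ sym)))) t)

    sharesP : ∀ i → D i ≡ true → ∃ λ j → j ≢ i × D j ≡ true × g (P i) ≡ g (P j)
    sharesP i Di =
      let j , j≢i , Dj , t = another (g (P i)) i Di (cong₂ _xor_ (indicator-≡ {i = g (P i)} refl) (indicator-≢ (bipartite i i)))
      in j , j≢i , Dj , indicator⇒≡ (trans (sym (Bool.xor-identityʳ _)) (trans (sym (cong (indicator (g (P i)) (g (P j)) xor_) (indicator-≢ (bipartite i j)))) t))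

    side : Fin q × Fin 2 → Fin F
    side (i , 0F) = c 2F (s i)
    side (i , 1F) = c 2F (τ 2F (s i))

    Sides : Set
    Sides = Σ (Fin 4 → Fin q × Fin 2) λ h → (∀ k → R.class (side (h k)) ≡ r) × (∀ {k l} → h k ≡ h l → k ≡ l)

    sideOf : ∀ i → D i ≡ true → ∃ λ k → R.class (side (i , k)) ≡ r
    sideOf i Di with within (c 2F (s i)) in eq
    ... | true = 0F , sym (indicator⇒≡ eq)
    ... | false = 1F , sym (indicator⇒≡ Di)

    distinct⇒sides : ∀ (i : Fin 4 → Fin q) → (∀ k → D (i k) ≡ true) → (∀ {k l} → i k ≡ i l → k ≡ l) → Sides
    distinct⇒sides i Di inj = (λ k → i k , proj₁ (sideOf (i k) (Di k))) , (λ k → proj₂ (sideOf (i k) (Di k))) , (λ e → inj (cong proj₁ e))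

    four : ∀ {A : Set} → A → A → A → A → Fin 4 → A
    four a b c d 0F = a
    four a b c d 1F = b
    four a b c d 2F = c
    four a b c d 3F = d

    four-injective : ∀ {A : Set} {a b c d : A} → b ≢ a → c ≢ a → d ≢ a → c ≢ b → d ≢ b → d ≢ c →
                     ∀ {k l} → four a b c d k ≡ four a b c d l → k ≡ l
    four-injective ba ca da cb db dc {0F} {0F} e = refl
    four-injective ba ca da cb db dc {0F} {1F} e = contradiction (sym e) ba
    four-injective ba ca da cb db dc {0F} {2F} e = contradiction (sym e) ca
    four-injective ba ca da cb db dc {0F} {3F} e = contradiction (sym e) da
    four-injective ba ca da cb db dc {1F} {0F} e = contradiction e ba
    four-injective ba ca da cb db dc {1F} {1F} e = refl
    four-injective ba ca da cb db dc {1F} {2F} e = contradiction (sym e) cb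
    four-injective ba ca da cb db dc {1F} {3F} e = contradiction (sym e) db
    four-injective ba ca da cb db dc {2F} {0F} e = contradiction e ca
    four-injective ba ca da cb db dc {2F} {1F} e = contradiction e cb
    four-injective ba ca da cb db dc {2F} {2F} e = refl
    four-injective ba ca da cb db dc {2F} {3F} e = contradiction (sym e) dc
    four-injective ba ca da cb db dc {3F} {0F} e = contradiction e da
    four-injective ba ca da cb db dc {3F} {1F} e = contradiction e db
    four-injective ba ca da cb db dc {3F} {2F} e = contradiction e dc
    four-injective ba ca da cb db dc {3F} {3F} e = refl

    -- A path i, j, k, l is followed through `Q`, `P`, `Q`. Edges `j` and `k` share their `P`, so
    -- simplicity separates their ends in `Q`; this keeps `k` and `l` apart from `i` and `j`, and
    -- each of the four edges contributes one side.
    boundary⇒sides : ∀ i → D i ≡ true → Sides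
    boundary⇒sides i Di = from-j (sharesQ i Di)
      where
      from-l : ∀ {j k} → j ≢ i → D j ≡ true → g (Q i) ≡ g (Q j) → k ≢ j → D k ≡ true → g (P j) ≡ g (P k) →
               (∃ λ l → l ≢ k × D l ≡ true × g (Q k) ≡ g (Q l)) → Sides
      from-l {j} {k} j≢i Dj ij k≢j Dk jk (l , l≢k , Dl , kl) = distinct⇒sides (four i j k l)
        (λ { 0F → Di ; 1F → Dj ; 2F → Dk ; 3F → Dl })
        (four-injective j≢i
          (λ { refl → Qk≢Qj ij }) (λ { refl → Qk≢Qj (trans kl ij) })
          k≢j (λ { refl → Qk≢Qj kl }) l≢k)
        where
        Qk≢Qj : g (Q k) ≢ g (Q j)
        Qk≢Qj e = k≢j (simple k j (sym jk) e)
      from-k : ∀ {j} → j ≢ i → D j ≡ true → g (Q i) ≡ g (Q j) → (∃ λ k → k ≢ j × D k ≡ true × g (P j) ≡ g (P k)) → Sides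
      from-k j≢i Dj ij (k , k≢j , Dk , jk) = from-l j≢i Dj ij k≢j Dk jk (sharesQ k Dk)
      from-j : (∃ λ j → j ≢ i × D j ≡ true × g (Q i) ≡ g (Q j)) → Sides
      from-j (j , j≢i , Dj , ij) = from-k j≢i Dj ij (sharesP j Dj)

    -- No 1-cell separates the region from anything, so by connectedness it contains every face, in
    -- particular both sides of `i₀` and of `i₁`.
    whole⇒sides : (∀ i → D i ≡ false) → Sides
    whole⇒sides D≡0 = four (i₀ , 0F) (i₀ , 1F) (i₁ , 0F) (i₁ , 1F) ,
      (λ k → sym (indicator⇒≡ (all (side (four (i₀ , 0F) (i₀ , 1F) (i₁ , 0F) (i₁ , 1F) k))))) ,
      four-injective (λ ()) (λ e → i₀≢i₁ (sym (cong proj₁ e))) (λ e → i₀≢i₁ (sym (cong proj₁ e)))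
                     (λ e → i₀≢i₁ (sym (cong proj₁ e))) (λ e → i₀≢i₁ (sym (cong proj₁ e))) (λ ())
      where
      zero-everywhere : ∀ e → δF within (rep₁ e) ≡ false
      zero-everywhere e with marked? e
      ... | yes (i , refl) = trans (δ*-s within i) (D≡0 i)
      ... | no n = unmarked-zero e (λ i eq → n (i , eq))
      all : ∀ f → within f ≡ true
      all f = begin
        within f ≡⟨ cong within (sym (cell-representative M 2F f)) ⟩
        within (c 2F (representative M 2F f)) ≡⟨ δ*-zero within zero-everywhere _ (representative M 2F (R.rep r)) ⟩
        within (c 2F (representative M 2F (R.rep r))) ≡⟨ cong within (cell-representative M 2F (R.rep r)) ⟩
        within (R.rep r) ≡⟨ indicator-≡ (sym (R.section r)) ⟩
        true ∎
        where open ≡-Reasoning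

    sides : Sides
    sides with Fin.any? (λ i → D i Bool.≟ true)
    ... | yes (i , Di) = boundary⇒sides i Di
    ... | no n = whole⇒sides (λ i → Bool.¬-not (λ Di → n (i , Di)))

  -- A side determines its region, so the choices of four sides for different regions are disjoint.
  regions-bound : regions * 4 ≤ q * 2
  regions-bound = Fin.injective⇒≤ {f = f} f-injective
    where
    h : Fin regions × Fin 4 → Fin q × Fin 2
    h (r , k) = proj₁ (sides r) k
    h-injective : ∀ x y → h x ≡ h y → x ≡ y
    h-injective (r , k) (r′ , k′) e with trans (sym (proj₁ (proj₂ (sides r)) k)) (trans (cong (R.class ∘ side′) e) (proj₁ (proj₂ (sides r′)) k′))
      where
      side′ : Fin q × Fin 2 → Fin F
      side′ = side r
    ... | eq = go eq e
      where
      go : r ≡ r′ → h (r , k) ≡ h (r′ , k′) → (r , k) ≡ (r′ , k′)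
      go refl e = cong (r ,_) (proj₂ (proj₂ (sides r)) e)
    f : Fin (regions * 4) → Fin (q * 2)
    f i = uncurry combine (h (remQuot {regions} 4 i))
    f-injective : ∀ {i j} → f i ≡ f j → i ≡ j
    f-injective {i} {j} e = trans (sym (Fin.combine-remQuot {regions} 4 i))
      (trans (cong (uncurry combine) (h-injective _ _ h-eq)) (Fin.combine-remQuot {regions} 4 j))
      where
      h-eq : h (remQuot {regions} 4 i) ≡ h (remQuot {regions} 4 j)
      h-eq = uncurry (cong₂ _,_) (Fin.combine-injective (proj₁ (h (remQuot {regions} 4 i))) _ _ _ e)

  euler-bound : 2 * (V + F) + q ≤ 2 * (E + p)
  euler-bound = ℕ.+-cancelʳ-≤ (q + 2 * regions) _ _ (begin
    2 * (V + F) + q + (q + 2 * regions)   ≡⟨ lhs V F q regions ⟩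
    2 * (V + (F + q)) + 2 * regions       ≤⟨ ℕ.+-mono-≤ (ℕ.*-monoʳ-≤ 2 rank-bound) 2r≤q ⟩
    2 * (E + (p + regions)) + q           ≡⟨ rhs E p q regions ⟩
    2 * (E + p) + (q + 2 * regions)       ∎)
    where
    open ℕ.≤-Reasoning
    2r≤q : 2 * regions ≤ q
    2r≤q = ℕ.*-cancelʳ-≤ (2 * regions) q 2 (ℕ.≤-trans (ℕ.≤-reflexive (trans (cong (_* 2) (ℕ.*-comm 2 regions)) (ℕ.*-assoc regions 2 2))) regions-bound)
    lhs : ∀ V F q r → 2 * (V + F) + q + (q + 2 * r) ≡ 2 * (V + (F + q)) + 2 * r
    lhs = solve-∀
    rhs : ∀ E p q r → 2 * (E + (p + r)) + q ≡ 2 * (E + p) + (q + 2 * r)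
    rhs = solve-∀

-- Triples of points and the Levi graph of the complete 3-uniform hypergraph

-- An ordered triple. The proofs of distinctness are irrelevant, so that equality is decided by the
-- three points.
record Triple (n : ℕ) : Set where
  constructor tri
  field
    a b c : Fin n
    .a≢b : a ≢ b
    .a≢c : a ≢ c
    .b≢c : b ≢ c

relevant : ∀ {n} {x y : Fin n} → .(x ≢ y) → x ≢ y
relevant x≢y e = ⊥-elim-irr (x≢y e)

Triple↔ : ∀ {m} → Triple (2 + m) ↔ Fin ((2 + m) * ((1 + m) * m))
Triple↔ {m} = Inv.↔-trans coordinates (Inv.↔-sym (Inv.↔-trans (Fin.*↔× {2 + m}) (Inv.↔-refl ×-↔ Fin.*↔× {1 + m})))
  where
  to : Triple (2 + m) → Fin (2 + m) × Fin (1 + m) × Fin m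
  to (tri a b c a≢b a≢c b≢c) = a , punchOut (relevant a≢b) ,
    punchOut {i = punchOut (relevant a≢b)} {punchOut (relevant a≢c)}
      (relevant b≢c ∘ Fin.punchOut-injective (relevant a≢b) (relevant a≢c))
  from : Fin (2 + m) × Fin (1 + m) × Fin m → Triple (2 + m)
  from (a , b , c) = tri a (punchIn a b) (punchIn a (punchIn b c))
    (Fin.punchInᵢ≢i a b ∘ sym) (Fin.punchInᵢ≢i a (punchIn b c) ∘ sym)
    (λ e → Fin.punchInᵢ≢i b c (sym (Fin.punchIn-injective a b _ e)))
  tri-cong : ∀ {a b b′ c c′ : Fin (2 + m)} .{p p′ q q′ r r′} → b ≡ b′ → c ≡ c′ → tri a b c p q r ≡ tri a b′ c′ p′ q′ r′
  tri-cong refl refl = refl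
  from-to : ∀ t → from (to t) ≡ t
  from-to (tri a b c a≢b a≢c b≢c) = tri-cong (Fin.punchIn-punchOut (relevant a≢b))
    (trans (cong (punchIn a) (Fin.punchIn-punchOut {i = punchOut (relevant a≢b)} _)) (Fin.punchIn-punchOut (relevant a≢c)))
  to-from : ∀ x → to (from x) ≡ x
  to-from (a , b , c) = cong (a ,_) (pair (Fin.punchOut-punchIn a)
    (λ {q} → Fin.punchOut-punchIn a) )
    where
    pair : ∀ {b′ c′ : Fin (1 + m)} {b′≢c′ : b′ ≢ c′} → b′ ≡ b → (∀ {q : ⊤} → c′ ≡ punchIn b c) → (b′ , punchOut b′≢c′) ≡ (b , c)
    pair refl e = cong (b ,_) (trans (Fin.punchOut-cong b (e {tt})) (Fin.punchOut-punchIn b))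
  coordinates : Triple (2 + m) ↔ (Fin (2 + m) × Fin (1 + m) × Fin m)
  coordinates = mk↔ₛ′ to from to-from from-to

stepClasses : ∀ {X : Set} {N G} → X ↔ Fin N → (γ : Fin G → X → X) (P : Fin G → Set) → (∀ i → Dec (P i)) →
              ∃ (Classes (λ x y → ∃ λ i → P i × γ i x ≡ y))
stepClasses {X} {N} {G} fin γ P P? = finiteClasses fin R (G * N) (pair ∘ remQuot {G} N) (sound ∘ remQuot {G} N) complete
  where
  module B = Inverse fin
  R : Rel X _
  R x y = ∃ λ i → P i × γ i x ≡ y
  pair : Fin G × Fin N → X × X
  pair (i , k) with P? i
  ... | yes _ = B.from k , γ i (B.from k)
  ... | no _  = B.from k , B.from k
  sound : ∀ ik → EqClosure R (proj₁ (pair ik)) (proj₂ (pair ik))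
  sound (i , k) with P? i
  ... | yes p = fwd (i , p , refl) ◅ ε
  ... | no _  = ε
  pair-yes : ∀ {i k} → P i → pair (i , k) ≡ (B.from k , γ i (B.from k))
  pair-yes {i} p with P? i
  ... | yes _ = refl
  ... | no ¬p = contradiction p ¬p
  complete : ∀ {x y} → R x y → ∃ λ ik → pair (remQuot {G} N ik) ≡ (x , y)
  complete {x} (i , p , refl) = combine i (B.to x) ,
    trans (cong pair (Fin.remQuot-combine i (B.to x)))
          (trans (pair-yes p) (cong (λ z → z , γ i z) (B.strictlyInverseʳ x)))

module _ {n : ℕ} where

  exchange : Fin 2 → Triple n → Triple n
  exchange 0F (tri a b c p q r) = tri b a c (p ∘ sym) r q
  exchange 1F (tri a b c p q r) = tri a c b q p (r ∘ sym)

  exchange-involutive : ∀ i t → exchange i (exchange i t) ≡ t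
  exchange-involutive 0F t = refl
  exchange-involutive 1F t = refl

  Reordered : Rel (Triple n) _
  Reordered x y = ∃ λ i → ⊤ × exchange i x ≡ y

  reorder : Fin 6 → Triple n → Triple n
  reorder 0F t = t
  reorder 1F t = exchange 0F t
  reorder 2F t = exchange 1F t
  reorder 3F t = exchange 0F (exchange 1F t)
  reorder 4F t = exchange 1F (exchange 0F t)
  reorder 5F t = exchange 0F (exchange 1F (exchange 0F t))

  reorder-related : ∀ i t → EqClosure Reordered t (reorder i t)
  reorder-related i t = path i
    where
    step : ∀ j t → EqClosure Reordered t (exchange j t)
    step j t = fwd (j , tt , refl) ◅ ε
    path : ∀ i → EqClosure Reordered t (reorder i t)
    path 0F = ε
    path 1F = step 0F t
    path 2F = step 1F t
    path 3F = step 1F t ◅◅ step 0F _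
    path 4F = step 0F t ◅◅ step 1F _
    path 5F = step 0F t ◅◅ step 1F _ ◅◅ step 0F _

  reorder-free : ∀ t {i j} → reorder i t ≡ reorder j t → i ≡ j
  reorder-free t@(tri a b c p q r) {i} {j} e = free i j (cong Triple.a e) (cong Triple.b e)
    where
    absurd : ∀ {A : Set} {x y : Fin n} → .(x ≢ y) → x ≡ y → A
    absurd x≢y e = ⊥-elim-irr (x≢y e)
    free : ∀ i j → Triple.a (reorder i t) ≡ Triple.a (reorder j t) → Triple.b (reorder i t) ≡ Triple.b (reorder j t) → i ≡ j
    free 0F 0F _ _ = refl
    free 1F 1F _ _ = refl
    free 2F 2F _ _ = refl
    free 3F 3F _ _ = refl
    free 4F 4F _ _ = refl
    free 5F 5F _ _ = refl
    free 0F 1F e _ = absurd p e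
    free 0F 2F _ e = absurd r e
    free 0F 3F e _ = absurd q e
    free 0F 4F e _ = absurd p e
    free 0F 5F e _ = absurd q e
    free 1F 0F e _ = absurd p (sym e)
    free 1F 2F e _ = absurd p (sym e)
    free 1F 3F e _ = absurd r e
    free 1F 4F _ e = absurd q e
    free 1F 5F e _ = absurd r e
    free 2F 0F _ e = absurd r (sym e)
    free 2F 1F e _ = absurd p e
    free 2F 3F e _ = absurd q e
    free 2F 4F e _ = absurd p e
    free 2F 5F e _ = absurd q e
    free 3F 0F e _ = absurd q (sym e)
    free 3F 1F e _ = absurd r (sym e)
    free 3F 2F e _ = absurd q (sym e)
    free 3F 4F e _ = absurd r (sym e)
    free 3F 5F _ e = absurd p e
    free 4F 0F e _ = absurd p (sym e)
    free 4F 1F _ e = absurd q (sym e)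
    free 4F 2F e _ = absurd p (sym e)
    free 4F 3F e _ = absurd r e
    free 4F 5F e _ = absurd r e
    free 5F 0F e _ = absurd q (sym e)
    free 5F 1F e _ = absurd r (sym e)
    free 5F 2F e _ = absurd q (sym e)
    free 5F 3F _ e = absurd p (sym e)
    free 5F 4F e _ = absurd r (sym e)

  exchange-reorder : ∀ t k i → ∃ λ j → reorder j t ≡ exchange k (reorder i t)
  exchange-reorder t 0F 0F = 1F , refl
  exchange-reorder t 0F 1F = 0F , refl
  exchange-reorder t 0F 2F = 3F , refl
  exchange-reorder t 0F 3F = 2F , refl
  exchange-reorder t 0F 4F = 5F , refl
  exchange-reorder t 0F 5F = 4F , refl
  exchange-reorder t 1F 0F = 2F , refl
  exchange-reorder t 1F 1F = 4F , refl
  exchange-reorder t 1F 2F = 0F , refl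
  exchange-reorder t 1F 3F = 5F , refl
  exchange-reorder t 1F 4F = 1F , refl
  exchange-reorder t 1F 5F = 3F , refl

  reorder-closed : ∀ t i {u} → SymClosure Reordered (reorder i t) u → ∃ λ j → reorder j t ≡ u
  reorder-closed t i (fwd (k , _ , refl)) = exchange-reorder t k i
  reorder-closed t i {u} (bwd (k , _ , e)) =
    let j , eq = exchange-reorder t k i in j , trans eq (trans (cong (exchange k) (sym e)) (exchange-involutive k u))

  triples : ∀ {N} → Triple n ↔ Fin N → ∃ (Classes Reordered)
  triples fin = stepClasses fin exchange (λ _ → ⊤) (λ _ → yes tt)

  triple-count : ∀ {N t} → Triple n ↔ Fin N → Classes Reordered t → N ≡ t * 6
  triple-count fin C = orbit-count C reorder reorder-related reorder-free (0F , λ _ → refl) reorder-closed fin Inv.↔-refl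

  underlying : Triple n → Subset n
  underlying (tri a b c _ _ _) = ⁅ a ⁆ ∪ (⁅ b ⁆ ∪ ⁅ c ⁆)

  ∈-underlying⁻ : ∀ {x} t → x ∈ underlying t → x ≡ Triple.a t ⊎ x ≡ Triple.b t ⊎ x ≡ Triple.c t
  ∈-underlying⁻ (tri a b c _ _ _) x∈ with Subset.x∈p∪q⁻ ⁅ a ⁆ _ x∈
  ... | inj₁ x∈a = inj₁ (Subset.x∈⁅y⁆⇒x≡y a x∈a)
  ... | inj₂ x∈bc with Subset.x∈p∪q⁻ ⁅ b ⁆ _ x∈bc
  ...   | inj₁ x∈b = inj₂ (inj₁ (Subset.x∈⁅y⁆⇒x≡y b x∈b))
  ...   | inj₂ x∈c = inj₂ (inj₂ (Subset.x∈⁅y⁆⇒x≡y c x∈c))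

  a∈underlying : ∀ t → Triple.a t ∈ underlying t
  a∈underlying (tri a b c _ _ _) = Subset.x∈p∪q⁺ (inj₁ (Subset.x∈⁅x⁆ a))

  b∈underlying : ∀ t → Triple.b t ∈ underlying t
  b∈underlying (tri a b c _ _ _) = Subset.x∈p∪q⁺ {p = ⁅ a ⁆} (inj₂ (Subset.x∈p∪q⁺ (inj₁ (Subset.x∈⁅x⁆ b))))

  c∈underlying : ∀ t → Triple.c t ∈ underlying t
  c∈underlying (tri a b c _ _ _) = Subset.x∈p∪q⁺ {p = ⁅ a ⁆} (inj₂ (Subset.x∈p∪q⁺ {p = ⁅ b ⁆} (inj₂ (Subset.x∈⁅x⁆ c))))

  underlying-⊆ : ∀ t {e} → Triple.a t ∈ e → Triple.b t ∈ e → Triple.c t ∈ e → underlying t ⊆ e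
  underlying-⊆ t a∈ b∈ c∈ x∈ with ∈-underlying⁻ t x∈
  ... | inj₁ refl = a∈
  ... | inj₂ (inj₁ refl) = b∈
  ... | inj₂ (inj₂ refl) = c∈

  underlying-exchange : ∀ i t → underlying (exchange i t) ≡ underlying t
  underlying-exchange 0F t = Subset.⊆-antisym
    (underlying-⊆ (exchange 0F t) (b∈underlying t) (a∈underlying t) (c∈underlying t))
    (underlying-⊆ t (b∈underlying (exchange 0F t)) (a∈underlying (exchange 0F t)) (c∈underlying (exchange 0F t)))
  underlying-exchange 1F t = Subset.⊆-antisym
    (underlying-⊆ (exchange 1F t) (a∈underlying t) (c∈underlying t) (b∈underlying t))
    (underlying-⊆ t (a∈underlying (exchange 1F t)) (c∈underlying (exchange 1F t)) (b∈underlying (exchange 1F t)))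

  underlying-related : ∀ {t u} → EqClosure Reordered t u → underlying t ≡ underlying u
  underlying-related = EqC.gfold {S = _≡_} isEquivalence underlying
    λ { (i , _ , refl) → sym (underlying-exchange i _) }

  related-underlying : ∀ t u → underlying t ≡ underlying u → EqClosure Reordered t u
  related-underlying t@(tri a b c p q r) u@(tri a′ b′ c′ p′ q′ r′) e =
    match (∈-underlying⁻ t (subst (a′ ∈_) (sym e) (a∈underlying u)))
          (∈-underlying⁻ t (subst (b′ ∈_) (sym e) (b∈underlying u)))
          (∈-underlying⁻ t (subst (c′ ∈_) (sym e) (c∈underlying u)))
    where
    Among : Fin n → Set
    Among x = x ≡ a ⊎ x ≡ b ⊎ x ≡ c
    match : Among a′ → Among b′ → Among c′ → EqClosure Reordered t u
    match (inj₁ refl) (inj₂ (inj₁ refl)) (inj₂ (inj₂ refl)) = reorder-related 0F t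
    match (inj₁ refl) (inj₂ (inj₂ refl)) (inj₂ (inj₁ refl)) = reorder-related 2F t
    match (inj₂ (inj₁ refl)) (inj₁ refl) (inj₂ (inj₂ refl)) = reorder-related 1F t
    match (inj₂ (inj₁ refl)) (inj₂ (inj₂ refl)) (inj₁ refl) = reorder-related 4F t
    match (inj₂ (inj₂ refl)) (inj₁ refl) (inj₂ (inj₁ refl)) = reorder-related 3F t
    match (inj₂ (inj₂ refl)) (inj₂ (inj₁ refl)) (inj₁ refl) = reorder-related 5F t
    match (inj₁ refl) (inj₁ refl) _ = contradiction refl (relevant p′)
    match (inj₁ refl) _ (inj₁ refl) = contradiction refl (relevant q′)
    match _ (inj₁ refl) (inj₁ refl) = contradiction refl (relevant r′)
    match (inj₂ (inj₁ refl)) (inj₂ (inj₁ refl)) _ = contradiction refl (relevant p′)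
    match (inj₂ (inj₁ refl)) _ (inj₂ (inj₁ refl)) = contradiction refl (relevant q′)
    match _ (inj₂ (inj₁ refl)) (inj₂ (inj₁ refl)) = contradiction refl (relevant r′)
    match (inj₂ (inj₂ refl)) (inj₂ (inj₂ refl)) _ = contradiction refl (relevant p′)
    match (inj₂ (inj₂ refl)) _ (inj₂ (inj₂ refl)) = contradiction refl (relevant q′)
    match _ (inj₂ (inj₂ refl)) (inj₂ (inj₂ refl)) = contradiction refl (relevant r′)

∣⁅x⁆∪p∣ : ∀ {n} (x : Fin n) p → x ∉ p → ∣ ⁅ x ⁆ ∪ p ∣ ≡ suc ∣ p ∣
∣⁅x⁆∪p∣ zero (inside ∷ p) x∉p = contradiction here x∉p
∣⁅x⁆∪p∣ zero (outside ∷ p) x∉p = cong (suc ∘ ∣_∣) (Subset.∪-identityˡ p)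
∣⁅x⁆∪p∣ (suc x) (inside ∷ p) x∉p = cong suc (∣⁅x⁆∪p∣ x p (x∉p ∘ there))
∣⁅x⁆∪p∣ (suc x) (outside ∷ p) x∉p = ∣⁅x⁆∪p∣ x p (x∉p ∘ there)

∣underlying∣ : ∀ {n} (t : Triple n) → ∣ underlying t ∣ ≡ 3
∣underlying∣ (tri a b c p q r) =
  trans (∣⁅x⁆∪p∣ a _ (λ a∈ → [ relevant p ∘ Subset.x∈⁅y⁆⇒x≡y b , relevant q ∘ Subset.x∈⁅y⁆⇒x≡y c ]′ (Subset.x∈p∪q⁻ ⁅ b ⁆ _ a∈)))
        (cong suc (trans (∣⁅x⁆∪p∣ b _ (relevant r ∘ Subset.x∈⁅y⁆⇒x≡y c)) (cong suc (Subset.∣⁅x⁆∣≡1 c))))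

remove-element : ∀ {n k} (e : Subset n) → ∣ e ∣ ≡ suc k →
                 ∃₂ λ x (e′ : Subset n) → ∣ e′ ∣ ≡ k × x ∈ e × e′ ⊆ e × x ∉ e′ × (∀ {y} → y ∈ e → y ≡ x ⊎ y ∈ e′)
remove-element (inside ∷ e) eq = zero , outside ∷ e , ℕ.suc-injective eq , here , (λ { (there y∈) → there y∈ }) , (λ ()) ,
  λ { here → inj₁ refl ; (there y∈) → inj₂ (there y∈) }
remove-element (outside ∷ e) eq with remove-element e eq
... | x , e′ , eq′ , x∈ , sub , x∉ , split = suc x , outside ∷ e′ , eq′ , there x∈ , (λ { (there y∈) → there (sub y∈) }) ,
  (λ { (there x∈e′) → x∉ x∈e′ }) , λ { (there y∈) → [ inj₁ ∘ cong suc , inj₂ ∘ there ]′ (split y∈) }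

elements : ∀ {n} (e : Subset n) → ∣ e ∣ ≡ 3 → ∃ λ t → underlying t ≡ e
elements e eq with remove-element e eq
... | a , e₁ , eq₁ , a∈ , sub₁ , a∉ , split₁ with remove-element e₁ eq₁
... | b , e₂ , eq₂ , b∈ , sub₂ , b∉ , split₂ with remove-element e₂ eq₂
... | c , e₃ , eq₃ , c∈ , sub₃ , c∉ , split₃ =
  t , Subset.⊆-antisym (underlying-⊆ t a∈ (sub₁ b∈) (sub₁ (sub₂ c∈))) all
  where
  t : Triple _
  t = tri a b c (λ { refl → a∉ b∈ }) (λ { refl → a∉ (sub₂ c∈) }) (λ { refl → b∉ c∈ })
  empty : ∀ {m} {p : Subset m} {y} → ∣ p ∣ ≡ 0 → y ∉ p
  empty {p = inside ∷ p} ()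
  empty {p = outside ∷ p} eq (there y∈) = empty eq y∈
  all : e ⊆ underlying t
  all y∈ with split₁ y∈
  ... | inj₁ refl = a∈underlying t
  ... | inj₂ y∈₁ with split₂ y∈₁
  ...   | inj₁ refl = b∈underlying t
  ...   | inj₂ y∈₂ with split₃ y∈₂
  ...     | inj₁ refl = c∈underlying t
  ...     | inj₂ y∈₃ = contradiction y∈₃ (empty eq₃)

-- Euler's inequality for the Levi graph of the complete 3-uniform hypergraph

module _ {n : ℕ} where

  K : Hypergraph n
  K = completeUniform 3 n

  toEdge : Triple n → Edge K
  toEdge t = underlying t , subst (λ k → T (k ≡ᵇ 3)) (sym (∣underlying∣ t)) tt

  fromEdge : (e : Edge K) → ∃ λ t → underlying t ≡ proj₁ e
  fromEdge (e , p) = elements e (ℕ.≡ᵇ⇒≡ _ 3 p)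

  corner : Triple n → Fin 3 → Fin n
  corner t 0F = Triple.a t
  corner t 1F = Triple.b t
  corner t 2F = Triple.c t

  corner-∈ : ∀ t k → corner t k ∈ underlying t
  corner-∈ t 0F = a∈underlying t
  corner-∈ t 1F = b∈underlying t
  corner-∈ t 2F = c∈underlying t

  corner-injective : ∀ t k l → corner t k ≡ corner t l → k ≡ l
  corner-injective _ 0F 0F _ = refl
  corner-injective _ 1F 1F _ = refl
  corner-injective _ 2F 2F _ = refl
  corner-injective (tri a b c p q r) 0F 1F e = contradiction e (relevant p)
  corner-injective (tri a b c p q r) 0F 2F e = contradiction e (relevant q)
  corner-injective (tri a b c p q r) 1F 2F e = contradiction e (relevant r)
  corner-injective (tri a b c p q r) 1F 0F e = contradiction (sym e) (relevant p)
  corner-injective (tri a b c p q r) 2F 0F e = contradiction (sym e) (relevant q)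
  corner-injective (tri a b c p q r) 2F 1F e = contradiction (sym e) (relevant r)

  -- `euler-bound` with p = n + t and q = t * 3: an edge of the Levi graph is indexed by a class of
  -- ordered triples and a corner of its representative.
  levi-bound : ∀ {t} → Classes (Reordered {n}) t → 1 ≤ t → (M : CellSurface) → Levi K ↪ M →
               let open CellSurface M in 2 * (#cells 0F + #cells 2F) + t * 3 ≤ 2 * (#cells 1F + (n + t))
  levi-bound {t} C 1≤t M emb = Euler.euler-bound M g s P Q source target bipartite simple i₀ i₁ i₀≢i₁
    where
    open CellSurface M
    open _↪_ emb
    module C = Inverse C
    vertexOf : Fin n ⊎ Fin t → Fin (#cells 0F)
    vertexOf (inj₁ v) = vertex (inj₁ v)
    vertexOf (inj₂ j) = vertex (inj₂ (toEdge (C.from j)))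
    g : Fin (n + t) → Fin (#cells 0F)
    g = vertexOf ∘ splitAt n
    side : Fin (t * 3) → Fin t × Fin 3
    side = remQuot {t} 3
    tripleAt : Fin (t * 3) → Triple n
    tripleAt i = C.from (proj₁ (side i))
    pointAt : Fin (t * 3) → Fin n
    pointAt i = corner (tripleAt i) (proj₂ (side i))
    at : ∀ i → ∃ λ x → cell 0F x ≡ vertex (inj₁ (pointAt i)) × cell 0F (τ 0F x) ≡ vertex (inj₂ (toEdge (tripleAt i)))
    at i = edge {inj₁ (pointAt i)} {inj₂ (toEdge (tripleAt i))} (corner-∈ (tripleAt i) (proj₂ (side i)))
    s : Fin (t * 3) → Flag
    s i = proj₁ (at i)
    P Q : Fin (t * 3) → Fin (n + t)
    P i = pointAt i ↑ˡ t
    Q i = n ↑ʳ proj₁ (side i)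
    gP : ∀ i → g (P i) ≡ vertex (inj₁ (pointAt i))
    gP i = cong vertexOf (Fin.splitAt-↑ˡ n (pointAt i) t)
    gQ : ∀ i → g (Q i) ≡ vertex (inj₂ (toEdge (tripleAt i)))
    gQ i = cong vertexOf (Fin.splitAt-↑ʳ n t (proj₁ (side i)))
    source : ∀ i → cell 0F (s i) ≡ g (P i)
    source i = trans (proj₁ (proj₂ (at i))) (sym (gP i))
    target : ∀ i → cell 0F (τ 0F (s i)) ≡ g (Q i)
    target i = trans (proj₂ (proj₂ (at i))) (sym (gQ i))
    bipartite : ∀ i j → g (P i) ≢ g (Q j)
    bipartite i j e with injective (trans (sym (gP i)) (trans e (gQ j)))
    ... | ()
    simple : ∀ i j → g (P i) ≡ g (P j) → g (Q i) ≡ g (Q j) → i ≡ j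
    simple i j eP eQ = trans (sym (Fin.combine-remQuot {t} 3 i)) (trans (cong (uncurry combine) (same (side i) (side j) index point)) (Fin.combine-remQuot {t} 3 j))
      where
      point : pointAt i ≡ pointAt j
      point = inj₁-injective (injective (trans (sym (gP i)) (trans eP (gP j))))
      index : proj₁ (side i) ≡ proj₁ (side j)
      index = trans (sym (C.strictlyInverseˡ _)) (trans (C.to-cong (related-underlying _ _
        (cong proj₁ (inj₂-injective (injective (trans (sym (gQ i)) (trans eQ (gQ j)))))))) (C.strictlyInverseˡ _))
      same : ∀ x y → proj₁ x ≡ proj₁ y → corner (C.from (proj₁ x)) (proj₂ x) ≡ corner (C.from (proj₁ y)) (proj₂ y) → x ≡ y
      same (j , k) (j , l) refl e = cong (j ,_) (corner-injective (C.from j) k l e)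
    j₀ : Fin t
    j₀ = fromℕ< 1≤t
    i₀ i₁ : Fin (t * 3)
    i₀ = combine j₀ 0F
    i₁ = combine j₀ 1F
    i₀≢i₁ : i₀ ≢ i₁
    i₀≢i₁ e with Fin.combine-injectiveʳ j₀ 0F j₀ 1F e
    ... | ()

-- From matchings of the triples at each pair of points to a surface

record Distinct {n : ℕ} (v w x : Fin n) : Set where
  constructor distinct
  field
    v≢w : v ≢ w
    v≢x : v ≢ x
    w≢x : w ≢ x

-- Going round the point `v`: `swap` crosses the edge from `v` to the triple vwx, from the face at v
-- and w to the face at v and x, and `turn` crosses the corner at `v` of the face at v and w.
data Move {n : ℕ} (m : Fin n → Fin n → Fin n → Fin n) (v : Fin n) : Fin n × Fin n → Fin n × Fin n → Set where
  swap : ∀ {w x} → Distinct v w x → Move m v (w , x) (x , w)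
  turn : ∀ {w x} → Distinct v w x → Move m v (w , x) (w , m v w x)

-- For each pair {v, w} the map m v w matches the triples v w x in pairs; these pairs are the
-- quadrilateral faces at v and w.  All triples at v have to be joined by faces at v into one cycle.
record Design (n : ℕ) : Set where
  field
    m     : Fin n → Fin n → Fin n → Fin n
    m-sym : ∀ {v w x} → Distinct v w x → m w v x ≡ m v w x
    fresh : ∀ {v w x} → Distinct v w x → Distinct v w (m v w x)
    moves : ∀ {v w x} → Distinct v w x → m v w x ≢ x
    m-inv : ∀ {v w x} → Distinct v w x → m v w (m v w x) ≡ x
    joined : ∀ {v w x y z} → Distinct v w x → Distinct v y z → EqClosure (Move m v) (w , x) (y , z)

  turnTriple : Triple n → Triple n
  turnTriple (tri v w x p q r) = tri v w (m v w x) p (Distinct.v≢x d) (Distinct.w≢x d)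
    where
    d : Distinct v w (m v w x)
    d = fresh (distinct (relevant p) (relevant q) (relevant r))

  Orientation : Set
  Orientation = Σ (Triple n → Bool) λ s →
    (∀ i t → s (exchange i t) ≡ not (s t)) × (∀ t → s (turnTriple t) ≡ not (s t))

module _ {n : ℕ} where

  triple : ∀ {v w x : Fin n} → Distinct v w x → Triple n
  triple d = tri _ _ _ (Distinct.v≢w d) (Distinct.v≢x d) (Distinct.w≢x d)

  distinctTriple : (t : Triple n) → Distinct (Triple.a t) (Triple.b t) (Triple.c t)
  distinctTriple (tri a b c p q r) = distinct (relevant p) (relevant q) (relevant r)

module Surface {k : ℕ} (D : Design (3 + k)) {t : ℕ} (C : Classes (Reordered {3 + k}) t) where

  open Design D

  private
    n : ℕ
    n = 3 + k
    module C = Inverse C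

  -- The flag (v w x , b) lies at the edge joining v to the triple vwx, at its end v if b is
  -- false and at its end vwx if b is true, on the side of the face at v and w.
  Flag : Set
  Flag = Triple n × Bool

  -- Within the face at v and w, the other edge at the corner `v` leads to the matched triple, and
  -- the other edge at the corner vwx leads to `w`.
  τ : Fin 3 → Flag → Flag
  τ 0F (t , b)     = t , not b
  τ 1F (t , false) = turnTriple t , false
  τ 1F (t , true)  = exchange 0F t , true
  τ 2F (t , b)     = exchange 1F t , b

  tri-cong₃ : ∀ {v w x y : Fin n} .{p q r q′ r′} → x ≡ y → tri v w x p q r ≡ tri v w y p q′ r′
  tri-cong₃ refl = refl

  turn-involutive : ∀ t → turnTriple (turnTriple t) ≡ t
  turn-involutive (tri v w x p q r) = tri-cong₃ (m-inv (distinct (relevant p) (relevant q) (relevant r)))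

  turn-≢ : ∀ t → turnTriple t ≢ t
  turn-≢ t@(tri v w x p q r) e = moves (distinct (relevant p) (relevant q) (relevant r)) (cong Triple.c e)

  exchange-≢ : ∀ i (t : Triple n) → exchange i t ≢ t
  exchange-≢ 0F (tri v w x p q r) e = relevant p (sym (cong Triple.a e))
  exchange-≢ 1F (tri v w x p q r) e = relevant r (sym (cong Triple.b e))

  τ-involutive : ∀ i x → τ i (τ i x) ≡ x
  τ-involutive 0F (t , b) = cong (t ,_) (Bool.not-involutive b)
  τ-involutive 1F (t , false) = cong (_, false) (turn-involutive t)
  τ-involutive 1F (t , true) = refl
  τ-involutive 2F (t , b) = refl

  τ-no-fixed : ∀ i x → τ i x ≢ x
  τ-no-fixed 0F (t , b) e = Bool.not-¬ refl (sym (cong proj₂ e))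
  τ-no-fixed 1F (t , false) e = turn-≢ t (cong proj₁ e)
  τ-no-fixed 1F (t , true) e = exchange-≢ 0F t (cong proj₁ e)
  τ-no-fixed 2F (t , b) e = exchange-≢ 1F t (cong proj₁ e)

  finite : Flag ↔ Fin ((3 + k) * ((2 + k) * (1 + k)) * 2)
  finite = Inv.↔-trans (Triple↔ ×-↔ Inv.↔-sym Fin.2↔Bool) (Inv.↔-sym Fin.*↔×)

  Around : Fin 3 → Rel Flag _
  Around j = Step τ (_≢ j)

  step : ∀ {P : Fin 3 → Set} i → P i → ∀ x → EqClosure (Step τ P) x (τ i x)
  step i p x = fwd (i , p , refl) ◅ ε

  at-point : ∀ {v w x y z} (d : Distinct v w x) (d′ : Distinct v y z) →
             EqClosure (Around 0F) (triple d , false) (triple d′ , false)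
  at-point {v} d d′ = lift d d′ (joined d d′)
    where
    lift-step : ∀ {w x y z} (d : Distinct v w x) (d′ : Distinct v y z) → Move m v (w , x) (y , z) →
                EqClosure (Around 0F) (triple d , false) (triple d′ , false)
    lift-step d d′ (swap _) = step 2F (λ ()) _
    lift-step d d′ (turn _) = step 1F (λ ()) _
    ends : ∀ {w x y z} → Move m v (w , x) (y , z) → Distinct v w x × Distinct v y z
    ends (swap d) = d , distinct (Distinct.v≢x d) (Distinct.v≢w d) (Distinct.w≢x d ∘ sym)
    ends (turn d) = d , fresh d
    lift : ∀ {w x y z} (d : Distinct v w x) (d′ : Distinct v y z) → EqClosure (Move m v) (w , x) (y , z) →
           EqClosure (Around 0F) (triple d , false) (triple d′ , false)
    lift d d′ ε = ε
    lift d d′ (fwd r ◅ rs) = lift-step d (proj₂ (ends r)) r ◅◅ lift (proj₂ (ends r)) d′ rs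
    lift d d′ (bwd r ◅ rs) = EqC.symmetric _ (lift-step (proj₁ (ends r)) d r) ◅◅ lift (proj₁ (ends r)) d′ rs

  Any : Fin 3 → Set
  Any _ = ⊤

  -- All flags at one point are connected by `joined`, and a triple leads from one of its points to
  -- another.
  τ-connected : ∀ x y → EqClosure (Step τ Any) x y
  τ-connected (t , b) (u , b′) = to-point b t ◅◅ between t u ◅◅ EqC.symmetric _ (to-point b′ u)
    where
    to-point : ∀ b t → EqClosure (Step τ Any) (t , b) (t , false)
    to-point false t = ε
    to-point true t = step 0F tt _
    same : ∀ {v w x y z} (d : Distinct v w x) (d′ : Distinct v y z) → EqClosure (Step τ Any) (triple d , false) (triple d′ , false)
    same d d′ = EqC.map (λ { (i , _ , e) → i , tt , e }) (at-point d d′)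
    flip : ∀ {v w x} (d : Distinct v w x) (d′ : Distinct w v x) → EqClosure (Step τ Any) (triple d , false) (triple d′ , false)
    flip d d′ = step 0F tt _ ◅◅ step 1F tt _ ◅◅ step 0F tt _
    between : ∀ t u → EqClosure (Step τ Any) (t , false) (u , false)
    between t u = go (distinctTriple t) (distinctTriple u)
      where
      go : ∀ {v w x v′ w′ x′} (d : Distinct v w x) (d′ : Distinct v′ w′ x′) → EqClosure (Step τ Any) (triple d , false) (triple d′ , false)
      go {v} {w} {x} {v′} d d′ with v Fin.≟ v′ | w Fin.≟ v′
      ... | yes refl | _ = same d d′
      ... | no _ | yes refl = flip d d″ ◅◅ same d″ d′
        where
        d″ : Distinct w v x
        d″ = distinct (Distinct.v≢w d ∘ sym) (Distinct.w≢x d) (Distinct.v≢x d)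
      ... | no v≢v′ | no w≢v′ = same d d₁ ◅◅ flip d₁ d₂ ◅◅ same d₂ d′
        where
        d₁ : Distinct v v′ w
        d₁ = distinct v≢v′ (Distinct.v≢w d) (w≢v′ ∘ sym)
        d₂ : Distinct v′ v w
        d₂ = distinct (v≢v′ ∘ sym) (w≢v′ ∘ sym) (Distinct.v≢w d)

  tripleAt : ∀ v → ∃₂ λ w x → Distinct {n} v w x
  tripleAt v = punchIn v 0F , punchIn v 1F , distinct (Fin.punchInᵢ≢i v 0F ∘ sym) (Fin.punchInᵢ≢i v 1F ∘ sym)
    (λ e → case Fin.punchIn-injective v 0F 1F e of λ ())

  -- The requirement `joined` is what makes the flags at a point a single 0-cell; those at a triple
  -- form one because the two exchanges generate all its orderings.
  vertices : Classes (Around 0F) (n + t)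
  vertices = record
    { to = to
    ; from = from
    ; to-cong = EqC.gfold {S = _≡_} isEquivalence to λ { (i , i≢0 , refl) → to-τ i i≢0 _ }
    ; from-cong = λ { refl → ε }
    ; inverse = (λ {i} x~ → trans (EqC.gfold {S = _≡_} isEquivalence to (λ { (i , i≢0 , refl) → to-τ i i≢0 _ }) x~) (to-from i)) ,
                λ { {x} refl → from-to x }
    }
    where
    to : Flag → Fin (n + t)
    to (u , false) = Triple.a u ↑ˡ t
    to (u , true)  = n ↑ʳ C.to u
    from′ : Fin n ⊎ Fin t → Flag
    from′ (inj₁ v) = triple (proj₂ (proj₂ (tripleAt v))) , false
    from′ (inj₂ j) = C.from j , true
    from : Fin (n + t) → Flag
    from = from′ ∘ splitAt n
    to-τ : ∀ i → i ≢ 0F → ∀ x → to x ≡ to (τ i x)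
    to-τ 0F i≢0 _ = contradiction refl i≢0
    to-τ 1F _ (u , false) = refl
    to-τ 1F _ (u , true) = cong (n ↑ʳ_) (C.to-cong (fwd (0F , tt , refl) ◅ ε))
    to-τ 2F _ (u , false) = refl
    to-τ 2F _ (u , true) = cong (n ↑ʳ_) (C.to-cong (fwd (1F , tt , refl) ◅ ε))
    to-from : ∀ i → to (from i) ≡ i
    to-from i = trans (go (splitAt n i)) (Fin.join-splitAt n t i)
      where
      go : ∀ s → to (from′ s) ≡ join n t s
      go (inj₁ v) = refl
      go (inj₂ j) = cong (n ↑ʳ_) (C.strictlyInverseˡ j)
    at-triple : ∀ {u u′} → EqClosure Reordered u u′ → EqClosure (Around 0F) (u , true) (u′ , true)
    at-triple = EqC.gmap (_, true) λ { (0F , _ , refl) → 1F , (λ ()) , refl ; (1F , _ , refl) → 2F , (λ ()) , refl }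
    from-to : ∀ x → EqClosure (Around 0F) (from (to x)) x
    from-to (u , false) = subst (λ s → EqClosure (Around 0F) (from′ s) (u , false)) (sym (Fin.splitAt-↑ˡ n (Triple.a u) t))
      (at-point (proj₂ (proj₂ (tripleAt (Triple.a u)))) (distinctTriple u))
    from-to (u , true) = subst (λ s → EqClosure (Around 0F) (from′ s) (u , true)) (sym (Fin.splitAt-↑ʳ n t (C.to u)))
      (at-triple (C.strictlyInverseʳ u))

  edges : ∃ (Classes (Around 1F))
  edges = stepClasses finite τ (_≢ 1F) (λ i → ¬? (i Fin.≟ 1F))

  faces : ∃ (Classes (Around 2F))
  faces = stepClasses finite τ (_≢ 2F) (λ i → ¬? (i Fin.≟ 2F))

  surface : CellSurface
  surface = record
    { Flag = Flag
    ; finite = _ , finite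
    ; base = triple (proj₂ (proj₂ (tripleAt 0F))) , false
    ; τ = τ
    ; involutive = τ-involutive
    ; no-fixed = τ-no-fixed
    ; commute = λ _ → refl
    ; disagree = λ x e → Bool.not-¬ refl (sym (cong proj₂ e))
    ; connected = τ-connected
    ; #cells = λ { 0F → n + t ; 1F → proj₁ edges ; 2F → proj₁ faces }
    ; cells = λ { 0F → vertices ; 1F → proj₂ edges ; 2F → proj₂ faces }
    }

  open CellSurface surface using (#cells; cell)

  triples-total : (3 + k) * ((2 + k) * (1 + k)) ≡ t * 6
  triples-total = triple-count Triple↔ C

  edge-count : #cells 1F ≡ t * 3
  edge-count = ℕ.*-cancelʳ-≡ _ _ 4 (trans (sym (↔⇒≡ (Inv.↔-trans (Inv.↔-sym finite)
    (Inv.↔-trans (Inv.↔-sym (edge-orbits surface)) (Inv.↔-sym Fin.*↔×)))))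
    (trans (cong (_* 2) triples-total) (lemma t)))
    where
    lemma : ∀ t → t * 6 * 2 ≡ t * 3 * 4
    lemma = solve-∀

  -- The eight flags of a quadrilateral: the first bit changes the end of the edge, the second
  -- exchanges v and w, and the third passes to the matched triple.
  aroundFace : Bool × Bool × Bool → Flag → Flag
  aroundFace (β , false , false) (u , b) = u , b xor β
  aroundFace (β , true  , false) (u , b) = exchange 0F u , b xor β
  aroundFace (β , false , true)  (u , b) = turnTriple u , b xor β
  aroundFace (β , true  , true)  (u , b) = exchange 0F (turnTriple u) , b xor β

  exchange-turn : ∀ u → turnTriple (exchange 0F u) ≡ exchange 0F (turnTriple u)
  exchange-turn (tri v w x p q r) = tri-cong₃ (m-sym (distinct (relevant p) (relevant q) (relevant r)))

  face-orbits : proj₁ faces * 8 ≡ t * 6 * 2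
  face-orbits = trans (sym (orbit-count (proj₂ faces) aroundFace related free ((false , false , false) , unit) closed finite
      (Inv.↔-trans (Inv.↔-sym Fin.2↔Bool ×-↔ Inv.↔-trans (Inv.↔-sym Fin.2↔Bool ×-↔ Inv.↔-sym Fin.2↔Bool) (Inv.↔-sym Fin.*↔×)) (Inv.↔-sym Fin.*↔×))))
    (cong (_* 2) triples-total)
    where
    unit : ∀ x → aroundFace (false , false , false) x ≡ x
    unit (u , b) = cong (u ,_) (Bool.xor-identityʳ b)
    toggle : ∀ u b b′ → EqClosure (Around 2F) (u , b) (u , b′)
    toggle u false false = ε
    toggle u true true = ε
    toggle u false true = step 0F (λ ()) _
    toggle u true false = step 0F (λ ()) _
    across : ∀ u b b′ → EqClosure (Around 2F) (u , b) (exchange 0F u , b′)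
    across u b b′ = toggle u b true ◅◅ step 1F (λ ()) _ ◅◅ toggle _ true b′
    along : ∀ u b b′ → EqClosure (Around 2F) (u , b) (turnTriple u , b′)
    along u b b′ = toggle u b false ◅◅ step 1F (λ ()) _ ◅◅ toggle _ false b′
    related : ∀ i x → EqClosure (Around 2F) x (aroundFace i x)
    related (β , false , false) (u , b) = toggle u b _
    related (β , true  , false) (u , b) = across u b _
    related (β , false , true)  (u , b) = along u b _
    related (β , true  , true)  (u , b) = along u b b ◅◅ across _ b _
    xor-injective : ∀ b {β β′} → b xor β ≡ b xor β′ → β ≡ β′
    xor-injective false e = e
    xor-injective true e = Bool.not-injective e
    freeTriple : ∀ u b {β σ μ β′ σ′ μ′} → proj₁ (aroundFace (β , σ , μ) (u , b)) ≡ proj₁ (aroundFace (β′ , σ′ , μ′) (u , b)) → (σ , μ) ≡ (σ′ , μ′)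
    freeTriple u b {σ = false} {false} {σ′ = false} {false} e = refl
    freeTriple u b {σ = true} {false} {σ′ = true} {false} e = refl
    freeTriple u b {σ = false} {true} {σ′ = false} {true} e = refl
    freeTriple u b {σ = true} {true} {σ′ = true} {true} e = refl
    freeTriple u b {σ = false} {false} {σ′ = true} {false} e = contradiction (sym e) (exchange-≢ 0F u)
    freeTriple u b {σ = false} {false} {σ′ = false} {true} e = contradiction (sym e) (turn-≢ u)
    freeTriple u b {σ = false} {false} {σ′ = true} {true} e = contradiction (cong Triple.a e) (Distinct.v≢w (distinctTriple u))
    freeTriple u b {σ = true} {false} {σ′ = false} {false} e = contradiction e (exchange-≢ 0F u)
    freeTriple u b {σ = true} {false} {σ′ = false} {true} e = contradiction (sym (cong Triple.a e)) (Distinct.v≢w (distinctTriple u))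
    freeTriple u b {σ = true} {false} {σ′ = true} {true} e = contradiction (sym (cong (exchange 0F) e)) (turn-≢ u)
    freeTriple u b {σ = false} {true} {σ′ = false} {false} e = contradiction e (turn-≢ u)
    freeTriple u b {σ = false} {true} {σ′ = true} {false} e = contradiction (cong Triple.a e) (Distinct.v≢w (distinctTriple u))
    freeTriple u b {σ = false} {true} {σ′ = true} {true} e = contradiction (sym e) (exchange-≢ 0F (turnTriple u))
    freeTriple u b {σ = true} {true} {σ′ = false} {false} e = contradiction (sym (cong Triple.a e)) (Distinct.v≢w (distinctTriple u))
    freeTriple u b {σ = true} {true} {σ′ = true} {false} e = contradiction (cong (exchange 0F) e) (turn-≢ u)
    freeTriple u b {σ = true} {true} {σ′ = false} {true} e = contradiction e (exchange-≢ 0F (turnTriple u))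
    bit : ∀ u b β σ μ → proj₂ (aroundFace (β , σ , μ) (u , b)) ≡ b xor β
    bit u b β false false = refl
    bit u b β true false = refl
    bit u b β false true = refl
    bit u b β true true = refl
    free : ∀ x {i j} → aroundFace i x ≡ aroundFace j x → i ≡ j
    free (u , b) {β , σ , μ} {β′ , σ′ , μ′} e = cong₂ _,_
      (xor-injective b (trans (sym (bit u b β σ μ)) (trans (cong proj₂ e) (bit u b β′ σ′ μ′))))
      (freeTriple u b {β} {σ} {μ} {β′} {σ′} {μ′} (cong proj₁ e))
    move : ∀ i → i ≢ 2F → ∀ x j → ∃ λ l → aroundFace l x ≡ τ i (aroundFace j x)
    move 2F i≢2 _ _ = contradiction refl i≢2
    move 0F _ (u , b) (β , false , false) = (not β , false , false) , cong (_ ,_) (sym (Bool.not-distribʳ-xor b β))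
    move 0F _ (u , b) (β , true , false) = (not β , true , false) , cong (_ ,_) (sym (Bool.not-distribʳ-xor b β))
    move 0F _ (u , b) (β , false , true) = (not β , false , true) , cong (_ ,_) (sym (Bool.not-distribʳ-xor b β))
    move 0F _ (u , b) (β , true , true) = (not β , true , true) , cong (_ ,_) (sym (Bool.not-distribʳ-xor b β))
    move 1F _ (u , b) (β , false , false) with b xor β in eq
    ... | false = (β , false , true) , cong (_ ,_) eq
    ... | true = (β , true , false) , cong (_ ,_) eq
    move 1F _ (u , b) (β , true , false) with b xor β in eq
    ... | false = (β , true , true) , cong₂ _,_ (sym (exchange-turn u)) eq
    ... | true = (β , false , false) , cong (_ ,_) eq
    move 1F _ (u , b) (β , false , true) with b xor β in eq
    ... | false = (β , false , false) , cong₂ _,_ (sym (turn-involutive u)) eq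
    ... | true = (β , true , true) , cong (_ ,_) eq
    move 1F _ (u , b) (β , true , true) with b xor β in eq
    ... | false = (β , true , false) , cong₂ _,_ (sym (trans (exchange-turn (turnTriple u)) (cong (exchange 0F) (turn-involutive u)))) eq
    ... | true = (β , false , true) , cong (_ ,_) eq
    closed : ∀ x j {y} → SymClosure (Around 2F) (aroundFace j x) y → ∃ λ l → aroundFace l x ≡ y
    closed x j (fwd (i , i≢2 , refl)) = move i i≢2 x j
    closed x j {y} (bwd (i , i≢2 , e)) =
      let l , eq = move i i≢2 x j in l , trans eq (trans (cong (τ i) (sym e)) (τ-involutive i y))

  face-count : 2 * #cells 2F ≡ t * 3
  face-count = ℕ.*-cancelʳ-≡ _ _ 4 (trans (lemma₁ (proj₁ faces)) (trans face-orbits (lemma₂ t)))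
    where
    lemma₁ : ∀ f → 2 * f * 4 ≡ f * 8
    lemma₁ = solve-∀
    lemma₂ : ∀ t → t * 6 * 2 ≡ t * 3 * 4
    lemma₂ = solve-∀

  orientable : Orientation → CellSurface.Orientable surface
  orientable (s , s-exchange , s-turn) = (λ { (u , b) → s u xor b }) , λ
    { 0F (u , b) → sym (Bool.not-distribʳ-xor (s u) b)
    ; 1F (u , false) → trans (cong (_xor false) (s-turn u)) (sym (Bool.not-distribˡ-xor (s u) false))
    ; 1F (u , true) → trans (cong (_xor true) (s-exchange 0F u)) (sym (Bool.not-distribˡ-xor (s u) true))
    ; 2F (u , b) → trans (cong (_xor b) (s-exchange 1F u)) (sym (Bool.not-distribˡ-xor (s u) b)) }

  -- Exchanging v and w is one adjacency at the end vwx. For the flags at the points it takes three,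
  -- still an odd number.
  orientation : CellSurface.Orientable surface → Orientation
  orientation (colour , flips) = (λ u → colour (u , false)) ,
    (λ { 0F u → Bool.not-injective (trans (sym (flips 0F _)) (trans (flips 1F (u , true)) (cong not (flips 0F (u , false)))))
       ; 1F u → flips 2F (u , false) }) ,
    λ u → flips 1F (u , false)

  embedding : Levi (completeUniform 3 n) ↪ surface
  embedding = record { vertex = vertex ; injective = vertex-injective ; edge = λ {x} {y} → edge x y }
    where
    vertex : Fin n ⊎ Edge K → Fin (n + t)
    vertex (inj₁ v) = v ↑ˡ t
    vertex (inj₂ e) = n ↑ʳ C.to (proj₁ (fromEdge e))
    ↑ˡ≢↑ʳ : ∀ v j → v ↑ˡ t ≢ n ↑ʳ j
    ↑ˡ≢↑ʳ v j e with trans (sym (Fin.splitAt-↑ˡ n v t)) (trans (cong (splitAt n) e) (Fin.splitAt-↑ʳ n t j))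
    ... | ()
    edge-≡ : ∀ {e e′ : Edge (K {n})} → proj₁ e ≡ proj₁ e′ → e ≡ e′
    edge-≡ {e , p} {.e , p′} refl = cong (e ,_) (Bool.T-irrelevant p p′)
    vertex-injective : ∀ {x y} → vertex x ≡ vertex y → x ≡ y
    vertex-injective {inj₁ v} {inj₁ w} e = cong inj₁ (Fin.↑ˡ-injective t v w e)
    vertex-injective {inj₁ v} {inj₂ _} e = contradiction e (↑ˡ≢↑ʳ v _)
    vertex-injective {inj₂ _} {inj₁ v} e = contradiction (sym e) (↑ˡ≢↑ʳ v _)
    vertex-injective {inj₂ d} {inj₂ d′} e = cong inj₂ (edge-≡ (trans (sym (proj₂ (fromEdge d)))
      (trans (underlying-related related) (proj₂ (fromEdge d′)))))
      where
      related : EqClosure Reordered (proj₁ (fromEdge d)) (proj₁ (fromEdge d′))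
      related = EqC.symmetric _ (C.strictlyInverseʳ _) ◅◅
        subst (λ j → EqClosure Reordered (C.from j) (proj₁ (fromEdge d′))) (sym (Fin.↑ʳ-injective n _ _ e)) (C.strictlyInverseʳ _)
    first : ∀ {v} u → v ∈ underlying u → ∃ λ u′ → Triple.a u′ ≡ v × EqClosure Reordered u′ u
    first u v∈ with ∈-underlying⁻ u v∈
    ... | inj₁ refl = u , refl , ε
    ... | inj₂ (inj₁ refl) = reorder 1F u , refl , EqC.symmetric _ (reorder-related 1F u)
    ... | inj₂ (inj₂ refl) = reorder 3F u , refl , EqC.symmetric _ (reorder-related 3F u)
    incidence : ∀ v (e : Edge (K {n})) → v ∈ proj₁ e →
                ∃ λ u → cell 0F (u , false) ≡ vertex (inj₁ v) × cell 0F (u , true) ≡ vertex (inj₂ e)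
    incidence v e v∈ =
      let u , a≡v , rel = first (proj₁ (fromEdge e)) (subst (v ∈_) (sym (proj₂ (fromEdge e))) v∈)
      in u , cong (_↑ˡ t) a≡v , cong (n ↑ʳ_) (C.to-cong rel)
    edge : ∀ x y → LeviAdj (K {n}) x y → ∃ λ f → cell 0F f ≡ vertex x × cell 0F (τ 0F f) ≡ vertex y
    edge (inj₁ v) (inj₂ e) v∈ = let u , p , q = incidence v e v∈ in (u , false) , p , q
    edge (inj₂ e) (inj₁ v) v∈ = let u , p , q = incidence v e v∈ in (u , true) , q , p

-- Adding two points to a design

-- Edges of a circuit with a distinguished end: `swap` changes the distinguished end, and `turn`
-- passes through it to the next edge.
data Turn {n : ℕ} (Q : Fin n → Fin n → Fin n) : Fin n × Fin n → Fin n × Fin n → Set where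
  swap : ∀ {v x} → v ≢ x → Turn Q (v , x) (x , v)
  turn : ∀ {v x} → v ≢ x → Turn Q (v , x) (v , Q v x)

extend-false : ∀ {n} → (Fin n → Bool) → Fin (suc n) → Bool
extend-false f zero    = false
extend-false f (suc x) = f x

-- An Euler circuit of the complete graph on Fin (suc n): it enters v along the edge from x and
-- leaves along the edge to Q v x.  At every nonzero point it changes between edges in W and edges not in W,
-- the edges at 0 being not in W.  Here suc v stands for the point v of W.
record Circuit (n : ℕ) : Set where
  field
    Q        : Fin (suc n) → Fin (suc n) → Fin (suc n)
    Q-fresh  : ∀ {v x} → v ≢ x → v ≢ Q v x
    Q-moves  : ∀ {v x} → v ≢ x → Q v x ≢ x
    Q-inv    : ∀ {v x} → v ≢ x → Q v (Q v x) ≡ x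
    Q-joined : ∀ {v x w y} → v ≢ x → w ≢ y → EqClosure (Turn Q) (v , x) (w , y)
    e        : Fin (suc n) → Fin (suc n) → Bool
    e-anti   : ∀ {v x} → v ≢ x → e x v ≡ not (e v x)
    e-Q      : ∀ {v x} → v ≢ x → e v (Q v x) ≡ not (e v x)
    W        : Fin n → Fin n → Bool
    W-sym    : ∀ v w → W w v ≡ W v w
    W-Q      : ∀ {v x} → suc v ≢ x → extend-false (W v) (Q (suc v) x) ≡ not (extend-false (W v) x)

module Extend {n : ℕ} (D : Design n) (E : Circuit n)
              (p : Fin n → Fin n → Fin n) (p-sym : ∀ v w → p w v ≡ p v w)
              (p-fresh : ∀ {v w} → v ≢ w → Distinct v w (p v w)) where

  open Design D
  open Circuit E

  W₀ : Fin n → Fin (suc n) → Bool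
  W₀ v = extend-false (W v)

  q : Fin n → Fin n → Fin n
  q v w = m v w (p v w)

  ι : Fin n → Fin (2 + n)
  ι x = suc (suc x)

  -- The point 0 of the circuit is whichever of the two new points is missing.
  skip₁ : Fin (suc n) → Fin (2 + n)
  skip₁ zero    = zero
  skip₁ (suc x) = ι x

  splice : ∀ (v w x : Fin n) → Dec (x ≡ p v w) → Dec (x ≡ q v w) → Fin (2 + n)
  splice v w x (yes _) _       = 0F
  splice v w x (no _)  (yes _) = 1F
  splice v w x (no _)  (no _)  = ι (m v w x)

  old : Bool → Fin n → Fin n → Fin (2 + n) → Fin (2 + n)
  old false v w zero          = 1F
  old false v w (suc zero)    = 0F
  old false v w (suc (suc x)) = ι (m v w x)
  old true  v w zero          = ι (p v w)
  old true  v w (suc zero)    = ι (q v w)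
  old true  v w (suc (suc x)) = splice v w x (x Fin.≟ p v w) (x Fin.≟ q v w)

  m′ : Fin (2 + n) → Fin (2 + n) → Fin (2 + n) → Fin (2 + n)
  m′ zero          (suc v)       (suc x)       = suc (Q v x)
  m′ (suc v)       zero          (suc x)       = suc (Q v x)
  m′ (suc zero)    (suc (suc v)) zero          = skip₁ (Q (suc v) zero)
  m′ (suc zero)    (suc (suc v)) (suc (suc x)) = skip₁ (Q (suc v) (suc x))
  m′ (suc (suc v)) (suc zero)    zero          = skip₁ (Q (suc v) zero)
  m′ (suc (suc v)) (suc zero)    (suc (suc x)) = skip₁ (Q (suc v) (suc x))
  m′ (suc (suc v)) (suc (suc w)) x             = old (W v w) v w x
  -- Only triples with a repeated point come here.
  m′ _             _             x             = x

  module _ {v w : Fin n} (v≢w : v ≢ w) where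

    p-distinct : Distinct v w (p v w)
    p-distinct = p-fresh v≢w

    m-q : m v w (q v w) ≡ p v w
    m-q = m-inv p-distinct

    q≢p : q v w ≢ p v w
    q≢p = moves p-distinct

    old-p : old true v w (ι (p v w)) ≡ 0F
    old-p with p v w Fin.≟ p v w
    ... | yes _ = refl
    ... | no ne = contradiction refl ne

    old-q : old true v w (ι (q v w)) ≡ 1F
    old-q with q v w Fin.≟ p v w | q v w Fin.≟ q v w
    ... | yes e | _ = contradiction e q≢p
    ... | no _ | yes _ = refl
    ... | no _ | no ne = contradiction refl ne

    old-other : ∀ {x} → x ≢ p v w → x ≢ q v w → old true v w (ι x) ≡ ι (m v w x)
    old-other {x} x≢p x≢q with x Fin.≟ p v w | x Fin.≟ q v w
    ... | yes e | _ = contradiction e x≢p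
    ... | no _ | yes e = contradiction e x≢q
    ... | no _ | no _ = refl

    -- The graph of `old`, arranged so that reversing a case or exchanging v and w gives a case
    -- again. Involutivity and symmetry of `m′` at old pairs are then read off the constructors.
    data Case (b : Bool) : Fin (2 + n) → Fin (2 + n) → Set where
      plain₀ : b ≡ false → Case b 0F 1F
      plain₁ : b ≡ false → Case b 1F 0F
      toP    : b ≡ true → Case b 0F (ι (p v w))
      toQ    : b ≡ true → Case b 1F (ι (q v w))
      fromP  : b ≡ true → Case b (ι (p v w)) 0F
      fromQ  : b ≡ true → Case b (ι (q v w)) 1F
      same   : ∀ {x} → (b ≡ true → x ≢ p v w) → (b ≡ true → x ≢ q v w) → Case b (ι x) (ι (m v w x))

    case-old : ∀ b x → Case b x (old b v w x)
    case-old false 0F = plain₀ refl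
    case-old false 1F = plain₁ refl
    case-old false (suc (suc x)) = same (λ ()) (λ ())
    case-old true 0F = toP refl
    case-old true 1F = toQ refl
    case-old true (suc (suc x)) with x Fin.≟ p v w | x Fin.≟ q v w
    ... | yes refl | _ = fromP refl
    ... | no _ | yes refl = fromQ refl
    ... | no x≢p | no x≢q = same (λ _ → x≢p) (λ _ → x≢q)

    old-case : ∀ {b x y} → Case b x y → old b v w x ≡ y
    old-case (plain₀ refl) = refl
    old-case (plain₁ refl) = refl
    old-case (toP refl) = refl
    old-case (toQ refl) = refl
    old-case (fromP refl) = old-p
    old-case (fromQ refl) = old-q
    old-case {false} (same _ _) = refl
    old-case {true} (same x≢p x≢q) = old-other (x≢p refl) (x≢q refl)

  ι-distinct⁻ : ∀ {v w x} → Distinct (ι v) (ι w) (ι x) → Distinct v w x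
  ι-distinct⁻ (distinct a b c) = distinct (a ∘ cong ι) (b ∘ cong ι) (c ∘ cong ι)

  ι-injective : ∀ {x y} → ι x ≡ ι y → x ≡ y
  ι-injective refl = refl

  ι-distinct : ∀ {v w x} → Distinct v w x → Distinct (ι v) (ι w) (ι x)
  ι-distinct (distinct a b c) = distinct (a ∘ ι-injective) (b ∘ ι-injective) (c ∘ ι-injective)

  suc-≢ : ∀ {k} {x y : Fin k} → x ≢ y → Fin.suc x ≢ suc y
  suc-≢ ne = ne ∘ Fin.suc-injective

  skip₁-injective : ∀ {x y} → skip₁ x ≡ skip₁ y → x ≡ y
  skip₁-injective {zero} {zero} e = refl
  skip₁-injective {suc x} {suc y} e = cong suc (ι-injective e)

  skip₁-≢1 : ∀ x → skip₁ x ≢ 1F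
  skip₁-≢1 zero ()
  skip₁-≢1 (suc x) ()

  -- This includes the pair of the two new points, where `m′` follows the numbering used at the
  -- other new point. The two numberings agree there because `Q zero` takes only nonzero values on
  -- nonzero points.
  m′-1 : ∀ {v x} → v ≢ x → m′ 1F (skip₁ v) (skip₁ x) ≡ skip₁ (Q v x)
  m′-1 {zero} {zero} v≢x = contradiction refl v≢x
  m′-1 {zero} {suc x} v≢x with Q zero (suc x) | Q-fresh v≢x
  ... | zero | ne = contradiction refl ne
  ... | suc y | _ = refl
  m′-1 {suc v} {zero} v≢x = refl
  m′-1 {suc v} {suc x} v≢x = refl

  m′-1ʳ : ∀ {v x} → v ≢ x → m′ (skip₁ v) 1F (skip₁ x) ≡ skip₁ (Q v x)
  m′-1ʳ {zero} {zero} v≢x = contradiction refl v≢x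
  m′-1ʳ {zero} {suc x} v≢x with Q zero (suc x) | Q-fresh v≢x
  ... | zero | ne = contradiction refl ne
  ... | suc y | _ = refl
  m′-1ʳ {suc v} {zero} v≢x = refl
  m′-1ʳ {suc v} {suc x} v≢x = refl

  data Skip : Fin (2 + n) → Set where
    skipped : Skip 1F
    image   : ∀ x → Skip (skip₁ x)

  skip : ∀ x → Skip x
  skip zero = image zero
  skip (suc zero) = skipped
  skip (suc (suc x)) = image (suc x)

  data Shape : Fin (2 + n) → Fin (2 + n) → Fin (2 + n) → Set where
    at0   : ∀ {v x} → v ≢ x → Shape 0F (suc v) (suc x)
    at0ʳ  : ∀ {v x} → v ≢ x → Shape (suc v) 0F (suc x)
    at1   : ∀ {v x} → v ≢ x → Shape 1F (skip₁ v) (skip₁ x)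
    at1ʳ  : ∀ {v x} → v ≢ x → Shape (skip₁ v) 1F (skip₁ x)
    at    : ∀ {v w x} → Distinct (ι v) (ι w) x → Shape (ι v) (ι w) x

  shape : ∀ {v w x} → Distinct v w x → Shape v w x
  shape {zero} {zero} (distinct a _ _) = contradiction refl a
  shape {zero} {suc w} {zero} (distinct _ b _) = contradiction refl b
  shape {zero} {suc w} {suc x} (distinct _ _ c) = at0 (c ∘ cong suc)
  shape {suc v} {zero} {zero} (distinct _ _ c) = contradiction refl c
  shape {suc v} {zero} {suc x} (distinct _ b _) = at0ʳ (b ∘ cong suc)
  shape {suc zero} {suc zero} (distinct a _ _) = contradiction refl a
  shape {suc zero} {suc (suc w)} {x} (distinct _ b c) with skip x
  ... | skipped = contradiction refl b
  ... | image x = at1 {suc w} {x} (c ∘ cong skip₁)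
  shape {suc (suc v)} {suc zero} {x} (distinct _ b c) with skip x
  ... | skipped = contradiction refl c
  ... | image x = at1ʳ {suc v} {x} (b ∘ cong skip₁)
  shape {suc (suc v)} {suc (suc w)} d = at d

  m′-sym : ∀ {v w x} → Distinct v w x → m′ w v x ≡ m′ v w x
  m′-sym d = go d (shape d)
    where
    go : ∀ {v w x} → Distinct v w x → Shape v w x → m′ w v x ≡ m′ v w x
    go _ (at0 _) = refl
    go _ (at0ʳ _) = refl
    go _ (at1 ne) = trans (m′-1ʳ ne) (sym (m′-1 ne))
    go _ (at1ʳ ne) = trans (m′-1 ne) (sym (m′-1ʳ ne))
    go {x = x} (distinct v≢w _ _) (at {v} {w} d) = trans (cong (λ b → old b w v x) (W-sym v w))
      (old-case w≢v (flip (case-old (v≢w ∘ cong ι) (W v w) x) d))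
      where
      w≢v : w ≢ v
      w≢v = v≢w ∘ cong ι ∘ sym
      q-sym : q w v ≡ q v w
      q-sym = trans (cong (m w v) (p-sym v w)) (m-sym (p-fresh (v≢w ∘ cong ι)))
      flip : ∀ {b x y} → Case (v≢w ∘ cong ι) b x y → Distinct (ι v) (ι w) x → Case w≢v b x y
      flip (plain₀ b) _ = plain₀ b
      flip (plain₁ b) _ = plain₁ b
      flip (toP b) _ = subst (λ z → Case w≢v _ 0F (ι z)) (p-sym v w) (toP b)
      flip (toQ b) _ = subst (λ z → Case w≢v _ 1F (ι z)) q-sym (toQ b)
      flip (fromP b) _ = subst (λ z → Case w≢v _ (ι z) 0F) (p-sym v w) (fromP b)
      flip (fromQ b) _ = subst (λ z → Case w≢v _ (ι z) 1F) q-sym (fromQ b)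
      flip (same {x} h₁ h₂) d = subst (λ z → Case w≢v _ (ι x) (ι z)) (m-sym (ι-distinct⁻ d))
        (same (λ b e → h₁ b (trans e (p-sym v w))) (λ b e → h₂ b (trans e q-sym)))

  fresh′ : ∀ {v w x} → Distinct v w x → Distinct v w (m′ v w x)
  fresh′ d = go d (shape d)
    where
    go : ∀ {v w x} → Distinct v w x → Shape v w x → Distinct v w (m′ v w x)
    go _ (at0 ne) = distinct (λ ()) (λ ()) (suc-≢ (Q-fresh ne))
    go _ (at0ʳ ne) = distinct (λ ()) (suc-≢ (Q-fresh ne)) (λ ())
    go _ (at1 {v} ne) = subst (Distinct _ _) (sym (m′-1 ne)) (distinct (skip₁-≢1 v ∘ sym) (skip₁-≢1 _ ∘ sym) (Q-fresh ne ∘ skip₁-injective))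
    go _ (at1ʳ {v} ne) = subst (Distinct _ _) (sym (m′-1ʳ ne)) (distinct (skip₁-≢1 v) (Q-fresh ne ∘ skip₁-injective) (skip₁-≢1 _ ∘ sym))
    go {x = x} d@(distinct v≢w _ _) (at {v} {w} _) = result (case-old (v≢w ∘ cong ι) (W v w) x) d
      where
      new : ∀ {y} → (∀ z → ι z ≢ y) → Distinct (ι v) (ι w) y
      new ne = distinct v≢w (ne v) (ne w)
      result : ∀ {b x y} → Case (v≢w ∘ cong ι) b x y → Distinct (ι v) (ι w) x → Distinct (ι v) (ι w) y
      result (plain₀ _) _ = new (λ _ ())
      result (plain₁ _) _ = new (λ _ ())
      result (toP _) _ = ι-distinct (p-fresh (v≢w ∘ cong ι))
      result (toQ _) _ = ι-distinct (fresh (p-fresh (v≢w ∘ cong ι)))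
      result (fromP _) _ = new (λ _ ())
      result (fromQ _) _ = new (λ _ ())
      result (same _ _) d = ι-distinct (fresh (ι-distinct⁻ d))

  moves′ : ∀ {v w x} → Distinct v w x → m′ v w x ≢ x
  moves′ d = go d (shape d)
    where
    go : ∀ {v w x} → Distinct v w x → Shape v w x → m′ v w x ≢ x
    go _ (at0 ne) = suc-≢ (Q-moves ne)
    go _ (at0ʳ ne) = suc-≢ (Q-moves ne)
    go _ (at1 ne) e = Q-moves ne (skip₁-injective (trans (sym (m′-1 ne)) e))
    go _ (at1ʳ ne) e = Q-moves ne (skip₁-injective (trans (sym (m′-1ʳ ne)) e))
    go {x = x} d@(distinct v≢w _ _) (at {v} {w} _) = result (case-old (v≢w ∘ cong ι) (W v w) x) d
      where
      result : ∀ {b x y} → Case (v≢w ∘ cong ι) b x y → Distinct (ι v) (ι w) x → y ≢ x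
      result (plain₀ _) _ ()
      result (plain₁ _) _ ()
      result (toP _) _ ()
      result (toQ _) _ ()
      result (fromP _) _ ()
      result (fromQ _) _ ()
      result (same _ _) d = moves (ι-distinct⁻ d) ∘ ι-injective

  m-inv′ : ∀ {v w x} → Distinct v w x → m′ v w (m′ v w x) ≡ x
  m-inv′ d = go d (shape d)
    where
    go : ∀ {v w x} → Distinct v w x → Shape v w x → m′ v w (m′ v w x) ≡ x
    go _ (at0 ne) = cong suc (Q-inv ne)
    go _ (at0ʳ ne) = cong suc (Q-inv ne)
    go _ (at1 {v} {x} ne) = trans (cong (m′ 1F (skip₁ v)) (m′-1 ne)) (trans (m′-1 (Q-fresh ne)) (cong skip₁ (Q-inv ne)))
    go _ (at1ʳ {v} {x} ne) = trans (cong (m′ (skip₁ v) 1F) (m′-1ʳ ne)) (trans (m′-1ʳ (Q-fresh ne)) (cong skip₁ (Q-inv ne)))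
    go {x = x} d@(distinct v≢w _ _) (at {v} {w} _) = old-case v≢w′ (back (case-old v≢w′ (W v w) x) d)
      where
      v≢w′ : v ≢ w
      v≢w′ = v≢w ∘ cong ι
      back : ∀ {b x y} → Case v≢w′ b x y → Distinct (ι v) (ι w) x → Case v≢w′ b y x
      back (plain₀ b) _ = plain₁ b
      back (plain₁ b) _ = plain₀ b
      back (toP b) _ = fromP b
      back (toQ b) _ = fromQ b
      back (fromP b) _ = toP b
      back (fromQ b) _ = toQ b
      back (same {x} h₁ h₂) d = subst (λ z → Case v≢w′ _ (ι (m v w x)) (ι z)) (m-inv d′)
        (same (λ b e → h₂ b (trans (sym (m-inv d′)) (cong (m v w) e)))
              (λ b e → h₁ b (trans (sym (m-inv d′)) (trans (cong (m v w) e) (m-q v≢w′)))))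
        where
        d′ = ι-distinct⁻ d

  rotate : ∀ {k} {v w x : Fin k} → Distinct v w x → Distinct v x w
  rotate (distinct a b c) = distinct b a (c ∘ sym)

  -- The Boolean is the parity of the number of moves, which decides how an orientation changes
  -- along the walk.
  data Walk (v : Fin (2 + n)) : Bool → Fin (2 + n) × Fin (2 + n) → Fin (2 + n) × Fin (2 + n) → Set where
    []  : ∀ {x} → Walk v false x x
    _∷_ : ∀ {b x y z} → Move m′ v x y → Walk v b y z → Walk v (not b) x z

  walk⇒closure : ∀ {v b x y} → Walk v b x y → EqClosure (Move m′ v) x y
  walk⇒closure [] = ε
  walk⇒closure (r ∷ rs) = fwd r ◅ walk⇒closure rs

  turn≡ : ∀ {v w x y} → Distinct v w x → m′ v w x ≡ y → Move m′ v (w , x) (w , y)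
  turn≡ d refl = turn d

  -- The short circuit of new triples at ι v, cut open at w.
  detour : ∀ {v w} → v ≢ w → W v w ≡ true → Walk (ι v) true (ι w , 0F) (ι w , 1F)
  detour {v} {w} v≢w Wvw = go (Q (suc v) (suc w)) refl
    where
    sv≢sw : Fin.suc v ≢ suc w
    sv≢sw = suc-≢ v≢w
    go : ∀ y → Q (suc v) (suc w) ≡ y → Walk (ι v) true (ι w , 0F) (ι w , 1F)
    -- At v the circuit pairs w with the other new point: the detour passes vwa, vab, vwb in five
    -- moves.
    go zero eq =
      swap (distinct (v≢w ∘ ι-injective) (λ ()) (λ ()))
      ∷ turn≡ (distinct (λ ()) (v≢w ∘ ι-injective) (λ ())) (cong suc eq)
      ∷ swap (distinct (λ ()) (λ ()) (λ ()))
      ∷ turn≡ (distinct (λ ()) (λ ()) (λ ())) (cong skip₁ (trans (cong (Q (suc v)) (sym eq)) (Q-inv sv≢sw)))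
      ∷ swap (distinct (λ ()) (v≢w ∘ ι-injective) (λ ()))
      ∷ []
    -- The detour passes vwa, vaw′, vw′b, vbw in seven moves. It uses the pair {a, b} in the
    -- matching of {v, w′}, which is intact because w′ lies on the other side of the alternation
    -- `W-Q`.
    go (suc w′) eq =
      swap (distinct (v≢w ∘ ι-injective) (λ ()) (λ ()))
      ∷ turn≡ (distinct (λ ()) (v≢w ∘ ι-injective) (λ ())) (cong suc eq)
      ∷ swap (distinct (λ ()) (v≢w′ ∘ ι-injective) (λ ()))
      ∷ turn≡ (distinct (v≢w′ ∘ ι-injective) (λ ()) (λ ())) (cong (λ b → old b v w′ 0F) Wvw′)
      ∷ swap (distinct (v≢w′ ∘ ι-injective) (λ ()) (λ ()))
      ∷ turn≡ (distinct (λ ()) (v≢w′ ∘ ι-injective) (λ ())) (cong skip₁ (trans (cong (Q (suc v)) (sym eq)) (Q-inv sv≢sw)))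
      ∷ swap (distinct (λ ()) (v≢w ∘ ι-injective) (λ ()))
      ∷ []
      where
      v≢w′ : v ≢ w′
      v≢w′ e = Q-fresh sv≢sw (trans (cong suc e) (sym eq))
      Wvw′ : W v w′ ≡ false
      Wvw′ = trans (cong (W₀ v) (sym eq)) (trans (W-Q sv≢sw) (cong not Wvw))

  module _ (v : Fin n) where

    infix 4 _~_
    _~_ : Rel (Fin (2 + n) × Fin (2 + n)) _
    _~_ = EqClosure (Move m′ (ι v))

    flip~ : ∀ {w x} → Distinct (ι v) w x → (w , x) ~ (x , w)
    flip~ d = fwd (swap d) ◅ ε

    turn~ : ∀ {w x y} → Distinct (ι v) w x → m′ (ι v) w x ≡ y → (w , x) ~ (w , y)
    turn~ d e = fwd (turn≡ d e) ◅ ε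

    d0 : ∀ {w} → v ≢ w → Distinct (ι v) (ι w) 0F
    d0 v≢w = distinct (v≢w ∘ ι-injective) (λ ()) (λ ())

    d1 : ∀ {w} → v ≢ w → Distinct (ι v) (ι w) 1F
    d1 v≢w = distinct (v≢w ∘ ι-injective) (λ ()) (λ ())

    -- A turn between p and q that has been cut is replaced by the turn from p to a, the detour from
    -- a to b and the turn from b to q, or by the reverse of this.
    lift-turn : ∀ {w x} → Distinct v w x → (ι w , ι x) ~ (ι w , ι (m v w x))
    lift-turn {w} {x} d@(distinct v≢w _ _) = go (W v w) refl (x Fin.≟ p v w) (x Fin.≟ q v w)
      where
      go : ∀ b → W v w ≡ b → Dec (x ≡ p v w) → Dec (x ≡ q v w) → (ι w , ι x) ~ (ι w , ι (m v w x))
      go false Wvw _ _ = turn~ (ι-distinct d) (cong (λ b → old b v w (ι x)) Wvw)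
      go true Wvw (no x≢p) (no x≢q) = turn~ (ι-distinct d) (trans (cong (λ b → old b v w (ι x)) Wvw) (old-other v≢w x≢p x≢q))
      go true Wvw (yes refl) _ =
        turn~ (ι-distinct d) (trans (cong (λ b → old b v w (ι x)) Wvw) (old-p v≢w))
        ◅◅ walk⇒closure (detour v≢w Wvw)
        ◅◅ turn~ (d1 v≢w) (cong (λ b → old b v w 1F) Wvw)
      go true Wvw (no _) (yes refl) =
        turn~ (ι-distinct d) (trans (cong (λ b → old b v w (ι x)) Wvw) (old-q v≢w))
        ◅◅ EqC.symmetric _ (walk⇒closure (detour v≢w Wvw))
        ◅◅ turn~ (d0 v≢w) (trans (cong (λ b → old b v w 0F) Wvw) (cong ι (sym (m-q v≢w))))

    lift : ∀ {w x y z} → EqClosure (Move m v) (w , x) (y , z) → (ι w , ι x) ~ (ι y , ι z)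
    lift = EqC.join ∘ EqC.gmap (λ (w , x) → ι w , ι x) λ
      { (swap d) → flip~ (ι-distinct d)
      ; (turn d) → lift-turn d }

    ToOld : Fin (2 + n) × Fin (2 + n) → Set
    ToOld s = ∃₂ λ w x → Distinct v w x × s ~ (ι w , ι x)

    via : ∀ {s s′} → s ~ s′ → ToOld s′ → ToOld s
    via r (w , x , d , r′) = w , x , d , r ◅◅ r′

    spliced-0 : ∀ {w} → v ≢ w → W v w ≡ true → ToOld (ι w , 0F)
    spliced-0 {w} v≢w Wvw = w , p v w , p-fresh v≢w , turn~ (d0 v≢w) (cong (λ b → old b v w 0F) Wvw)

    -- Edges at the circuit point 0 are outside `W`, so an edge outside `W` is followed by one that
    -- leads to an old point.
    partner : ∀ {x y} → suc v ≢ x → W₀ v x ≡ false → Q (suc v) x ≡ y → ∃ λ w → y ≡ suc w × v ≢ w × W v w ≡ true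
    partner {x} {zero} ne Wvx eq = contradiction (trans (cong (W₀ v) (sym eq)) (trans (W-Q ne) (cong not Wvx))) λ ()
    partner {x} {suc w} ne Wvx eq = w , refl , (λ e → Q-fresh ne (trans (cong suc e) (sym eq))) ,
      trans (cong (W₀ v) (sym eq)) (trans (W-Q ne) (cong not Wvx))

    toOld-0 : ∀ {w} → v ≢ w → ∀ b → W v w ≡ b → ToOld (ι w , 0F)
    toOld-0 v≢w true Wvw = spliced-0 v≢w Wvw
    toOld-0 {w} v≢w false Wvw with partner (suc-≢ v≢w) Wvw refl
    ... | w′ , eq , v≢w′ , Wvw′ = via
      (flip~ (d0 v≢w) ◅◅ turn~ (rotate (d0 v≢w)) (cong suc eq) ◅◅ flip~ (rotate (d0 v≢w′)))
      (spliced-0 v≢w′ Wvw′)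

    toOld-1 : ∀ {w} → v ≢ w → ∀ b → W v w ≡ b → ToOld (ι w , 1F)
    toOld-1 v≢w true Wvw = via (EqC.symmetric _ (walk⇒closure (detour v≢w Wvw))) (spliced-0 v≢w Wvw)
    toOld-1 {w} v≢w false Wvw = via (turn~ (d1 v≢w) (cong (λ b → old b v w 1F) Wvw)) (toOld-0 v≢w false Wvw)

    toOld-01 : ToOld (0F , 1F)
    toOld-01 with partner {zero} (λ ()) refl refl
    ... | w , eq , v≢w , Wvw = via
      (turn~ (distinct (λ ()) (λ ()) (λ ())) (cong suc eq) ◅◅ flip~ (rotate (d0 v≢w)))
      (spliced-0 v≢w Wvw)

    -- Each new triple at v lies on a short circuit, and each short circuit meets the old one at its
    -- edge in `W`.
    toOld : ∀ {y z} → Distinct (ι v) y z → ToOld (y , z)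
    toOld {suc (suc w)} {suc (suc x)} d = w , x , ι-distinct⁻ d , ε
    toOld {suc (suc w)} {zero} d = toOld-0 (Distinct.v≢w d ∘ cong ι) _ refl
    toOld {suc (suc w)} {suc zero} d = toOld-1 (Distinct.v≢w d ∘ cong ι) _ refl
    toOld {zero} {suc (suc w)} d = via (flip~ d) (toOld-0 (Distinct.v≢x d ∘ cong ι) _ refl)
    toOld {suc zero} {suc (suc w)} d = via (flip~ d) (toOld-1 (Distinct.v≢x d ∘ cong ι) _ refl)
    toOld {zero} {suc zero} d = toOld-01
    toOld {suc zero} {zero} d = via (flip~ d) toOld-01
    toOld {zero} {zero} d = contradiction refl (Distinct.w≢x d)
    toOld {suc zero} {suc zero} d = contradiction refl (Distinct.w≢x d)

    joined-old : ∀ {w x y z} → Distinct (ι v) w x → Distinct (ι v) y z → (w , x) ~ (y , z)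
    joined-old d d′ =
      let _ , _ , e , r = toOld d
          _ , _ , e′ , r′ = toOld d′
      in r ◅◅ lift (joined e e′) ◅◅ EqC.symmetric _ r′

  joined-0 : ∀ {w x y z} → Distinct 0F w x → Distinct 0F y z → EqClosure (Move m′ 0F) (w , x) (y , z)
  joined-0 {zero} (distinct a _ _) _ = contradiction refl a
  joined-0 {suc w} {zero} (distinct _ b _) _ = contradiction refl b
  joined-0 {suc w} {suc x} {zero} _ (distinct a _ _) = contradiction refl a
  joined-0 {suc w} {suc x} {suc y} {zero} _ (distinct _ b _) = contradiction refl b
  joined-0 {suc w} {suc x} {suc y} {suc z} (distinct _ _ c) (distinct _ _ c′) =
    EqC.gmap (λ (v , x) → suc v , suc x)
      (λ { (swap ne) → swap (distinct (λ ()) (λ ()) (suc-≢ ne)) ; (turn ne) → turn (distinct (λ ()) (λ ()) (suc-≢ ne)) })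
      (Q-joined (c ∘ cong suc) (c′ ∘ cong suc))

  joined-1 : ∀ {w x y z} → Distinct 1F w x → Distinct 1F y z → EqClosure (Move m′ 1F) (w , x) (y , z)
  joined-1 {w} {x} {y} {z} (distinct a b c) (distinct a′ b′ c′) = go (skip w) (skip x) (skip y) (skip z) a b c a′ b′ c′
    where
    d : ∀ {v x} → v ≢ x → Distinct 1F (skip₁ v) (skip₁ x)
    d ne = distinct (skip₁-≢1 _ ∘ sym) (skip₁-≢1 _ ∘ sym) (ne ∘ skip₁-injective)
    go : ∀ {w x y z} → Skip w → Skip x → Skip y → Skip z → 1F ≢ w → 1F ≢ x → w ≢ x → 1F ≢ y → 1F ≢ z → y ≢ z → EqClosure (Move m′ 1F) (w , x) (y , z)
    go skipped _ _ _ a _ _ _ _ _ = contradiction refl a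
    go _ skipped _ _ _ b _ _ _ _ = contradiction refl b
    go _ _ skipped _ _ _ _ a′ _ _ = contradiction refl a′
    go _ _ _ skipped _ _ _ _ b′ _ = contradiction refl b′
    go (image w) (image x) (image y) (image z) _ _ c _ _ c′ =
      EqC.gmap (λ (v , x) → skip₁ v , skip₁ x)
        (λ { (swap ne) → swap (d ne) ; (turn ne) → turn≡ (d ne) (m′-1 ne) })
        (Q-joined (c ∘ cong skip₁) (c′ ∘ cong skip₁))

  joined′ : ∀ {v w x y z} → Distinct v w x → Distinct v y z → EqClosure (Move m′ v) (w , x) (y , z)
  joined′ {zero} = joined-0
  joined′ {suc zero} = joined-1
  joined′ {suc (suc v)} = joined-old v

  extended : Design (2 + n)
  extended = record { m = m′ ; m-sym = m′-sym ; fresh = fresh′ ; moves = moves′ ; m-inv = m-inv′ ; joined = joined′ }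

-- Restricting and extending orientations

module ExtendOrientation {n : ℕ} (D : Design n) (E : Circuit n)
         (p : Fin n → Fin n → Fin n) (p-sym : ∀ v w → p w v ≡ p v w)
         (p-fresh : ∀ {v w} → v ≢ w → Distinct v w (p v w)) where

  open Design D
  open Circuit E
  open Extend D E p p-sym p-fresh
  private module D′ = Design extended

  ι-triple : Triple n → Triple (2 + n)
  ι-triple (tri a b c p q r) = tri (ι a) (ι b) (ι c) (λ e → p (ι-injective e)) (λ e → q (ι-injective e)) (λ e → r (ι-injective e))

  -- No compatibility of p with signs is assumed. Where an old turn has been cut, the replacement
  -- consists of a turn, a detour with an odd number of moves and a turn, so the sign changes just
  -- as under the old turn.
  restrict : D′.Orientation → Orientation
  restrict (s , s-exchange , s-turn) = s ∘ ι-triple , (λ { 0F t → s-exchange 0F (ι-triple t) ; 1F t → s-exchange 1F (ι-triple t) }) , turned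
    where
    triple-cong : ∀ {v w x y : Fin (2 + n)} (d : Distinct v w x) (d′ : Distinct v w y) → x ≡ y → s (triple d) ≡ s (triple d′)
    triple-cong d d′ refl = refl
    at-turn : ∀ {v w x y} (d : Distinct v w x) (d′ : Distinct v w y) → m′ v w x ≡ y → s (triple d′) ≡ not (s (triple d))
    at-turn d d′ refl = s-turn (triple d)
    at-walk : ∀ {v b w x y z} → Walk v b (w , x) (y , z) → (d : Distinct v w x) (d′ : Distinct v y z) → s (triple d′) ≡ b xor s (triple d)
    at-walk [] d d′ = refl
    at-walk (_∷_ {b = b} (swap _) rs) d d′ =
      trans (at-walk rs (rotate d) d′) (trans (cong (b xor_) (s-exchange 1F (triple d))) (trans (sym (Bool.not-distribʳ-xor b _)) (Bool.not-distribˡ-xor b _)))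
    at-walk (_∷_ {b = b} (turn {w} {x} _) rs) d d′ =
      trans (at-walk rs (fresh′ d) d′) (trans (cong (b xor_) (at-turn d (fresh′ d) refl)) (trans (sym (Bool.not-distribʳ-xor b _)) (Bool.not-distribˡ-xor b _)))
    turned-at : ∀ {v w x} (d : Distinct v w x) → s (triple (ι-distinct (fresh d))) ≡ not (s (triple (ι-distinct d)))
    turned-at {v} {w} {x} d@(distinct v≢w _ _) = go (W v w) refl (x Fin.≟ p v w) (x Fin.≟ q v w)
      where
      d₀ = d0 v v≢w
      d₁ = d1 v v≢w
      dₓ = ι-distinct d
      d′ = ι-distinct (fresh d)
      becomes : ∀ {b y z} → W v w ≡ b → old b v w y ≡ z → m′ (ι v) (ι w) y ≡ z
      becomes {y = y} Wvw e = trans (cong (λ b → old b v w y) Wvw) e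
      go : ∀ b → W v w ≡ b → Dec (x ≡ p v w) → Dec (x ≡ q v w) → s (triple d′) ≡ not (s (triple dₓ))
      go false Wvw _ _ = at-turn dₓ d′ (becomes Wvw refl)
      go true Wvw (no x≢p) (no x≢q) = at-turn dₓ d′ (becomes Wvw (old-other v≢w x≢p x≢q))
      go true Wvw (yes refl) _ = trans (at-turn d₁ d′ (becomes Wvw refl))
        (cong not (trans (at-walk (detour v≢w Wvw) d₀ d₁) (trans (cong not (at-turn dₓ d₀ (becomes Wvw (old-p v≢w)))) (Bool.not-involutive _))))
      go true Wvw (no _) (yes refl) = trans (at-turn d₀ d′ (becomes Wvw (cong ι (sym (m-q v≢w)))))
        (trans (sym (at-walk (detour v≢w Wvw) d₀ d₁)) (at-turn dₓ d₁ (becomes Wvw (old-q v≢w))))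
    turned : ∀ t → s (ι-triple (turnTriple t)) ≡ not (s (ι-triple t))
    turned (tri v w x p q r) = turned-at (distinct (relevant p) (relevant q) (relevant r))

  -- By `compatible` the triples vwp and vwa, which become matched at a spliced pair, have opposite
  -- signs. The same follows for vwq and vwb, since both signs are reversed.
  module _ (s : Triple n → Bool) (s-exchange : ∀ i t → s (exchange i t) ≡ not (s t)) (s-turn : ∀ t → s (turnTriple t) ≡ not (s t))
           (compatible : ∀ {v w} (v≢w : v ≢ w) → W v w ≡ true → s (triple (p-fresh v≢w)) ≡ not (e (suc v) (suc w))) where

    -- The triples at 0 are oriented along the circuit and those at 1 against it.
    sign : ∀ (a b c : Fin (2 + n)) → .(a ≢ b) → .(a ≢ c) → .(b ≢ c) → Bool
    sign zero (suc v) (suc x) _ _ _ = e v x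
    sign (suc v) zero (suc x) _ _ _ = not (e v x)
    sign (suc v) (suc x) zero _ _ _ = e v x
    sign (suc zero) (suc (suc v)) (suc (suc x)) _ _ _ = not (e (suc v) (suc x))
    sign (suc (suc v)) (suc zero) (suc (suc x)) _ _ _ = e (suc v) (suc x)
    sign (suc (suc v)) (suc (suc x)) (suc zero) _ _ _ = not (e (suc v) (suc x))
    sign (suc (suc v)) (suc (suc w)) (suc (suc x)) a≢b a≢c b≢c =
      s (tri v w x (λ e → a≢b (cong ι e)) (λ e → a≢c (cong ι e)) (λ e → b≢c (cong ι e)))
    sign _ _ _ _ _ _ = false

    signed : Triple (2 + n) → Bool
    signed (tri a b c a≢b a≢c b≢c) = sign a b c a≢b a≢c b≢c

    σ : ∀ {v w x} → Distinct v w x → Bool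
    σ d = signed (triple d)

    e-anti′ : ∀ {v x} → v ≢ x → not (e x v) ≡ e v x
    e-anti′ ne = trans (cong not (e-anti ne)) (Bool.not-involutive _)

    signed-exchange₀ : ∀ {v w x} (d : Distinct v w x) → sign w v x (Distinct.v≢w d ∘ sym) (Distinct.w≢x d) (Distinct.v≢x d) ≡ not (σ d)
    signed-exchange₀ {zero} {zero} d = contradiction refl (Distinct.v≢w d)
    signed-exchange₀ {zero} {suc v} {zero} d = contradiction refl (Distinct.v≢x d)
    signed-exchange₀ {zero} {suc v} {suc x} d = refl
    signed-exchange₀ {suc v} {zero} {zero} d = contradiction refl (Distinct.w≢x d)
    signed-exchange₀ {suc v} {zero} {suc x} d = sym (Bool.not-involutive _)
    signed-exchange₀ {suc v} {suc w} {zero} d = e-anti (Distinct.v≢w d ∘ cong suc)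
    signed-exchange₀ {suc zero} {suc zero} {suc x} d = contradiction refl (Distinct.v≢w d)
    signed-exchange₀ {suc zero} {suc (suc v)} {suc zero} d = contradiction refl (Distinct.v≢x d)
    signed-exchange₀ {suc zero} {suc (suc v)} {suc (suc x)} d = sym (Bool.not-involutive _)
    signed-exchange₀ {suc (suc v)} {suc zero} {suc zero} d = contradiction refl (Distinct.w≢x d)
    signed-exchange₀ {suc (suc v)} {suc zero} {suc (suc x)} d = refl
    signed-exchange₀ {suc (suc v)} {suc (suc w)} {suc zero} d = cong not (e-anti (Distinct.v≢w d ∘ cong suc))
    signed-exchange₀ {suc (suc v)} {suc (suc w)} {suc (suc x)} d = s-exchange 0F (triple (ι-distinct⁻ d))

    signed-exchange₁ : ∀ {v w x} (d : Distinct v w x) → σ (rotate d) ≡ not (σ d)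
    signed-exchange₁ {zero} {zero} d = contradiction refl (Distinct.v≢w d)
    signed-exchange₁ {zero} {suc v} {zero} d = contradiction refl (Distinct.v≢x d)
    signed-exchange₁ {zero} {suc v} {suc x} d = e-anti (Distinct.w≢x d ∘ cong suc)
    signed-exchange₁ {suc v} {zero} {zero} d = contradiction refl (Distinct.w≢x d)
    signed-exchange₁ {suc v} {zero} {suc x} d = sym (Bool.not-involutive _)
    signed-exchange₁ {suc v} {suc w} {zero} d = refl
    signed-exchange₁ {suc zero} {suc zero} {suc x} d = contradiction refl (Distinct.v≢w d)
    signed-exchange₁ {suc zero} {suc (suc v)} {suc zero} d = contradiction refl (Distinct.v≢x d)
    signed-exchange₁ {suc zero} {suc (suc v)} {suc (suc x)} d = cong not (e-anti (Distinct.w≢x d ∘ cong suc))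
    signed-exchange₁ {suc (suc v)} {suc zero} {suc zero} d = contradiction refl (Distinct.w≢x d)
    signed-exchange₁ {suc (suc v)} {suc zero} {suc (suc x)} d = refl
    signed-exchange₁ {suc (suc v)} {suc (suc w)} {suc zero} d = sym (Bool.not-involutive _)
    signed-exchange₁ {suc (suc v)} {suc (suc w)} {suc (suc x)} d = s-exchange 1F (triple (ι-distinct⁻ d))

    signed-cong : ∀ {v w x y} (d : Distinct v w x) (d′ : Distinct v w y) → x ≡ y → σ d ≡ σ d′
    signed-cong d d′ refl = refl

    σ-at1 : ∀ {v x} (d : Distinct 1F (skip₁ v) (skip₁ x)) → σ d ≡ not (e v x)
    σ-at1 {zero} {zero} d = contradiction refl (Distinct.w≢x d)
    σ-at1 {zero} {suc x} d = refl
    σ-at1 {suc v} {zero} d = sym (e-anti′ λ ())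
    σ-at1 {suc v} {suc x} d = refl

    signed-turn : ∀ {v w x} (d : Distinct v w x) → σ (fresh′ d) ≡ not (σ d)
    signed-turn d = go d (shape d)
      where
      at1-turn : ∀ {v x} (d : Distinct 1F (skip₁ v) (skip₁ x)) → v ≢ x → σ (fresh′ d) ≡ not (σ d)
      at1-turn {v} {x} d ne = trans (signed-cong (fresh′ d) d′ (m′-1 ne)) (trans (σ-at1 d′) (trans (cong not (e-Q ne)) (cong not (sym (σ-at1 d)))))
        where
        d′ : Distinct 1F (skip₁ v) (skip₁ (Q v x))
        d′ = subst (Distinct 1F (skip₁ v)) (m′-1 ne) (fresh′ d)
      go : ∀ {v w x} (d : Distinct v w x) → Shape v w x → σ (fresh′ d) ≡ not (σ d)
      go d (at0 ne) = e-Q ne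
      go d (at0ʳ ne) = cong not (e-Q ne)
      go d (at1 ne) = at1-turn d ne
      go d (at1ʳ {v} {x} ne) = begin
        σ (fresh′ d)                 ≡⟨ sym (Bool.not-involutive _) ⟩
        not (not (σ (fresh′ d)))     ≡⟨ cong not (sym (signed-exchange₀ (fresh′ d))) ⟩
        not (σ (exch (fresh′ d)))    ≡⟨ cong not (signed-cong (exch (fresh′ d)) (fresh′ (exch d)) (sym (m′-sym d))) ⟩
        not (σ (fresh′ (exch d)))    ≡⟨ cong not (at1-turn (exch d) ne) ⟩
        not (not (σ (exch d)))       ≡⟨ cong (not ∘ not) (signed-exchange₀ d) ⟩
        not (not (not (σ d)))        ≡⟨ Bool.not-involutive _ ⟩
        not (σ d)                    ∎
        where
        open ≡-Reasoning
        exch : ∀ {v w x : Fin (2 + n)} → Distinct v w x → Distinct w v x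
        exch (distinct a b c) = distinct (a ∘ sym) c b
      go {x = x} d (at {v} {w} _) = byCase (case-old v≢w (W v w) x) refl d (fresh′ d)
        where
        v≢w : v ≢ w
        v≢w = Distinct.v≢w d ∘ cong ι
        σp : W v w ≡ true → s (triple (p-fresh v≢w)) ≡ not (e (suc v) (suc w))
        σp = compatible v≢w
        σq : W v w ≡ true → s (triple (fresh (p-fresh v≢w))) ≡ e (suc v) (suc w)
        σq Wvw = trans (s-turn (triple (p-fresh v≢w))) (trans (cong not (σp Wvw)) (Bool.not-involutive _))
        byCase : ∀ {b x y} → Case v≢w b x y → W v w ≡ b → (d : Distinct (ι v) (ι w) x) (d′ : Distinct (ι v) (ι w) y) → σ d′ ≡ not (σ d)
        byCase (plain₀ _) _ d d′ = refl
        byCase (plain₁ _) _ d d′ = sym (Bool.not-involutive _)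
        byCase (toP refl) Wvw d d′ = σp Wvw
        byCase (toQ refl) Wvw d d′ = trans (σq Wvw) (sym (Bool.not-involutive _))
        byCase (fromP refl) Wvw d d′ = trans (sym (Bool.not-involutive _)) (cong not (sym (σp Wvw)))
        byCase (fromQ refl) Wvw d d′ = cong not (sym (σq Wvw))
        byCase (same _ _) _ d d′ = s-turn (triple (ι-distinct⁻ d))

    extendOrientation : D′.Orientation
    extendOrientation = signed ,
      (λ { 0F t → signed-exchange₀ (distinctTriple t) ; 1F t → signed-exchange₁ (distinctTriple t) }) ,
      (λ t → signed-turn (distinctTriple t))

-- An Euler circuit of the complete graph on an odd number of points

par : ℕ → Bool
par zero    = false
par (suc x) = not (par x)

par-+ : ∀ x y → par (x + y) ≡ par x xor par y
par-+ zero y = refl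
par-+ (suc x) y = trans (cong not (par-+ x y)) (Bool.not-distribˡ-xor (par x) (par y))

not-≢ : ∀ {b} → not b ≢ b
not-≢ {false} ()
not-≢ {true} ()

-- The points 0, …, n are arranged on a cycle; a nonzero v matches v + d with v + d + 1 for d odd.
module Rotation (n : ℕ) (0<n : 0 < n) (n-even : par n ≡ false) where

  -- Here x is the lower point of a pair {x, x + 1} at v. For x below v the offset d is n + 1 - (v -
  -- x) and n + 1 is odd, so the parity condition is opposite on the two sides of v.
  Matched : ℕ → ℕ → Set
  Matched v x = (suc x < v × par x ≡ par v) ⊎ (v < x × x < n × par x ≡ not (par v))

  -- The pair {n, 0} has offset d = n - v, which is odd exactly when v is odd, as n is even.
  data Rel′ (v x y : ℕ) : Set where
    up    : Matched v x → y ≡ suc x → Rel′ v x y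
    down  : Matched v y → x ≡ suc y → Rel′ v x y
    wrapˡ : par v ≡ true → x ≡ 0 → y ≡ n → Rel′ v x y
    wrapʳ : par v ≡ true → x ≡ n → y ≡ 0 → Rel′ v x y

  Rel′-sym : ∀ {v x y} → Rel′ v x y → Rel′ v y x
  Rel′-sym (up M e) = down M e
  Rel′-sym (down M e) = up M e
  Rel′-sym (wrapˡ p e e′) = wrapʳ p e′ e
  Rel′-sym (wrapʳ p e e′) = wrapˡ p e′ e

  consecutive : ∀ {v x} → Matched v x → Matched v (suc x) → ⊥
  consecutive (inj₁ (_ , p)) (inj₁ (_ , p′)) = not-≢ (trans p′ (sym p))
  consecutive (inj₁ (sx<v , _)) (inj₂ (v<sx , _)) = ℕ.<-asym sx<v v<sx
  consecutive (inj₂ (v<x , _)) (inj₁ (ssx<v , _)) = ℕ.<-asym v<x (ℕ.<-trans (ℕ.<-trans (ℕ.n<1+n _) (ℕ.n<1+n _)) ssx<v)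
  consecutive (inj₂ (_ , _ , p)) (inj₂ (_ , _ , p′)) = not-≢ (trans p′ (sym p))

  ¬up-0 : ∀ {v} → par v ≡ true → ¬ Matched v 0
  ¬up-0 pv (inj₁ (_ , p)) = contradiction (trans p pv) λ ()
  ¬up-0 pv (inj₂ (() , _))

  ¬up-n : ∀ {v} → v ≤ n → ¬ Matched v n
  ¬up-n v≤n (inj₁ (n<v , _)) = ℕ.<⇒≱ (ℕ.<-trans (ℕ.n<1+n n) n<v) v≤n
  ¬up-n v≤n (inj₂ (_ , n<n , _)) = ℕ.<-irrefl refl n<n

  ¬down-n : ∀ {v x} → v ≤ n → par v ≡ true → n ≡ suc x → ¬ Matched v x
  ¬down-n v≤n pv refl (inj₁ (n<v , _)) = ℕ.<⇒≱ n<v v≤n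
  ¬down-n v≤n pv refl (inj₂ (_ , _ , p)) = contradiction (trans (sym n-even) (cong not (trans p (cong not pv)))) λ ()

  functional : ∀ {v x y z} → v ≤ n → Rel′ v x y → Rel′ v x z → y ≡ z
  functional _ (up _ e) (up _ e′) = trans e (sym e′)
  functional _ (up M _) (down M′ refl) = contradiction M (consecutive M′)
  functional _ (up M _) (wrapˡ p refl _) = contradiction M (¬up-0 p)
  functional v≤n (up M _) (wrapʳ p refl _) = contradiction M (¬up-n v≤n)
  functional _ (down M refl) (up M′ _) = contradiction M′ (consecutive M)
  functional _ (down _ e) (down _ e′) = ℕ.suc-injective (trans (sym e) e′)
  functional _ (down _ refl) (wrapˡ _ () _)
  functional v≤n (down M e) (wrapʳ p refl _) = contradiction M (¬down-n v≤n p e)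
  functional _ (wrapˡ p refl _) (up M _) = contradiction M (¬up-0 p)
  functional _ (wrapˡ _ refl _) (down _ ())
  functional _ (wrapˡ _ _ e) (wrapˡ _ _ e′) = trans e (sym e′)
  functional _ (wrapˡ _ refl _) (wrapʳ _ 0≡n _) = contradiction 0≡n (ℕ.<⇒≢ 0<n)
  functional v≤n (wrapʳ p refl _) (up M _) = contradiction M (¬up-n v≤n)
  functional v≤n (wrapʳ p refl _) (down M e) = contradiction M (¬down-n v≤n p e)
  functional _ (wrapʳ _ refl _) (wrapˡ _ n≡0 _) = contradiction (sym n≡0) (ℕ.<⇒≢ 0<n)
  functional _ (wrapʳ _ _ e) (wrapʳ _ _ e′) = trans e (sym e′)

  par-≢ : ∀ {x y} → par x ≢ par y → x ≢ y
  par-≢ ne refl = ne refl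

  total : ∀ {v x} → v ≤ n → x ≤ n → x ≢ v → ∃ λ y → y ≤ n × Rel′ v x y
  total {v} {x} v≤n x≤n x≢v with ℕ.<-cmp x v | par x Bool.≟ par v
  ... | tri≈ _ x≡v _ | _ = contradiction x≡v x≢v
  ... | tri< x<v _ _ | yes p = suc x , ℕ.≤-trans x<v v≤n ,
    up (inj₁ (ℕ.≤∧≢⇒< x<v (par-≢ (λ e → not-≢ (trans e (sym p)))) , p)) refl
  total {v} {zero} v≤n x≤n x≢v | tri< x<v _ _ | no p =
    n , ℕ.≤-refl , wrapˡ (Bool.¬-not (p ∘ sym)) refl refl
  total {v} {suc x} v≤n x≤n x≢v | tri< x<v _ _ | no p =
    x , ℕ.≤-trans (ℕ.n≤1+n x) x≤n , down (inj₁ (x<v , trans (sym (Bool.not-involutive _)) (sym (Bool.¬-not (p ∘ sym))))) refl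
  total {v} {suc x} v≤n x≤n x≢v | tri> _ _ v<x | yes p =
    x , ℕ.≤-trans (ℕ.n≤1+n x) x≤n ,
    down (inj₂ (ℕ.≤∧≢⇒< (ℕ.≤-pred v<x) (λ { refl → not-≢ p }) , x≤n , trans (sym (Bool.not-involutive _)) (cong not p))) refl
  total {v} {x} v≤n x≤n x≢v | tri> _ _ v<x | no p with x ℕ.≟ n
  ... | yes refl = 0 , z≤n , wrapʳ (trans (Bool.¬-not (p ∘ sym)) (cong not n-even)) refl refl
  ... | no x≢n = suc x , ℕ.≤∧≢⇒< x≤n x≢n , up (inj₂ (v<x , ℕ.≤∧≢⇒< x≤n x≢n , Bool.¬-not p)) refl

  Rel′-≢ : ∀ {v x y} → Rel′ v x y → y ≢ x
  Rel′-≢ (up _ refl) = ℕ.1+n≢n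
  Rel′-≢ (down _ refl) = ℕ.1+n≢n ∘ sym
  Rel′-≢ (wrapˡ _ refl refl) = ℕ.<⇒≢ 0<n ∘ sym
  Rel′-≢ (wrapʳ _ refl refl) = ℕ.<⇒≢ 0<n

  par-v≢0 : ∀ {v} → par v ≡ true → v ≢ 0
  par-v≢0 () refl

  Rel′-≢v : ∀ {v x y} → Rel′ v x y → v ≢ y
  Rel′-≢v (up (inj₁ (lt , _)) refl) refl = ℕ.<-irrefl refl lt
  Rel′-≢v (up (inj₂ (lt , _)) refl) refl = ℕ.<⇒≱ lt (ℕ.n≤1+n _)
  Rel′-≢v (down (inj₁ (lt , _)) refl) refl = ℕ.<⇒≱ lt (ℕ.n≤1+n _)
  Rel′-≢v (down (inj₂ (lt , _)) refl) refl = ℕ.<-irrefl refl lt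
  Rel′-≢v (wrapˡ p refl refl) refl = contradiction (trans (sym p) n-even) λ ()
  Rel′-≢v (wrapʳ p refl refl) refl = contradiction p λ ()

  -- The tournament of the rotational orientation: an edge is directed upwards if its length is odd.
  below : ℕ → ℕ → Bool
  below x v = does (x ℕ.<? v)

  sgn : ℕ → ℕ → Bool
  sgn v x = (par v xor par x) xor below x v

  below-true : ∀ {x v} → x < v → below x v ≡ true
  below-true {x} {v} x<v = dec-true (x ℕ.<? v) x<v

  below-false : ∀ {x v} → v ≤ x → below x v ≡ false
  below-false {x} {v} v≤x = dec-false (x ℕ.<? v) (ℕ.≤⇒≯ v≤x)

  sgn-anti : ∀ {v x} → v ≢ x → sgn x v ≡ not (sgn v x)
  sgn-anti {v} {x} v≢x with ℕ.<-cmp v x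
  ... | tri≈ _ e _ = contradiction e v≢x
  ... | tri< v<x _ _ rewrite below-true v<x | below-false (ℕ.<⇒≤ v<x) | Bool.xor-comm (par v) (par x) = flip₁ (par x xor par v)
    where
    flip₁ : ∀ b → b xor true ≡ not (b xor false)
    flip₁ false = refl
    flip₁ true = refl
  ... | tri> _ _ x<v rewrite below-true x<v | below-false (ℕ.<⇒≤ x<v) | Bool.xor-comm (par v) (par x) = flip₀ (par x xor par v)
    where
    flip₀ : ∀ b → b xor false ≡ not (b xor true)
    flip₀ false = refl
    flip₀ true = refl

  sgn-step : ∀ v x → below (suc x) v ≡ below x v → sgn v (suc x) ≡ not (sgn v x)
  sgn-step v x e = trans (cong ((par v xor not (par x)) xor_) e)
    (trans (cong (_xor below x v) (sym (Bool.not-distribʳ-xor (par v) (par x)))) (sym (Bool.not-distribˡ-xor (par v xor par x) (below x v))))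

  sgn-matched : ∀ {v x} → Matched v x → sgn v (suc x) ≡ not (sgn v x)
  sgn-matched {v} {x} (inj₁ (sx<v , _)) = sgn-step v x (trans (below-true sx<v) (sym (below-true (ℕ.<-trans (ℕ.n<1+n x) sx<v))))
  sgn-matched {v} {x} (inj₂ (v<x , _)) = sgn-step v x (trans (below-false (ℕ.<⇒≤ (ℕ.<-trans v<x (ℕ.n<1+n x)))) (sym (below-false (ℕ.<⇒≤ v<x))))

  sgn-wrap : ∀ {v} → v ≤ n → par v ≡ true → sgn v n ≡ not (sgn v 0)
  sgn-wrap {v} v≤n p rewrite n-even | p | below-false v≤n | below-true {0} {v} (ℕ.n≢0⇒n>0 (par-v≢0 p)) = refl

  -- `sgn v x` is the parity of the residue of x - v modulo n + 1, and the points of a pair have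
  -- consecutive residues d and d + 1 without wrapping.
  sgn-Rel′ : ∀ {v x y} → v ≤ n → Rel′ v x y → sgn v y ≡ not (sgn v x)
  sgn-Rel′ _ (up M refl) = sgn-matched M
  sgn-Rel′ _ (down M refl) = trans (sym (Bool.not-involutive _)) (cong not (sym (sgn-matched M)))
  sgn-Rel′ v≤n (wrapˡ p refl refl) = sgn-wrap v≤n p
  sgn-Rel′ v≤n (wrapʳ p refl refl) = trans (sym (Bool.not-involutive _)) (cong not (sym (sgn-wrap v≤n p)))

  -- The class of the edge from a nonzero v: it is selected if x is nonzero and of the other parity.
  -- Paired nonzero points are consecutive numbers, so exactly one is selected; the pair {0, 1}
  -- occurs only at even v and {n, 0} only at odd v, where 1 and n respectively are selected.
  ω : ℕ → ℕ → Bool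
  ω v zero = false
  ω v (suc x) = par v xor par (suc x)

  ω-matched : ∀ {v x} → Matched v x → ω v (suc x) ≡ not (ω v x)
  ω-matched {v} {zero} (inj₁ (_ , p)) = cong (_xor true) (sym p)
  ω-matched {v} {zero} (inj₂ (() , _))
  ω-matched {v} {suc x} _ = sym (Bool.not-distribʳ-xor (par v) (par (suc x)))

  ω-n : ∀ {v} → par v ≡ true → ω v n ≡ true
  ω-n {v} p = trans (at n 0<n) (cong₂ _xor_ p n-even)
    where
    at : ∀ x → 0 < x → ω v x ≡ par v xor par x
    at (suc x) _ = refl

  ω-Rel′ : ∀ {v x y} → Rel′ v x y → ω v y ≡ not (ω v x)
  ω-Rel′ (up M refl) = ω-matched M
  ω-Rel′ (down M refl) = trans (sym (Bool.not-involutive _)) (cong not (sym (ω-matched M)))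
  ω-Rel′ (wrapˡ p refl refl) = ω-n p
  ω-Rel′ (wrapʳ p refl refl) = cong not (sym (ω-n p))


-- At the point 0 the rotational pairs are replaced by {1, 2} and the pairs {x, n + 3 - x}, which joins all the circuits.
module RotationalCircuit (k : ℕ) (k-even : par k ≡ false) where

  private
    n : ℕ
    n = 2 + k

  open Rotation n (s≤s z≤n) (trans (Bool.not-involutive _) k-even)

  bound : (x : Fin (suc n)) → toℕ x ≤ n
  bound x = Fin.toℕ≤pred[n] x

  reflect : Fin n → Fin n
  reflect 0F = 1F
  reflect 1F = 0F
  reflect (suc (suc x)) = suc (suc (opposite x))

  toℕ-≢ : ∀ {m} {x y : Fin m} → x ≢ y → toℕ x ≢ toℕ y
  toℕ-≢ ne = ne ∘ Fin.toℕ-injective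

  pick : ∀ {v x : Fin (suc n)} → (∃ λ y → y ≤ n × Rel′ (toℕ v) (toℕ x) y) → ∃ λ y → Rel′ (toℕ v) (toℕ x) (toℕ y)
  pick (y , y≤n , r) = fromℕ< (s≤s y≤n) , subst (Rel′ _ _) (sym (Fin.toℕ-fromℕ< (s≤s y≤n))) r

  Q : Fin (suc n) → Fin (suc n) → Fin (suc n)
  Q zero zero = zero
  Q zero (suc x) = suc (reflect x)
  Q v@(suc _) x with v Fin.≟ x
  ... | yes _ = x
  ... | no v≢x = proj₁ (pick {v} {x} (total (bound v) (bound x) (toℕ-≢ v≢x ∘ sym)))

  Q-Rel′ : ∀ {v x} → Fin.suc v ≢ x → Rel′ (suc (toℕ v)) (toℕ x) (toℕ (Q (suc v) x))
  Q-Rel′ {v} {x} ne with suc v Fin.≟ x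
  ... | yes e = contradiction e ne
  ... | no v≢x = proj₂ (pick {suc v} {x} (total (bound (suc v)) (bound x) (toℕ-≢ v≢x ∘ sym)))

  Rel′-Q : ∀ {v x y} → Fin.suc v ≢ x → Rel′ (suc (toℕ v)) (toℕ x) (toℕ y) → Q (suc v) x ≡ y
  Rel′-Q {v} ne r = Fin.toℕ-injective (functional (bound (suc v)) (Q-Rel′ ne) r)

  reflect-involutive : ∀ x → reflect (reflect x) ≡ x
  reflect-involutive 0F = refl
  reflect-involutive 1F = refl
  reflect-involutive (suc (suc x)) = cong (Fin.suc ∘ Fin.suc) (Fin.opposite-involutive x)

  par-opposite : ∀ {m} (x : Fin m) → par m ≡ false → par (toℕ (opposite x)) ≡ not (par (toℕ x))
  par-opposite {m} x m-even = trans (sym (Bool.not-involutive _)) (cong not (sym (xor-cancel _ _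
    (trans (sym (par-+ (toℕ x) (suc (toℕ (opposite x)))))
      (trans (cong par (trans (ℕ.+-suc (toℕ x) _) (trans (cong (λ z → suc (toℕ x) + z) (Fin.opposite-prop x)) (ℕ.m+[n∸m]≡n (Fin.toℕ<n x))))) m-even)))))

  -- The pairs at the point 0 have the odd sums 3 and n + 3. This makes the tournament alternate at
  -- 0, where the sign of an edge is the parity of its other end.
  par-reflect : ∀ x → par (toℕ (reflect x)) ≡ not (par (toℕ x))
  par-reflect 0F = refl
  par-reflect 1F = refl
  par-reflect (suc (suc x)) = cong (not ∘ not) (par-opposite x k-even)

  e : Fin (suc n) → Fin (suc n) → Bool
  e v x = sgn (toℕ v) (toℕ x)

  W : Fin n → Fin n → Bool
  W v w = par (toℕ v) xor par (toℕ w)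

  ω-W : ∀ v x → ω (suc (toℕ v)) (toℕ x) ≡ extend-false (W v) x
  ω-W v zero = refl
  ω-W v (suc x) = Bool.xor-annihilates-not (par (toℕ v)) (par (toℕ x))

  -- Points given by numbers; numbers beyond n are junk.
  pt : ℕ → Fin (suc n)
  pt x with x ℕ.<? suc n
  ... | yes x<n = fromℕ< x<n
  ... | no _ = zero

  toℕ-pt : ∀ {x} → x ≤ n → toℕ (pt x) ≡ x
  toℕ-pt {x} x≤n with x ℕ.<? suc n
  ... | yes x<n = Fin.toℕ-fromℕ< x<n
  ... | no ¬x<n = contradiction (s≤s x≤n) ¬x<n

  pt-toℕ : ∀ x → pt (toℕ x) ≡ x
  pt-toℕ x = Fin.toℕ-injective (toℕ-pt (bound x))

  pt-≢ : ∀ {x y} → x ≤ n → y ≤ n → x ≢ y → pt x ≢ pt y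
  pt-≢ x≤n y≤n x≢y e = x≢y (trans (sym (toℕ-pt x≤n)) (trans (cong toℕ e) (toℕ-pt y≤n)))

  infix 4 _~_
  _~_ : Rel (ℕ × ℕ) _
  (v , x) ~ (w , y) = EqClosure (Turn Q) (pt v , pt x) (pt w , pt y)

  flip~ : ∀ {v x} → v ≤ n → x ≤ n → v ≢ x → (v , x) ~ (x , v)
  flip~ v≤n x≤n v≢x = fwd (swap (pt-≢ v≤n x≤n v≢x)) ◅ ε

  turn≡ : ∀ {v x y} → v ≢ x → Q v x ≡ y → EqClosure (Turn Q) (v , x) (v , y)
  turn≡ ne refl = fwd (turn ne) ◅ ε

  turn~ : ∀ {v x y} → suc v ≤ n → x ≤ n → y ≤ n → suc v ≢ x → Rel′ (suc v) x y → (suc v , x) ~ (suc v , y)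
  turn~ {v} {x} {y} v≤n x≤n y≤n ne r = go (pt (suc v)) (toℕ-pt v≤n)
    where
    go : ∀ u → toℕ u ≡ suc v → EqClosure (Turn Q) (u , pt x) (u , pt y)
    go zero ()
    go (suc u) eq = turn≡ ne′ (Rel′-Q ne′ (subst (λ z → Rel′ z (toℕ (pt x)) (toℕ (pt y))) (sym eq) (subst₂ (Rel′ (suc v)) (sym (toℕ-pt x≤n)) (sym (toℕ-pt y≤n)) r)))
      where
      ne′ : suc u ≢ pt x
      ne′ e = ne (trans (sym eq) (trans (cong toℕ e) (toℕ-pt x≤n)))

  reflect~ : ∀ x y → x ≤ n → y ≤ n → (∀ i j → toℕ i ≡ x → toℕ j ≡ y → 1 ≤ x × Q zero i ≡ j) → (0 , x) ~ (0 , y)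
  reflect~ x y x≤n y≤n h = let 1≤x , eq = h (pt x) (pt y) (toℕ-pt x≤n) (toℕ-pt y≤n) in
    turn≡ (pt-≢ z≤n x≤n (ℕ.<⇒≢ 1≤x)) eq

  reflect-12 : (0 , 1) ~ (0 , 2)
  reflect-12 = reflect~ 1 2 (s≤s z≤n) (s≤s (s≤s z≤n))
    λ { (suc zero) (suc (suc zero)) refl refl → s≤s z≤n , refl }

  reflect-sum : ∀ x y → x + y ≡ 3 + n → x ≤ n → y ≤ n → (0 , x) ~ (0 , y)
  reflect-sum x y eq x≤n y≤n = reflect~ x y x≤n y≤n (go x y eq x≤n y≤n)
    where
    go : ∀ x y → x + y ≡ 3 + n → x ≤ n → y ≤ n → ∀ i j → toℕ i ≡ x → toℕ j ≡ y → 1 ≤ x × Q zero i ≡ j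
    -- If one summand is at most 2, the other exceeds n.
    go _ _ eq _ y≤n zero _ refl _ = contradiction (subst (_≤ n) eq y≤n) (ℕ.<⇒≱ (s≤s (ℕ.≤-trans (ℕ.n≤1+n n) (ℕ.n≤1+n _))))
    go _ _ eq _ y≤n (suc zero) _ refl _ = contradiction (subst (_≤ n) (ℕ.suc-injective eq) y≤n) (ℕ.<⇒≱ (s≤s (ℕ.n≤1+n n)))
    go _ _ eq _ y≤n (suc (suc zero)) _ refl _ = contradiction (subst (_≤ n) (ℕ.suc-injective (ℕ.suc-injective eq)) y≤n) (ℕ.<⇒≱ ℕ.≤-refl)
    go x _ eq x≤n _ i zero refl refl = contradiction (subst (_≤ n) (trans (sym (ℕ.+-identityʳ x)) eq) x≤n) (ℕ.<⇒≱ (s≤s (ℕ.≤-trans (ℕ.n≤1+n n) (ℕ.n≤1+n _))))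
    go x _ eq x≤n _ i (suc zero) refl refl = contradiction (subst (_≤ n) (ℕ.suc-injective (trans (sym (ℕ.+-comm x 1)) eq)) x≤n) (ℕ.<⇒≱ (s≤s (ℕ.n≤1+n n)))
    go x _ eq x≤n _ i (suc (suc zero)) refl refl = contradiction (subst (_≤ n) (ℕ.suc-injective (ℕ.suc-injective (trans (sym (ℕ.+-comm x 2)) eq))) x≤n) (ℕ.<⇒≱ ℕ.≤-refl)
    go _ _ eq _ _ (suc (suc (suc i))) (suc (suc (suc j))) refl refl = s≤s z≤n , cong (λ z → suc (suc (suc z))) (Fin.toℕ-injective (begin
      toℕ (opposite i)  ≡⟨ Fin.opposite-prop i ⟩
      k ∸ suc (toℕ i)            ≡⟨ cong (_∸ suc (toℕ i)) k≡ ⟩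
      suc (toℕ i) + toℕ j ∸ suc (toℕ i) ≡⟨ ℕ.m+n∸m≡n (suc (toℕ i)) (toℕ j) ⟩
      toℕ j ∎))
      where
      open ≡-Reasoning
      shift : ∀ a b → 3 + a + (3 + b) ≡ 5 + (1 + a + b)
      shift = solve-∀
      k≡ : k ≡ suc (toℕ i) + toℕ j
      k≡ = ℕ.+-cancelˡ-≡ 5 _ _ (trans (sym eq) (shift (toℕ i) (toℕ j)))

  -- The edge {2 + x, 3 + x + δ} is followed at its upper end by {1 + x, 3 + x + δ}, and this at its
  -- lower end by {1 + x, 2 + x + δ}. So the odd length 1 + δ recurs with both ends lowered by one,
  -- until the lower end reaches 0.
  descend : ∀ x δ → par δ ≡ false → 2 + x + δ ≤ n → (1 + x , 2 + x + δ) ~ (0 , 2 + δ)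
  descend zero δ δ-even le =
    flip~ (s≤s z≤n) le (λ ()) ◅◅
    turn~ le (s≤s z≤n) z≤n (λ ()) (down (inj₁ (s≤s (s≤s z≤n) , sym (trans (Bool.not-involutive _) δ-even))) refl) ◅◅
    flip~ le z≤n (λ ())
  descend (suc x) δ δ-even le =
    flip~ {2 + x} {3 + x + δ} (ℕ.≤-trans 2+x≤ le) le (λ e → ℕ.<⇒≢ (s≤s 2+x≤′) e) ◅◅
    turn~ {2 + x + δ} {2 + x} {1 + x} le (ℕ.≤-trans 2+x≤ le) (ℕ.≤-trans (ℕ.≤-trans (ℕ.n≤1+n _) 2+x≤) le)
      (λ e → ℕ.<⇒≢ (s≤s 2+x≤′) (sym e))
      (down (inj₁ (s≤s 2+x≤′ , cong not (trans (sym (Bool.not-involutive (par x)))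
         (cong not (sym (trans (cong not (par-+ x δ)) (cong not (trans (cong (par x xor_) δ-even) (Bool.xor-identityʳ _))))))))) refl) ◅◅
    flip~ {3 + x + δ} {1 + x} le (ℕ.≤-trans (ℕ.≤-trans (ℕ.n≤1+n _) 2+x≤) le) (λ e → ℕ.<⇒≢ (s≤s (ℕ.≤-trans (ℕ.n≤1+n _) 2+x≤′)) (sym e)) ◅◅
    turn~ {x} {3 + x + δ} {2 + x + δ} (ℕ.≤-trans (ℕ.≤-trans (ℕ.n≤1+n _) 2+x≤) le) le (ℕ.≤-trans (ℕ.n≤1+n _) le)
      (λ e → ℕ.<⇒≢ (s≤s (ℕ.≤-trans (ℕ.n≤1+n _) 2+x≤′)) e)
      (down (inj₂ (s≤s (s≤s (ℕ.m≤m+n x δ)) , le ,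
        cong (not ∘ not) (trans (par-+ x δ) (trans (cong (par x xor_) δ-even) (Bool.xor-identityʳ _))))) refl) ◅◅
    descend x δ δ-even (ℕ.≤-trans (ℕ.n≤1+n _) le)
    where
    2+x≤′ : 2 + x ≤ 2 + x + δ
    2+x≤′ = ℕ.m≤m+n (2 + x) δ
    2+x≤ : 2 + x ≤ 3 + x + δ
    2+x≤ = ℕ.≤-trans 2+x≤′ (ℕ.n≤1+n _)

  n-even : par n ≡ false
  n-even = trans (Bool.not-involutive _) k-even

  par-double-suc : ∀ x → par (2 + x) ≡ false → par x ≡ false
  par-double-suc x e = trans (sym (Bool.not-involutive _)) e

  -- Descending from {1 + x, n}, which is matched with {1 + x, 0} at 1 + x.
  across : ∀ x δ → par x ≡ false → 2 + x + δ ≡ n → (0 , 1 + x) ~ (0 , 2 + δ)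
  across x δ x-even eq =
    flip~ z≤n 1+x≤n (λ ()) ◅◅
    turn~ 1+x≤n z≤n ℕ.≤-refl (λ ()) (wrapˡ (cong not x-even) refl refl) ◅◅
    subst (λ z → (1 + x , z) ~ (0 , 2 + δ)) eq (descend x δ δ-even (ℕ.≤-reflexive eq))
    where
    1+x≤n : 1 + x ≤ n
    1+x≤n = subst (1 + x ≤_) eq (s≤s (ℕ.≤-trans (ℕ.n≤1+n x) (s≤s (ℕ.m≤m+n x δ))))
    δ-even : par δ ≡ false
    δ-even = trans (cong (_xor par δ) (sym x-even)) (trans (sym (par-+ x δ)) (par-double-suc (x + δ) (trans (cong par eq) n-even)))

  -- The pairing at 0 takes y to n + 3 - y, and the strand of `across` takes it on to the point
  -- complementing it to n + 1. Together they lower an even y by two, until 2 is reached, whose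
  -- partner at 0 is 1.
  even-base : ∀ δ → par δ ≡ false → 2 + δ ≤ n → (0 , 2 + δ) ~ (0 , 1)
  even-base 0 _ _ = EqC.symmetric _ reflect-12
  even-base 1 ()
  even-base (suc (suc δ)) δ-even le =
    reflect-sum (4 + δ) (1 + x) (trans (shift δ x) (cong (λ z → 3 + z) eq)) le 1+x≤n ◅◅
    across x δ x-even eq ◅◅
    even-base δ (par-double-suc δ δ-even) (ℕ.≤-trans (ℕ.≤-trans (ℕ.n≤1+n _) (ℕ.n≤1+n _)) le)
    where
    x : ℕ
    x = n ∸ (2 + δ)
    shift : ∀ δ x → 4 + δ + (1 + x) ≡ 3 + (2 + x + δ)
    shift = solve-∀
    comm : ∀ δ x → 2 + x + δ ≡ x + (2 + δ)
    comm = solve-∀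
    eq : 2 + x + δ ≡ n
    eq = trans (comm δ x) (ℕ.m∸n+n≡m (ℕ.≤-trans (ℕ.≤-trans (ℕ.n≤1+n _) (ℕ.n≤1+n _)) le))
    1+x≤n : 1 + x ≤ n
    1+x≤n = subst (1 + x ≤_) eq (s≤s (ℕ.≤-trans (ℕ.n≤1+n x) (s≤s (ℕ.m≤m+n x δ))))
    x-even : par x ≡ false
    x-even = trans (sym (Bool.xor-identityʳ _)) (trans (cong (par x xor_) (sym (par-double-suc δ δ-even)))
      (trans (sym (par-+ x δ)) (par-double-suc (x + δ) (trans (cong par eq) n-even))))

  odd-base : ∀ x → par x ≡ false → 1 + x ≤ n → (0 , 1 + x) ~ (0 , 1)
  odd-base x x-even le = across x δ x-even eq ◅◅ even-base δ δ-even (subst (2 + δ ≤_) (trans (comm x δ) eq) (ℕ.m≤m+n (2 + δ) x))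
    where
    2+x≤n : 2 + x ≤ n
    2+x≤n = ℕ.≤∧≢⇒< le (λ e → contradiction (trans (sym n-even) (trans (cong par (sym e)) (cong not x-even))) λ ())
    δ : ℕ
    δ = n ∸ (2 + x)
    eq : 2 + x + δ ≡ n
    eq = ℕ.m+[n∸m]≡n 2+x≤n
    comm : ∀ x δ → 2 + δ + x ≡ 2 + x + δ
    comm = solve-∀
    δ-even : par δ ≡ false
    δ-even = trans (cong (_xor par δ) (sym x-even)) (trans (sym (par-+ x δ)) (par-double-suc (x + δ) (trans (cong par eq) n-even)))

  zero-base : ∀ y → 1 + y ≤ n → (0 , 1 + y) ~ (0 , 1)
  zero-base y le with par y in eq
  ... | false = odd-base y eq le
  zero-base (suc y) le | true = even-base y (Bool.not-injective eq) le

  odd-length : ∀ x δ → par δ ≡ false → 1 + x + δ ≤ n → (x , 1 + x + δ) ~ (0 , 1)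
  odd-length zero δ δ-even le = zero-base δ le
  odd-length (suc x) δ δ-even le = descend x δ δ-even le ◅◅
    zero-base (1 + δ) (ℕ.≤-trans (s≤s (s≤s (ℕ.m≤n+m δ x))) le)

  -- One turn at the upper end raises the lower end by one, which makes the length odd.
  even-length : ∀ x δ → par δ ≡ true → 1 + x + δ ≤ n → (x , 1 + x + δ) ~ (0 , 1)
  even-length x zero () le
  even-length x (suc δ) δ-odd le = subst (λ y → (x , y) ~ (0 , 1)) (sym (cong suc (ℕ.+-suc x δ))) (go (subst (_≤ n) (cong suc (ℕ.+-suc x δ)) le))
    where
    δ-even : par δ ≡ false
    δ-even = Bool.not-injective δ-odd
    go : 2 + x + δ ≤ n → (x , 2 + x + δ) ~ (0 , 1)
    go le =
      flip~ {x} {2 + x + δ} x≤n le (λ e → ℕ.<⇒≢ x<′ e) ◅◅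
      turn~ {1 + x + δ} {x} {1 + x} le x≤n (ℕ.≤-trans (s≤s (ℕ.≤-trans (ℕ.m≤m+n x δ) (ℕ.n≤1+n _))) le) (λ e → ℕ.<⇒≢ x<′ (sym e))
        (up (inj₁ (s≤s (s≤s (ℕ.m≤m+n x δ)) ,
           trans (sym (Bool.xor-identityʳ _)) (trans (cong (par x xor_) (sym δ-even)) (trans (sym (par-+ x δ)) (sym (Bool.not-involutive _)))))) refl) ◅◅
      flip~ {2 + x + δ} {1 + x} le (ℕ.≤-trans (s≤s (ℕ.≤-trans (ℕ.m≤m+n x δ) (ℕ.n≤1+n _))) le) (λ e → ℕ.<⇒≢ (s≤s (s≤s (ℕ.m≤m+n x δ))) (sym e)) ◅◅
      odd-length (1 + x) δ δ-even le
      where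
      x<′ : x < 2 + x + δ
      x<′ = s≤s (ℕ.≤-trans (ℕ.m≤m+n x δ) (ℕ.n≤1+n _))
      x≤n : x ≤ n
      x≤n = ℕ.≤-trans (ℕ.<⇒≤ x<′) le

  ascending : ∀ x y → x < y → y ≤ n → (x , y) ~ (0 , 1)
  ascending x y x<y y≤n = subst (λ y → (x , y) ~ (0 , 1)) eq (go (par δ) refl)
    where
    δ : ℕ
    δ = y ∸ suc x
    eq : 1 + x + δ ≡ y
    eq = ℕ.m+[n∸m]≡n x<y
    le : 1 + x + δ ≤ n
    le = subst (_≤ n) (sym eq) y≤n
    go : ∀ b → par δ ≡ b → (x , 1 + x + δ) ~ (0 , 1)
    go false δ-even = odd-length x δ δ-even le
    go true δ-odd = even-length x δ δ-odd le

  base : ∀ x y → x ≤ n → y ≤ n → x ≢ y → (x , y) ~ (0 , 1)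
  base x y x≤n y≤n x≢y with ℕ.<-cmp x y
  ... | tri< x<y _ _ = ascending x y x<y y≤n
  ... | tri≈ _ e _ = contradiction e x≢y
  ... | tri> _ _ y<x = flip~ x≤n y≤n x≢y ◅◅ ascending y x y<x x≤n

  Q-joined : ∀ {v x w y} → v ≢ x → w ≢ y → EqClosure (Turn Q) (v , x) (w , y)
  Q-joined {v} {x} {w} {y} v≢x w≢y = toBase v x v≢x ◅◅ EqC.symmetric _ (toBase w y w≢y)
    where
    toBase : ∀ v x → v ≢ x → EqClosure (Turn Q) (v , x) (pt 0 , pt 1)
    toBase v x ne = subst₂ (λ a b → EqClosure (Turn Q) (a , b) (pt 0 , pt 1)) (pt-toℕ v) (pt-toℕ x)
      (base (toℕ v) (toℕ x) (bound v) (bound x) (toℕ-≢ ne))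

  circuit : Circuit n
  circuit = record
    { Q = Q
    ; Q-fresh = fresh
    ; Q-moves = moves
    ; Q-inv = inv
    ; Q-joined = Q-joined
    ; e = e
    ; e-anti = sgn-anti ∘ toℕ-≢
    ; e-Q = sign
    ; W = W
    ; W-sym = λ v w → Bool.xor-comm (par (toℕ w)) (par (toℕ v))
    ; W-Q = λ {v} {x} ne → trans (sym (ω-W v (Q (suc v) x))) (trans (ω-Rel′ (Q-Rel′ ne)) (cong not (ω-W v x)))
    }
    where
    fresh : ∀ {v x} → v ≢ x → v ≢ Q v x
    fresh {zero} {zero} ne = contradiction refl ne
    fresh {zero} {suc x} ne ()
    fresh {suc v} ne e = Rel′-≢v (Q-Rel′ ne) (cong toℕ e)
    moves : ∀ {v x} → v ≢ x → Q v x ≢ x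
    moves {zero} {zero} ne = contradiction refl ne
    moves {zero} {suc x} ne e = not-≢ (trans (sym (par-reflect x)) (cong (par ∘ toℕ) (Fin.suc-injective e)))
    moves {suc v} ne e = Rel′-≢ (Q-Rel′ ne) (cong toℕ e)
    inv : ∀ {v x} → v ≢ x → Q v (Q v x) ≡ x
    inv {zero} {zero} ne = contradiction refl ne
    inv {zero} {suc x} ne = cong suc (reflect-involutive x)
    inv {suc v} ne = Rel′-Q (fresh ne) (Rel′-sym (Q-Rel′ ne))
    sign : ∀ {v x} → v ≢ x → e v (Q v x) ≡ not (e v x)
    sign {zero} {zero} ne = contradiction refl ne
    sign {zero} {suc x} ne = trans (cong (λ b → not b xor false) (par-reflect x)) (lemma (par (toℕ x)))
      where
      lemma : ∀ b → not (not b) xor false ≡ not (not b xor false)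
      lemma false = refl
      lemma true = refl
    sign {suc v} ne = sgn-Rel′ (bound (suc v)) (Q-Rel′ ne)

-- Designs on every even number of points

distinct? : ∀ {n} (v w x : Fin n) → Dec (Distinct v w x)
distinct? v w x with v Fin.≟ w | v Fin.≟ x | w Fin.≟ x
... | no a | no b | no c = yes (distinct a b c)
... | yes e | _ | _ = no λ d → Distinct.v≢w d e
... | no _ | yes e | _ = no λ d → Distinct.v≢x d e
... | no _ | no _ | yes e = no λ d → Distinct.w≢x d e

module Tetrahedron where

  -- Bitwise exclusive or, so that the fourth point is the sum of the other three.
  infixr 6 _⊕_
  _⊕_ : Fin 4 → Fin 4 → Fin 4
  0F ⊕ y  = y
  1F ⊕ 0F = 1F
  1F ⊕ 1F = 0F
  1F ⊕ 2F = 3F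
  1F ⊕ 3F = 2F
  2F ⊕ 0F = 2F
  2F ⊕ 1F = 3F
  2F ⊕ 2F = 0F
  2F ⊕ 3F = 1F
  3F ⊕ 0F = 3F
  3F ⊕ 1F = 2F
  3F ⊕ 2F = 1F
  3F ⊕ 3F = 0F

  fourth : Fin 4 → Fin 4 → Fin 4 → Fin 4
  fourth v w x = v ⊕ w ⊕ x

  all₃? : {P : Fin 4 → Fin 4 → Fin 4 → Set} → (∀ v w x → Dec (P v w x)) → Dec (∀ v w x → P v w x)
  all₃? P? = Fin.all? λ v → Fin.all? λ w → Fin.all? λ x → P? v w x

  fourth-sym : ∀ v w x → fourth w v x ≡ fourth v w x
  fourth-sym = from-yes (all₃? λ v w x → fourth w v x Fin.≟ fourth v w x)

  fourth-inv : ∀ v w x → fourth v w (fourth v w x) ≡ x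
  fourth-inv = from-yes (all₃? λ v w x → fourth v w (fourth v w x) Fin.≟ x)

  fourth-fresh : ∀ v w x → Distinct v w x → Distinct v w (fourth v w x)
  fourth-fresh = from-yes (all₃? λ v w x → distinct? v w x →-dec distinct? v w (fourth v w x))

  fourth-moves : ∀ v w x → Distinct v w x → fourth v w x ≢ x
  fourth-moves = from-yes (all₃? λ v w x → distinct? v w x →-dec ¬? (fourth v w x Fin.≟ x))

  fourth-unique : ∀ v w x → Distinct v w x → ∀ y → Distinct v w y → x ≢ y → fourth v w x ≡ y
  fourth-unique = from-yes (all₃? λ v w x → distinct? v w x →-dec
    Fin.all? λ y → distinct? v w y →-dec (¬? (x Fin.≟ y) →-dec (fourth v w x Fin.≟ y)))

  module _ {v : Fin 4} where

    infix 4 _~_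
    _~_ : Rel (Fin 4 × Fin 4) _
    _~_ = EqClosure (Move fourth v)

    turn-to : ∀ {w x y} → Distinct v w x → Distinct v w y → (w , x) ~ (w , y)
    turn-to {w} {x} {y} d d′ with x Fin.≟ y
    ... | yes refl = ε
    ... | no x≢y = subst (λ z → (w , x) ~ (w , z)) (fourth-unique v w x d y d′ x≢y) (fwd (turn d) ◅ ε)

    any-to : ∀ {w x y z} → Distinct v w x → Distinct v y z → (w , x) ~ (y , z)
    any-to {w} {x} {y} d d′ with w Fin.≟ y
    ... | yes refl = turn-to d d′
    ... | no w≢y = turn-to d e ◅◅ fwd (swap e) ◅ turn-to (distinct (Distinct.v≢w d′) (Distinct.v≢w d) (w≢y ∘ sym)) d′
      where
      e : Distinct v w y
      e = distinct (Distinct.v≢w d) (Distinct.v≢w d′) w≢y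

  -- Each pair of points has one quadrilateral, and the six of them form the boundary of a cube,
  -- with points and triples as alternate corners.
  design : Design 4
  design = record
    { m = fourth
    ; m-sym = λ {v} {w} {x} _ → fourth-sym v w x
    ; fresh = fourth-fresh _ _ _
    ; moves = fourth-moves _ _ _
    ; m-inv = λ {v} {w} {x} _ → fourth-inv v w x
    ; joined = any-to
    }

  -- Up to a constant this is the parity of the permutation a, b, c, d of the four points. The sum a
  -- + b + c accounts for d: it is 6 - d, and 3 - d of the points exceed d.
  sign : Fin 4 → Fin 4 → Fin 4 → Bool
  sign a b c = par (toℕ a + toℕ b + toℕ c) xor inverted a b xor inverted a c xor inverted b c
    where
    inverted : Fin 4 → Fin 4 → Bool
    inverted x y = does (toℕ y ℕ.<? toℕ x)

  sign-laws : ∀ a b c → Distinct a b c →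
    sign b a c ≡ not (sign a b c) × sign a c b ≡ not (sign a b c) × sign a b (fourth a b c) ≡ not (sign a b c)
  sign-laws = from-yes (all₃? λ a b c → distinct? a b c →-dec
    ((sign b a c Bool.≟ not (sign a b c)) ×-dec (sign a c b Bool.≟ not (sign a b c)) ×-dec (sign a b (fourth a b c) Bool.≟ not (sign a b c))))

  orientation : Design.Orientation design
  orientation = (λ t → sign (Triple.a t) (Triple.b t) (Triple.c t)) ,
    (λ { 0F t → proj₁ (laws t) ; 1F t → proj₁ (proj₂ (laws t)) }) , (λ t → proj₂ (proj₂ (laws t)))
    where
    laws : ∀ t → _
    laws t = sign-laws (Triple.a t) (Triple.b t) (Triple.c t) (distinctTriple t)

third : ∀ {k} → Fin (4 + k) → Fin (4 + k) → Fin (4 + k)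
third (suc _)       (suc _)       = 0F
third zero          (suc zero)    = 2F
third zero          zero          = 1F
third zero          (suc (suc _)) = 1F
third (suc zero)    zero          = 2F
third (suc (suc _)) zero          = 1F

third-sym : ∀ {k} (v w : Fin (4 + k)) → third w v ≡ third v w
third-sym (suc _)       (suc _)       = refl
third-sym zero          (suc zero)    = refl
third-sym zero          zero          = refl
third-sym zero          (suc (suc _)) = refl
third-sym (suc zero)    zero          = refl
third-sym (suc (suc _)) zero          = refl

third-fresh : ∀ {k} {v w : Fin (4 + k)} → v ≢ w → Distinct v w (third v w)
third-fresh {v = suc _}       {suc _}       ne = distinct ne (λ ()) (λ ())
third-fresh {v = zero}        {suc zero}    ne = distinct ne (λ ()) (λ ())
third-fresh {v = zero}        {zero}        ne = contradiction refl ne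
third-fresh {v = zero}        {suc (suc _)} ne = distinct ne (λ ()) (λ ())
third-fresh {v = suc zero}    {zero}        ne = distinct ne (λ ()) (λ ())
third-fresh {v = suc (suc _)} {zero}        ne = distinct ne (λ ()) (λ ())

par-double : ∀ k → par (k * 2) ≡ false
par-double zero = refl
par-double (suc k) = trans (Bool.not-involutive _) (par-double k)

circuit : ∀ k → Circuit (4 + k * 2)
circuit k = RotationalCircuit.circuit (2 + k * 2) (par-double (suc k))

module OrientableStep {k : ℕ} (D : Design (4 + k)) (o : Design.Orientation D) (E : Circuit (4 + k)) where

  open Design D
  open Circuit E using (e; e-anti; W)

  private
    s : Triple (4 + k) → Bool
    s = proj₁ o

  -- The triples formed by v and w with `third v w` and with its matched point have opposite signs,
  -- so exactly one of these two points fits the tournament `e`.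
  choose : Bool → Fin (4 + k) → Fin (4 + k) → Fin (4 + k)
  choose true v w = third v w
  choose false v w = m v w (third v w)

  agrees : ∀ {v w} → v ≢ w → Bool
  agrees {v} {w} v≢w = s (triple (third-fresh v≢w)) xor e (suc v) (suc w)

  choice : ∀ v w → Dec (v ≡ w) → Fin (4 + k)
  choice v w (yes _) = third v w
  choice v w (no v≢w) = choose (agrees v≢w) v w

  p : Fin (4 + k) → Fin (4 + k) → Fin (4 + k)
  p v w = choice v w (v Fin.≟ w)

  -- Exchanging v and w reverses both the sign of the triple and the direction of the edge, so both
  -- orders lead to the same choice.
  agrees-sym : ∀ {v w} (v≢w : v ≢ w) (w≢v : w ≢ v) → agrees w≢v ≡ agrees v≢w
  agrees-sym {v} {w} v≢w w≢v = trans (cong₂ _xor_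
    (trans (triple-cong (third-fresh w≢v) (distinct w≢v (Distinct.w≢x (third-fresh v≢w)) (Distinct.v≢x (third-fresh v≢w))) (third-sym v w)) (proj₁ (proj₂ o) 0F (triple (third-fresh v≢w))))
    (e-anti (v≢w ∘ Fin.suc-injective))) (Bool.xor-annihilates-not (s (triple (third-fresh v≢w))) (e (suc v) (suc w)))
    where
    triple-cong : ∀ {v w x y : Fin (4 + k)} (d : Distinct v w x) (d′ : Distinct v w y) → x ≡ y → s (triple d) ≡ s (triple d′)
    triple-cong d d′ refl = refl

  p-sym : ∀ v w → p w v ≡ p v w
  p-sym v w = go (w Fin.≟ v) (v Fin.≟ w)
    where
    go : ∀ d d′ → choice w v d ≡ choice v w d′
    go (yes refl) (yes _) = refl
    go (yes refl) (no ne) = contradiction refl ne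
    go (no ne) (yes refl) = contradiction refl ne
    go (no w≢v) (no v≢w) with agrees w≢v | agrees v≢w | agrees-sym v≢w w≢v
    ... | true | true | refl = third-sym v w
    ... | false | false | refl = trans (cong (m w v) (third-sym v w)) (m-sym (third-fresh v≢w))

  p-fresh : ∀ {v w} → v ≢ w → Distinct v w (p v w)
  p-fresh {v} {w} v≢w = go (v Fin.≟ w)
    where
    go : ∀ d → Distinct v w (choice v w d)
    go (yes v≡w) = contradiction v≡w v≢w
    go (no ne) with agrees ne
    ... | true = third-fresh v≢w
    ... | false = fresh (third-fresh v≢w)

  compatible : ∀ {v w} (v≢w : v ≢ w) → W v w ≡ true → s (triple (p-fresh v≢w)) ≡ not (e (suc v) (suc w))
  compatible {v} {w} v≢w _ = go (v Fin.≟ w) (p-fresh v≢w)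
    where
    agree : ∀ x y b → x xor y ≡ b → (if b then x else not x) ≡ not y
    agree false y .y refl = lemma y
      where
      lemma : ∀ y → (if y then false else true) ≡ not y
      lemma false = refl
      lemma true = refl
    agree true false .true refl = refl
    agree true true .false refl = refl
    go : ∀ d (D : Distinct v w (choice v w d)) → s (triple D) ≡ not (e (suc v) (suc w))
    go (yes v≡w) _ = contradiction v≡w v≢w
    go (no ne) with agrees ne in eq
    ... | true = λ _ → agree (s (triple (third-fresh ne))) _ true eq
    ... | false = λ _ → trans (proj₂ (proj₂ o) (triple (third-fresh ne))) (agree (s (triple (third-fresh ne))) _ false eq)

  design : Design (6 + k)
  design = Extend.extended D E p p-sym p-fresh

  orientation : Design.Orientation design
  orientation = ExtendOrientation.extendOrientation D E p p-sym p-fresh s (proj₁ (proj₂ o)) (proj₂ (proj₂ o)) compatible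

orientableDesign : ∀ k → Σ (Design (4 + k * 2)) Design.Orientation
orientableDesign zero = Tetrahedron.design , Tetrahedron.orientation
orientableDesign (suc k) = OrientableStep.design D o (circuit k) , OrientableStep.orientation D o (circuit k)
  where
  D = proj₁ (orientableDesign k)
  o = proj₂ (orientableDesign k)

module SixPoints where

  -- The choice 2 for {0, 1} would give an orientable surface.
  p : Fin 4 → Fin 4 → Fin 4
  p 0F 1F = 3F
  p 1F 0F = 3F
  p v  w  = third v w

  p-sym : ∀ v w → p w v ≡ p v w
  p-sym = from-yes (Fin.all? λ v → Fin.all? λ w → p w v Fin.≟ p v w)

  p-fresh : ∀ {v w} → v ≢ w → Distinct v w (p v w)
  p-fresh = from-yes (Fin.all? λ v → Fin.all? λ w → ¬? (v Fin.≟ w) →-dec distinct? v w (p v w)) _ _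

  design : Design 6
  design = Extend.extended Tetrahedron.design (circuit 0) p p-sym p-fresh

  ⟨_,_,_⟩ : (a b c : Fin 6) {_ : True (distinct? a b c)} → Triple 6
  ⟨ a , b , c ⟩ {d} = triple (toWitness d)

  -- There is a closed chain of thirteen adjacent triangles.
  nonorientable : ¬ Design.Orientation design
  nonorientable (s , ex , flip) = not-≢ (trans (sym (flip ⟨ 0F , 1F , 3F ⟩)) twelve)
    where
    twice : ∀ {x y z} → y ≡ not x → z ≡ not y → z ≡ x
    twice refl refl = Bool.not-involutive _
    twelve : s ⟨ 0F , 1F , 2F ⟩ ≡ s ⟨ 0F , 1F , 3F ⟩
    twelve = sym (trans (twice (flip ⟨ 0F , 3F , 2F ⟩) (ex 1F ⟨ 0F , 3F , 1F ⟩))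
      (trans (twice (ex 1F ⟨ 3F , 2F , 0F ⟩) (ex 0F ⟨ 3F , 0F , 2F ⟩))
      (trans (twice (ex 0F ⟨ 2F , 3F , 5F ⟩) (flip ⟨ 3F , 2F , 5F ⟩))
      (trans (twice (flip ⟨ 2F , 5F , 0F ⟩) (ex 1F ⟨ 2F , 5F , 3F ⟩))
      (trans (twice (flip ⟨ 2F , 0F , 1F ⟩) (ex 1F ⟨ 2F , 0F , 5F ⟩))
      (twice (ex 1F ⟨ 0F , 1F , 2F ⟩) (ex 0F ⟨ 0F , 2F , 1F ⟩)))))))

-- An orientation of any extension would restrict, step by step, to the six points.
nonorientableDesign : ∀ k → Σ (Design (6 + k * 2)) λ D → ¬ Design.Orientation D
nonorientableDesign zero = SixPoints.design , SixPoints.nonorientable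
nonorientableDesign (suc k) =
  Extend.extended D (circuit (suc k)) third third-sym third-fresh ,
  proj₂ (nonorientableDesign k) ∘ ExtendOrientation.restrict D (circuit (suc k)) third third-sym third-fresh
  where
  D = proj₁ (nonorientableDesign k)

-- The genus

-- The number k (k + 1) (2k + 7) / 6, belonging to 4 + 2k points, given by its increments so that no
-- division occurs.
genus : ℕ → ℕ
genus zero    = 0
genus (suc k) = genus k + (1 + k) * (3 + k)

genus-formula : ∀ k → 24 * genus k ≡ (2 + k * 2) * (4 + k * 2 + 3) * (k * 2)
genus-formula zero = refl
genus-formula (suc k) = begin
  24 * (genus k + (1 + k) * (3 + k))             ≡⟨ ℕ.*-distribˡ-+ 24 (genus k) _ ⟩
  24 * genus k + 24 * ((1 + k) * (3 + k))        ≡⟨ cong (λ z → z + 24 * ((1 + k) * (3 + k))) (genus-formula k) ⟩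
  (2 + k * 2) * (4 + k * 2 + 3) * (k * 2) + 24 * ((1 + k) * (3 + k)) ≡⟨ lemma k ⟩
  (2 + (2 + k * 2)) * (4 + (2 + k * 2) + 3) * (2 + k * 2) ∎
  where
  open ≡-Reasoning
  lemma : ∀ k → (2 + k * 2) * (4 + k * 2 + 3) * (k * 2) + 24 * ((1 + k) * (3 + k)) ≡ (2 + (2 + k * 2)) * (4 + (2 + k * 2) + 3) * (2 + k * 2)
  lemma = solve-∀

χ-from : ∀ V E F x → V + F + x ≡ E + 2 → + V ℤ.- + E ℤ.+ + F ≡ + 2 ℤ.- + x
χ-from V E F x eq = begin
  + V ℤ.- + E ℤ.+ + F                              ≡⟨ rearrange (+ V) (+ E) (+ F) (+ x) ⟩
  (+ V ℤ.+ + F ℤ.+ + x) ℤ.- + E ℤ.- + x            ≡⟨ cong (λ z → z ℤ.- + E ℤ.- + x) (cong +_ eq) ⟩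
  (+ E ℤ.+ + 2) ℤ.- + E ℤ.- + x                    ≡⟨ cancel (+ E) (+ x) ⟩
  + 2 ℤ.- + x                                      ∎
  where
  open ≡-Reasoning
  rearrange : ∀ V E F x → V ℤ.- E ℤ.+ F ≡ (V ℤ.+ F ℤ.+ x) ℤ.- E ℤ.- x
  rearrange = ℤ-Solver.solve-∀
  cancel : ∀ E x → (E ℤ.+ + 2) ℤ.- E ℤ.- x ≡ + 2 ℤ.- x
  cancel = ℤ-Solver.solve-∀

χ-to : ∀ V E F x → + V ℤ.- + E ℤ.+ + F ≡ + 2 ℤ.- + x → V + F + x ≡ E + 2
χ-to V E F x eq = ℤ.+-injective (begin
  + V ℤ.+ + F ℤ.+ + x                              ≡⟨ rearrange (+ V) (+ E) (+ F) (+ x) ⟩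
  (+ V ℤ.- + E ℤ.+ + F) ℤ.+ + E ℤ.+ + x            ≡⟨ cong (λ z → z ℤ.+ + E ℤ.+ + x) eq ⟩
  (+ 2 ℤ.- + x) ℤ.+ + E ℤ.+ + x                    ≡⟨ cancel (+ E) (+ x) ⟩
  + E ℤ.+ + 2                                      ∎)
  where
  open ≡-Reasoning
  rearrange : ∀ V E F x → V ℤ.+ F ℤ.+ x ≡ (V ℤ.- E ℤ.+ F) ℤ.+ E ℤ.+ x
  rearrange = ℤ-Solver.solve-∀
  cancel : ∀ E x → (+ 2 ℤ.- x) ℤ.+ E ℤ.+ x ≡ E ℤ.+ + 2
  cancel = ℤ-Solver.solve-∀

module Genus (k : ℕ) where

  n : ℕ
  n = 4 + k * 2

  triangles : ∃ (Classes (Reordered {n}))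
  triangles = triples Triple↔

  t : ℕ
  t = proj₁ triangles

  t-count : (4 + k * 2) * ((3 + k * 2) * (2 + k * 2)) ≡ t * 6
  t-count = triple-count Triple↔ (proj₂ triangles)

  t≥1 : 1 ≤ t
  t≥1 = positive t t-count
    where
    positive : ∀ t → (4 + k * 2) * ((3 + k * 2) * (2 + k * 2)) ≡ t * 6 → 1 ≤ t
    positive zero ()
    positive (suc t) _ = s≤s z≤n

  -- The only place where the closed formula meets the number of triples: 2n - t, the bound for
  -- twice the Euler characteristic, equals 4 - 4g.
  t-genus : 4 + t ≡ 2 * n + 4 * genus k
  t-genus = ℕ.*-cancelʳ-≡ _ _ 6 (begin
    (4 + t) * 6                                       ≡⟨ ℕ.*-distribʳ-+ 6 4 t ⟩
    24 + t * 6                                        ≡⟨ cong (λ z → 24 + z) (sym t-count) ⟩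
    24 + (4 + k * 2) * ((3 + k * 2) * (2 + k * 2))    ≡⟨ lemma k ⟩
    12 * (4 + k * 2) + (2 + k * 2) * (4 + k * 2 + 3) * (k * 2) ≡⟨ cong (λ z → 12 * n + z) (sym (genus-formula k)) ⟩
    12 * n + 24 * genus k                             ≡⟨ collect n (genus k) ⟩
    (2 * n + 4 * genus k) * 6                         ∎)
    where
    open ≡-Reasoning
    lemma : ∀ k → 24 + (4 + k * 2) * ((3 + k * 2) * (2 + k * 2)) ≡ 12 * (4 + k * 2) + (2 + k * 2) * (4 + k * 2 + 3) * (k * 2)
    lemma = solve-∀
    collect : ∀ n g → 12 * n + 24 * g ≡ (2 * n + 4 * g) * 6
    collect = solve-∀

  -- Orientability plays no part in the inequality, so x stands for 2h on an orientable surface and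
  -- for the number of crosscaps otherwise.
  lower-bound : (M : CellSurface) → Levi (completeUniform 3 n) ↪ M → ∀ x → CellSurface.χ M ≡ + 2 ℤ.- + x → 2 * genus k ≤ x
  lower-bound M emb x χ≡ = ℕ.*-cancelˡ-≤ 2 (ℕ.+-cancelˡ-≤ (2 * n) _ _ (begin
    2 * n + 2 * (2 * genus k)     ≡⟨ assoc n (genus k) ⟩
    2 * n + 4 * genus k           ≡⟨ sym t-genus ⟩
    4 + t                         ≤⟨ ℕ.+-cancelˡ-≤ (2 * E + 2 * t) _ _ (begin
      2 * E + 2 * t + (4 + t)             ≡⟨ lemma₁ E t ⟩
      2 * (E + 2) + t * 3                 ≡⟨ cong (λ z → 2 * z + t * 3) (sym (χ-to V E F x χ≡)) ⟩
      2 * (V + F + x) + t * 3             ≡⟨ lemma₂ (V + F) x t ⟩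
      2 * (V + F) + t * 3 + 2 * x         ≤⟨ ℕ.+-monoˡ-≤ (2 * x) (levi-bound (proj₂ triangles) t≥1 M emb) ⟩
      2 * (E + (n + t)) + 2 * x           ≡⟨ lemma₃ E n t x ⟩
      2 * E + 2 * t + (2 * n + 2 * x)     ∎) ⟩
    2 * n + 2 * x                 ∎))
    where
    open ℕ.≤-Reasoning
    V E F : ℕ
    V = CellSurface.#cells M 0F
    E = CellSurface.#cells M 1F
    F = CellSurface.#cells M 2F
    assoc : ∀ n g → 2 * n + 2 * (2 * g) ≡ 2 * n + 4 * g
    assoc = solve-∀
    lemma₁ : ∀ E t → 2 * E + 2 * t + (4 + t) ≡ 2 * (E + 2) + t * 3
    lemma₁ = solve-∀
    lemma₂ : ∀ a x t → 2 * (a + x) + t * 3 ≡ 2 * a + t * 3 + 2 * x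
    lemma₂ = solve-∀
    lemma₃ : ∀ E n t x → 2 * (E + (n + t)) + 2 * x ≡ 2 * E + 2 * t + (2 * n + 2 * x)
    lemma₃ = solve-∀

  module _ (D : Design n) where

    open Surface D (proj₂ triangles)

    -- V = n + t, E = 3t and 2F = 3t give 2χ = 2n - t, the case of equality in `lower-bound`.
    χ-surface : CellSurface.χ surface ≡ + 2 ℤ.- + (2 * genus k)
    χ-surface = χ-from (n + t) E F (2 * genus k) (ℕ.*-cancelˡ-≡ _ _ 2 (begin
      2 * (n + t + F + 2 * genus k)                   ≡⟨ lemma₁ n t F (genus k) ⟩
      2 * n + 4 * genus k + 2 * t + 2 * F             ≡⟨ cong₂ (λ a b → a + 2 * t + b) (sym t-genus) face-count ⟩
      4 + t + 2 * t + t * 3                           ≡⟨ lemma₂ t ⟩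
      2 * (t * 3 + 2)                                 ≡⟨ cong (λ z → 2 * (z + 2)) (sym edge-count) ⟩
      2 * (E + 2)                                     ∎))
      where
      open ≡-Reasoning
      E F : ℕ
      E = CellSurface.#cells surface 1F
      F = CellSurface.#cells surface 2F
      lemma₁ : ∀ n t F g → 2 * (n + t + F + 2 * g) ≡ 2 * n + 4 * g + 2 * t + 2 * F
      lemma₁ = solve-∀
      lemma₂ : ∀ t → 4 + t + 2 * t + t * 3 ≡ 2 * (t * 3 + 2)
      lemma₂ = solve-∀

    embedsInOrientable : Design.Orientation D → EmbedsInOrientable (Levi (completeUniform 3 n)) (genus k)
    embedsInOrientable o = surface , (orientable o , χ-surface) , embedding

    embedsInNonOrientable : ¬ Design.Orientation D → 1 ≤ genus k → EmbedsInNonOrientable (Levi (completeUniform 3 n)) (2 * genus k)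
    embedsInNonOrientable ¬o 1≤g = surface , (ℕ.≤-trans 1≤g (ℕ.m≤m+n (genus k) _) , ¬o ∘ orientation , χ-surface) , embedding

  orientable-bound : ∀ h → EmbedsInOrientable (Levi (completeUniform 3 n)) h → genus k ≤ h
  orientable-bound h (M , (_ , χ≡) , emb) = ℕ.*-cancelˡ-≤ 2 (lower-bound M emb (2 * h) χ≡)

  hasGenus : HypergraphHasGenus (completeUniform 3 n) (genus k)
  hasGenus = embedsInOrientable (proj₁ (orientableDesign k)) (proj₂ (orientableDesign k)) , orientable-bound

hasNonOrientableGenus : ∀ k → HypergraphHasNonOrientableGenus (completeUniform 3 (6 + k * 2)) (2 * genus (suc k))
hasNonOrientableGenus k = inj₂ (nonplanar ,
  embedsInNonOrientable (proj₁ (nonorientableDesign k)) (proj₂ (nonorientableDesign k)) positive ,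
  λ { c (M , (_ , _ , χ≡) , emb) → lower-bound M emb c χ≡ })
  where
  open Genus (suc k)
  positive : 1 ≤ genus (suc k)
  positive = ℕ.m≤n⇒m≤o+n (genus k) (s≤s z≤n)
  -- From six points on the orientable bound is positive, which excludes the convention for planar
  -- graphs.
  nonplanar : ¬ Planar (Levi (completeUniform 3 (6 + k * 2)))
  nonplanar planar = ℕ.<⇒≱ positive (orientable-bound 0 planar)

theorem1p2 : ((n : ℕ) → 4 ≤ n → 2 ∣ n →
    ∃ λ g → HypergraphHasGenus (completeUniform 3 n) g
    × 24 * g ≡ (n ∸ 2) * (n + 3) * (n ∸ 4))
    × ((n : ℕ) → 6 ≤ n → 2 ∣ n →
    ∃ λ c → HypergraphHasNonOrientableGenus (completeUniform 3 n) c
    × 12 * c ≡ (n ∸ 2) * (n + 3) * (n ∸ 4))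
theorem1p2 =
  (λ { _ () (divides 0 refl)
     ; _ (s≤s (s≤s ())) (divides 1 refl)
     ; _ _ (divides (suc (suc k)) refl) → genus k , Genus.hasGenus k , genus-formula k }) ,
  (λ { _ () (divides 0 refl)
     ; _ (s≤s (s≤s ())) (divides 1 refl)
     ; _ (s≤s (s≤s (s≤s (s≤s ())))) (divides 2 refl)
     ; _ _ (divides (suc (suc (suc k))) refl) → 2 * genus (suc k) , hasNonOrientableGenus k ,
         trans (sym (ℕ.*-assoc 12 2 (genus (suc k)))) (genus-formula (suc k)) })
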